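{- Let $v_1,v_2,v_3,v_4$ be pairwise distinct positive integers with $\gcd(v_1,v_2,v_3,v_4)=1$ and $v_1+v_2+v_3+v_4\ge196$. Then for every $s_1,s_2,s_3,s_4\in\mathbb{R}$ there is some $t\in\mathbb{R}$ such that $\|v_it+s_i\|\ge\frac15$ for every $1\le i\le4$.
   Context: For $x\in\mathbb{R}$, $\|x\|$ denotes the distance from $x$ to a nearest integer. -}

module Defs where

open import Data.Integer.Base as ℤ using (ℤ; +_)
import Data.Integer.DivMod as ℤ
import Data.Integer.Properties as ℤ
open import Data.Nat.Base as ℕ using (ℕ; suc)
import Data.Nat.Properties as ℕ
open import Data.Product.Base using (∃; _×_; _,_; proj₁; proj₂)
open import Data.Rational.Base as ℚ using (ℚ; mkℚ; 0ℚ; 1ℚ; _/_; _+_; _*_; _-_; -_; _≤_; _<_; _⊓_; ∣_∣; floor; ceiling; ↥_; ↧_)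
open import Data.Rational.Properties as ℚ
open import Data.Rational.Solver using (module +-*-Solver)
import Data.Rational.Unnormalised.Base as ℚᵘ
import Data.Rational.Unnormalised.Properties as ℚᵘ
open import Data.Sum.Base using (inj₁; inj₂)
open import Relation.Binary.PropositionalEquality using (_≡_; refl; sym; trans; cong; subst; subst₂)

-- Distance from a rational to a nearest integer: the nearest integer is the
-- floor or the ceiling.
distℤ : ℚ → ℚ
distℤ q = (q - floor q / 1) ⊓ (ceiling q / 1 - q)

private
  fromℤ : ℤ → ℚ
  fromℤ n = n / 1

  p-q+q≡p : ∀ p q → (p - q) + q ≡ p
  p-q+q≡p = solve 2 (λ p q → (p :- q) :+ q := p) refl
    where open +-*-Solver

  fromℤᵘ : ∀ n → ℚ.toℚᵘ (fromℤ n) ℚᵘ.≃ ℚᵘ.mkℚᵘ n 0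
  fromℤᵘ n = toℚᵘ-fromℚᵘ (ℚᵘ.mkℚᵘ n 0)

  fromℤ-≤ : ∀ n q → n ℤ.* ↧ q ℤ.≤ ↥ q → fromℤ n ≤ q
  fromℤ-≤ n q@record{} le = toℚᵘ-cancel-≤ (ℚᵘ.≤-respˡ-≃ (ℚᵘ.≃-sym (fromℤᵘ n))
    (ℚᵘ.*≤* (subst (n ℤ.* ↧ q ℤ.≤_) (sym (ℤ.*-identityʳ (↥ q))) le)))

  fromℤ-≤⁻¹ : ∀ n q → fromℤ n ≤ q → n ℤ.* ↧ q ℤ.≤ ↥ q
  fromℤ-≤⁻¹ n q@record{} le with ℚᵘ.≤-respˡ-≃ (fromℤᵘ n) (toℚᵘ-mono-≤ le)
  ... | ℚᵘ.*≤* h = subst (n ℤ.* ↧ q ℤ.≤_) (ℤ.*-identityʳ (↥ q)) h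

  fromℤ-mono : ∀ {m n} → m ℤ.≤ n → fromℤ m ≤ fromℤ n
  fromℤ-mono {m} {n} le = toℚᵘ-cancel-≤
    (ℚᵘ.≤-respˡ-≃ (ℚᵘ.≃-sym (fromℤᵘ m)) (ℚᵘ.≤-respʳ-≃ (ℚᵘ.≃-sym (fromℤᵘ n))
      (ℚᵘ.*≤* (ℤ.*-monoʳ-≤-nonNeg (+ 1) le))))

  fromℤ-neg : ∀ n → fromℤ (ℤ.- n) ≡ - fromℤ n
  fromℤ-neg n = toℚᵘ-injective (ℚᵘ.≃-trans (fromℤᵘ (ℤ.- n))
    (ℚᵘ.≃-trans (ℚᵘ.-‿cong (ℚᵘ.≃-sym (fromℤᵘ n))) (ℚᵘ.≃-sym (toℚᵘ-homo‿- (fromℤ n)))))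

  floor-≤ : ∀ q → fromℤ (floor q) ≤ q
  floor-≤ q@record{} = fromℤ-≤ (floor q) q (ℤ.[n/d]*d≤n (↥ q) (↧ q))

  floor-greatest : ∀ n q → fromℤ n ≤ q → n ℤ.≤ floor q
  floor-greatest n q@(mkℚ a d-1 _) le =
    subst (n ℤ.≤_) (trans (ℤ.pred-suc (a ℤ./ℕ suc d-1)) (sym (ℤ.div-pos-is-/ℕ a (suc d-1))))
      (ℤ.i<j⇒i≤pred[j] (ℤ.*-cancelʳ-<-nonNeg {j = ℤ.suc (a ℤ./ℕ suc d-1)} (+ suc d-1)
        (ℤ.≤-<-trans (fromℤ-≤⁻¹ n q le) (ℤ.n<s[n/ℕd]*d a (suc d-1)))))

  neg-involutive : ∀ r → - (- r) ≡ r
  neg-involutive = solve 1 (λ r → :- (:- r) := r) refl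
    where open +-*-Solver

  ≤-ceiling : ∀ q → q ≤ fromℤ (ceiling q)
  ≤-ceiling q@record{} = subst₂ _≤_ (neg-involutive q) (sym (fromℤ-neg (floor (- q))))
                           (neg-antimono-≤ (floor-≤ (- q)))

  ceiling-least : ∀ n q → q ≤ fromℤ n → ceiling q ℤ.≤ n
  ceiling-least n q@record{} le = subst (ceiling q ℤ.≤_) (ℤ.neg-involutive n)
    (ℤ.neg-mono-≤ (floor-greatest (ℤ.- n) (- q)
      (subst (_≤ - q) (sym (fromℤ-neg n)) (neg-antimono-≤ le))))

  p≤∣p∣ : ∀ p → p ≤ ∣ p ∣
  p≤∣p∣ p with ≤-total 0ℚ p
  ... | inj₁ 0≤p = ≤-reflexive (sym (0≤p⇒∣p∣≡p 0≤p))
  ... | inj₂ p≤0 = ≤-trans p≤0 (0≤∣p∣ p)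

  ∣p-q∣≡∣q-p∣ : ∀ p q → ∣ p - q ∣ ≡ ∣ q - p ∣
  ∣p-q∣≡∣q-p∣ p q = trans (cong ∣_∣ (swap p q)) (∣-p∣≡∣p∣ (q - p))
    where
    open +-*-Solver
    swap : ∀ p q → p - q ≡ - (q - p)
    swap = solve 2 (λ p q → p :- q := :- (q :- p)) refl

  0≤-⇒∣∣ : ∀ {p q} → q ≤ p → ∣ p - q ∣ ≡ p - q
  0≤-⇒∣∣ {p} {q} le = 0≤p⇒∣p∣≡p (subst (_≤ p - q) (+-inverseʳ q) (+-monoˡ-≤ (- q) le))

distℤ-≤ : ∀ q n → distℤ q ≤ ∣ q - n / 1 ∣
distℤ-≤ q n with ≤-total (n / 1) q
... | inj₁ n≤q = begin
  distℤ q             ≤⟨ p⊓q≤p (q - floor q / 1) (ceiling q / 1 - q) ⟩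
  q - floor q / 1     ≤⟨ +-monoʳ-≤ q (neg-antimono-≤ (fromℤ-mono (floor-greatest n q n≤q))) ⟩
  q - n / 1           ≤⟨ p≤∣p∣ (q - n / 1) ⟩
  ∣ q - n / 1 ∣       ∎
  where open ≤-Reasoning
... | inj₂ q≤n = begin
  distℤ q             ≤⟨ p⊓q≤q (q - floor q / 1) (ceiling q / 1 - q) ⟩
  ceiling q / 1 - q   ≤⟨ +-monoˡ-≤ (- q) (fromℤ-mono (ceiling-least n q q≤n)) ⟩
  n / 1 - q           ≤⟨ p≤∣p∣ (n / 1 - q) ⟩
  ∣ n / 1 - q ∣       ≡⟨ ∣p-q∣≡∣q-p∣ (n / 1) q ⟩
  ∣ q - n / 1 ∣       ∎
  where open ≤-Reasoning

distℤ-attained : ∀ q → ∃ λ n → distℤ q ≡ ∣ q - n / 1 ∣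
distℤ-attained q with ≤-total (q - floor q / 1) (ceiling q / 1 - q)
... | inj₁ le = floor q , trans (p≤q⇒p⊓q≡p le) (sym (0≤-⇒∣∣ (floor-≤ q)))
... | inj₂ ge = ceiling q , trans (p≥q⇒p⊓q≡q ge)
                  (trans (sym (0≤-⇒∣∣ (≤-ceiling q))) (∣p-q∣≡∣q-p∣ (ceiling q / 1) q))

private
  triangle : ∀ p q r → ∣ p - r ∣ ≤ ∣ p - q ∣ + ∣ q - r ∣
  triangle p q r = subst (λ z → ∣ z ∣ ≤ ∣ p - q ∣ + ∣ q - r ∣) (telescope p q r)
                     (∣p+q∣≤∣p∣+∣q∣ (p - q) (q - r))
    where
    open +-*-Solver
    telescope : ∀ p q r → (p - q) + (q - r) ≡ p - r
    telescope = solve 3 (λ p q r → (p :- q) :+ (q :- r) := p :- r) refl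

  distℤ-step : ∀ p q → distℤ p ≤ ∣ p - q ∣ + distℤ q
  distℤ-step p q with distℤ-attained q
  ... | n , eq = ≤-trans (distℤ-≤ p n)
                   (subst (λ z → ∣ p - n / 1 ∣ ≤ ∣ p - q ∣ + z) (sym eq) (triangle p q (n / 1)))

  diff-≤ : ∀ {p q r} → p ≤ r + q → p - q ≤ r
  diff-≤ {p} {q} {r} le = subst (p - q ≤_) (cancel r q) (+-monoˡ-≤ (- q) le)
    where
    open +-*-Solver
    cancel : ∀ r q → (r + q) - q ≡ r
    cancel = solve 2 (λ r q → (r :+ q) :- q := r) refl

  ∣∣-≤ : ∀ {p q r} → p ≤ r + q → q ≤ r + p → ∣ p - q ∣ ≤ r
  ∣∣-≤ {p} {q} {r} h₁ h₂ with ≤-total q p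
  ... | inj₁ q≤p = subst (_≤ r) (sym (0≤-⇒∣∣ q≤p)) (diff-≤ h₁)
  ... | inj₂ p≤q = subst (_≤ r) (sym (trans (∣p-q∣≡∣q-p∣ p q) (0≤-⇒∣∣ p≤q))) (diff-≤ h₂)

distℤ-lipschitz : ∀ p q → ∣ distℤ p - distℤ q ∣ ≤ ∣ p - q ∣
distℤ-lipschitz p q = ∣∣-≤ (distℤ-step p q)
  (subst (λ z → distℤ q ≤ z + distℤ p) (∣p-q∣≡∣q-p∣ q p) (distℤ-step q p))

-- Real numbers as Cauchy sequences of rationals. No quotient is taken: two
-- sequences denote the same real when each is ≤ℝ the other, and everything
-- below respects this.
record ℝ : Set where
  constructor mkℝ
  field
    seq    : ℕ → ℚ
    cauchy : ∀ ε → 0ℚ < ε →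
             ∃ λ N → ∀ m n → N ℕ.≤ m → N ℕ.≤ n → ∣ seq m - seq n ∣ ≤ ε

open ℝ public

infix  4 _≤ℝ_ _≥ℝ_
infixl 6 _+ℝ_
infixl 7 _*ℝ_

_≤ℝ_ : ℝ → ℝ → Set
x ≤ℝ y = ∀ ε → 0ℚ < ε → ∃ λ N → ∀ n → N ℕ.≤ n → seq x n ≤ seq y n + ε

_≥ℝ_ : ℝ → ℝ → Set
x ≥ℝ y = y ≤ℝ x

fromℚ : ℚ → ℝ
fromℚ q .seq _ = q
fromℚ q .cauchy ε 0<ε = 0 , λ _ _ _ _ → subst (λ z → ∣ z ∣ ≤ ε) (sym (+-inverseʳ q)) (<⇒≤ 0<ε)

fromℕ : ℕ → ℝ
fromℕ n = fromℚ (+ n / 1)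

private
  -- A positive δ with c * δ ≡ ε.
  scale : ∀ c ε → 0ℚ < c → 0ℚ < ε → ∃ λ δ → 0ℚ < δ × c * δ ≡ ε
  scale c ε 0<c 0<ε = δ , positive⁻¹ δ {{δ-pos}} , eq
    where
    instance
      c-pos = ℚ.positive 0<c
      ε-pos = ℚ.positive 0<ε
      c-nonZero = pos⇒nonZero c
      1/c-pos = 1/pos⇒pos c
    δ = ℚ.1/ c * ε
    δ-pos = pos*pos⇒pos (ℚ.1/ c) ε
    eq : c * δ ≡ ε
    eq = trans (sym (*-assoc c (ℚ.1/ c) ε))
           (trans (cong (_* ε) (*-inverseʳ c)) (*-identityˡ ε))

  0<1 : 0ℚ < 1ℚ
  0<1 = positive⁻¹ 1ℚ

  bound : (x : ℝ) → ∃ λ B → 0ℚ < B × ∃ λ N → ∀ n → N ℕ.≤ n → ∣ seq x n ∣ ≤ B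
  bound x with cauchy x 1ℚ 0<1
  ... | N , close = 1ℚ + ∣ seq x N ∣ , 0<B , N , below
    where
    0<B : 0ℚ < 1ℚ + ∣ seq x N ∣
    0<B = subst (_< 1ℚ + ∣ seq x N ∣) (+-identityʳ 0ℚ) (+-mono-<-≤ 0<1 (0≤∣p∣ (seq x N)))
    below : ∀ n → N ℕ.≤ n → ∣ seq x n ∣ ≤ 1ℚ + ∣ seq x N ∣
    below n N≤n = ≤-trans
      (subst (λ z → ∣ z ∣ ≤ ∣ seq x n - seq x N ∣ + ∣ seq x N ∣) (p-q+q≡p (seq x n) (seq x N))
        (∣p+q∣≤∣p∣+∣q∣ (seq x n - seq x N) (seq x N)))
      (+-monoˡ-≤ ∣ seq x N ∣ (close n N N≤n ℕ.≤-refl))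

_+ℝ_ : ℝ → ℝ → ℝ
(x +ℝ y) .seq n = seq x n + seq y n
(x +ℝ y) .cauchy ε 0<ε = M ℕ.⊔ N , close
  where
  half = scale (1ℚ + 1ℚ) ε (positive⁻¹ (1ℚ + 1ℚ)) 0<ε
  δ = proj₁ half
  cx = cauchy x δ (proj₁ (proj₂ half))
  cy = cauchy y δ (proj₁ (proj₂ half))
  M = proj₁ cx
  N = proj₁ cy
  open +-*-Solver
  regroup : ∀ a b c d → (a - b) + (c - d) ≡ (a + c) - (b + d)
  regroup = solve 4 (λ a b c d → (a :- b) :+ (c :- d) := (a :+ c) :- (b :+ d)) refl
  double : ∀ d → (1ℚ + 1ℚ) * d ≡ d + d
  double = solve 1 (λ d → con (1ℚ + 1ℚ) :* d := d :+ d) refl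
  close : ∀ m n → M ℕ.⊔ N ℕ.≤ m → M ℕ.⊔ N ℕ.≤ n → ∣ (seq x m + seq y m) - (seq x n + seq y n) ∣ ≤ ε
  close m n hm hn = begin
    ∣ (seq x m + seq y m) - (seq x n + seq y n) ∣
      ≡⟨ cong ∣_∣ (regroup (seq x m) (seq x n) (seq y m) (seq y n)) ⟨
    ∣ (seq x m - seq x n) + (seq y m - seq y n) ∣
      ≤⟨ ∣p+q∣≤∣p∣+∣q∣ (seq x m - seq x n) (seq y m - seq y n) ⟩
    ∣ seq x m - seq x n ∣ + ∣ seq y m - seq y n ∣
      ≤⟨ +-mono-≤ (proj₂ cx m n (ℕ.m⊔n≤o⇒m≤o M N hm) (ℕ.m⊔n≤o⇒m≤o M N hn))
                  (proj₂ cy m n (ℕ.m⊔n≤o⇒n≤o M N hm) (ℕ.m⊔n≤o⇒n≤o M N hn)) ⟩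
    δ + δ
      ≡⟨ trans (sym (double δ)) (proj₂ (proj₂ half)) ⟩
    ε ∎
    where open ≤-Reasoning

_*ℝ_ : ℝ → ℝ → ℝ
(x *ℝ y) .seq n = seq x n * seq y n
(x *ℝ y) .cauchy ε 0<ε = K , close
  where
  bx = bound x
  by = bound y
  A = proj₁ bx
  B = proj₁ by
  0<A = proj₁ (proj₂ bx)
  0<B = proj₁ (proj₂ by)
  δs = scale (A + B) ε (subst (_< A + B) (+-identityʳ 0ℚ) (+-mono-< 0<A 0<B)) 0<ε
  δ = proj₁ δs
  0<δ = proj₁ (proj₂ δs)
  cx = cauchy x δ 0<δ
  cy = cauchy y δ 0<δ
  Nx = proj₁ (proj₂ (proj₂ bx))
  Ny = proj₁ (proj₂ (proj₂ by))
  Mx = proj₁ cx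
  My = proj₁ cy
  K = (Nx ℕ.⊔ Ny) ℕ.⊔ (Mx ℕ.⊔ My)
  open +-*-Solver
  regroup : ∀ a b c d → a * (c - d) + d * (a - b) ≡ a * c - b * d
  regroup = solve 4 (λ a b c d → a :* (c :- d) :+ d :* (a :- b) := a :* c :- b :* d) refl
  product-≤ : ∀ {p q a} → ∣ p ∣ ≤ a → 0ℚ < a → ∣ q ∣ ≤ δ → ∣ p * q ∣ ≤ a * δ
  product-≤ {p} {q} {a} p≤a 0<a q≤δ = begin
    ∣ p * q ∣       ≡⟨ ∣p*q∣≡∣p∣*∣q∣ p q ⟩
    ∣ p ∣ * ∣ q ∣   ≤⟨ *-monoʳ-≤-nonNeg ∣ q ∣ {{∣-∣-nonNeg q}} p≤a ⟩
    a * ∣ q ∣       ≤⟨ *-monoˡ-≤-nonNeg a {{ℚ.nonNegative (<⇒≤ 0<a)}} q≤δ ⟩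
    a * δ           ∎
    where open ≤-Reasoning
  close : ∀ m n → K ℕ.≤ m → K ℕ.≤ n → ∣ seq x m * seq y m - seq x n * seq y n ∣ ≤ ε
  close m n hm hn = begin
    ∣ seq x m * seq y m - seq x n * seq y n ∣
      ≡⟨ cong ∣_∣ (regroup (seq x m) (seq x n) (seq y m) (seq y n)) ⟨
    ∣ seq x m * (seq y m - seq y n) + seq y n * (seq x m - seq x n) ∣
      ≤⟨ ∣p+q∣≤∣p∣+∣q∣ (seq x m * (seq y m - seq y n)) (seq y n * (seq x m - seq x n)) ⟩
    ∣ seq x m * (seq y m - seq y n) ∣ + ∣ seq y n * (seq x m - seq x n) ∣
      ≤⟨ +-mono-≤
           (product-≤ {seq x m} {seq y m - seq y n} (proj₂ (proj₂ (proj₂ bx)) m (ℕ.m⊔n≤o⇒m≤o Nx Ny (lower hm))) 0<A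
             (proj₂ cy m n (ℕ.m⊔n≤o⇒n≤o Mx My (upper hm)) (ℕ.m⊔n≤o⇒n≤o Mx My (upper hn))))
           (product-≤ {seq y n} {seq x m - seq x n} (proj₂ (proj₂ (proj₂ by)) n (ℕ.m⊔n≤o⇒n≤o Nx Ny (lower hn))) 0<B
             (proj₂ cx m n (ℕ.m⊔n≤o⇒m≤o Mx My (upper hm)) (ℕ.m⊔n≤o⇒m≤o Mx My (upper hn)))) ⟩
    A * δ + B * δ
      ≡⟨ trans (sym (*-distribʳ-+ δ A B)) (proj₂ (proj₂ δs)) ⟩
    ε ∎
    where
    open ≤-Reasoning
    lower : ∀ {k} → K ℕ.≤ k → Nx ℕ.⊔ Ny ℕ.≤ k
    lower = ℕ.m⊔n≤o⇒m≤o (Nx ℕ.⊔ Ny) (Mx ℕ.⊔ My)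
    upper : ∀ {k} → K ℕ.≤ k → Mx ℕ.⊔ My ℕ.≤ k
    upper = ℕ.m⊔n≤o⇒n≤o (Nx ℕ.⊔ Ny) (Mx ℕ.⊔ My)

-- Distance from a real to a nearest integer, as the continuous extension of
-- distℤ: it is 1-Lipschitz, so it may be applied termwise.  (A nearest integer
-- of a Cauchy sequence cannot be selected constructively.)
‖_‖ : ℝ → ℝ
‖ x ‖ .seq n = distℤ (seq x n)
‖ x ‖ .cauchy ε 0<ε with cauchy x ε 0<ε
... | N , close = N , λ m n hm hn →
  ≤-trans (distℤ-lipschitz (seq x m) (seq x n)) (close m n hm hn)

{-# OPTIONS --safe #-}
-- The points at distance at least 1/5 from ℤ in every coordinate are those within 3/10 of
-- (½,½,½,½) modulo ℤ⁴, so an arbitrary point of ℚ⁴ has to be approximated within 3/10 by points of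
-- ℚ v + ℤ⁴.  Complete v to a unimodular flag v, w, c, d and let S = ∣ v ∣₁, A = ∣ v ∧ w ∣₁ and
-- K = ∣ v ∧ w ∧ c ∣₁.  Rounding successively along d, c and w costs ½ (1/K + K/A + A/S).
-- Alternating Gauss reductions of the pairs (c , d) and (w , c) achieve K² ≤ 2A and A² ≤ 2SK, and
-- K ≥ 3 because the vᵢ are distinct; for S ≥ 196 this keeps the cost below 3/10, unless 10 A < S.
-- In that case it suffices to approximate within ¼ by the plane ℚ v + ℚ w modulo ℤ⁴, since rounding
-- along w then costs less than 1/20.  This is a problem about four runners with two-dimensional time.
-- A line on which one runner stands still reduces it to three runners with distinct speeds, unless
-- there are coincidences among the 2 × 2 minors, which by Plücker's relation force two of the runners
-- into the directions of the sum and of the difference of the other two.  As all bounds are strict,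
-- rational approximations may replace the real shifts.
module Submission where

open import Defs

-- Errors are measured in the sup norm on ℚ⁴, whose dual is the ℓ¹ norm. This is why the volumes of
-- the flag are ℓ¹ norms of exterior products: each rounding then costs exactly ½ times a ratio of
-- consecutive volumes. The factor 2 in both reduction inequalities comes from a planar zonotope and
-- a hexagon spanned by six of its points.
--
-- The obstacle is a small A. The values K = 3 and A = 5 satisfy K² ≤ 2A, and yet ½ (1/K + K/A) =
-- 7/15 exceeds 3/10, however large S may be. The orbit of v then nearly fills a two-dimensional
-- subtorus, and rounding along d and c has to give way to an exact argument in the plane of v and
-- w. The radius ¼ of that argument is the one that three runners with distinct speeds attain; the
-- threshold 10 A < S says that ½ A/S fits into the remaining 3/10 - ¼. For S ≤ 10 A, conversely, A
-- is large enough to control K/A.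

module Integral where

  open import Data.Fin.Base using (Fin)
  open import Data.Fin.Patterns using (0F; 1F)
  open import Data.Fin.Properties using (all?)
  open import Data.Integer.Base as ℤ using (ℤ; +_; -[1+_]; 0ℤ; 1ℤ; _+_; _*_; _-_; -_; _≤_; _<_; ∣_∣; +≤+)
  open import Data.Integer.Properties as ℤ using
    (≤-trans; ≤-refl; ≤-reflexive; ≤-total; <⇒≤; ≰⇒>; ≮⇒≥; _≤?_; _<?_; +-mono-≤)
  open import Data.Integer.Solver using (module +-*-Solver)
  open import Data.Integer.Tactic.RingSolver using (solve-∀)
  open import Data.List.Base using (List; []; _∷_; map)
  open import Data.List.Relation.Unary.All using (All; []; _∷_)
  open import Data.List.Relation.Unary.AllPairs.Core using (AllPairs; []; _∷_)
  open import Data.Nat.Base as ℕ using (ℕ; zero; suc)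
  import Data.Nat.Divisibility as ℕ
  import Data.Nat.GCD as ℕ
  import Data.Nat.Properties as ℕ
  import Data.Nat.Tactic.RingSolver as ℕR
  open import Data.Product.Base using (∃₂; ∃-syntax; _×_; _,_; proj₁; proj₂)
  open import Data.Sum.Base using (_⊎_; inj₁; inj₂; [_,_]′)
  open import Relation.Binary.PropositionalEquality using (_≡_; _≢_; refl; sym; trans; cong; cong₂; subst; subst₂)
  open import Relation.Nullary using (¬_; yes; no; contradiction)
  open import Relation.Nullary.Decidable using (from-yes)
  open +-*-Solver using (solve; Polynomial; con; _:=_; _:+_; _:*_; _:-_; :-_)

  -- Order and absolute value on the integers

  0≤-+ : ∀ {x y} → 0ℤ ≤ x → 0ℤ ≤ y → 0ℤ ≤ x + y
  0≤-+ = +-mono-≤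

  0≤-* : ∀ {x y} → 0ℤ ≤ x → 0ℤ ≤ y → 0ℤ ≤ x * y
  0≤-* {+ m} {+ n} _ _ = subst (0ℤ ≤_) (ℤ.pos-* m n) (+≤+ ℕ.z≤n)

  ≤⇒0≤- : ∀ {x y} → x ≤ y → 0ℤ ≤ y - x
  ≤⇒0≤- = ℤ.i≤j⇒0≤j-i

  0≤-⇒≤ : ∀ {x y e} → 0ℤ ≤ e → e ≡ y - x → x ≤ y
  0≤-⇒≤ p refl = ℤ.0≤i-j⇒j≤i p

  ∥_∥ : ℤ → ℤ
  ∥ x ∥ = + ∣ x ∣

  0≤∥∥ : ∀ x → 0ℤ ≤ ∥ x ∥
  0≤∥∥ x = +≤+ ℕ.z≤n

  x≤∥x∥ : ∀ x → x ≤ ∥ x ∥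
  x≤∥x∥ (+ n) = ≤-refl
  x≤∥x∥ -[1+ n ] = ℤ.-≤+

  -x≤∥x∥ : ∀ x → - x ≤ ∥ x ∥
  -x≤∥x∥ x = subst (- x ≤_) (cong +_ (ℤ.∣-i∣≡∣i∣ x)) (x≤∥x∥ (- x))

  ∥∥-* : ∀ x y → ∥ x * y ∥ ≡ ∥ x ∥ * ∥ y ∥
  ∥∥-* x y = trans (cong +_ (ℤ.abs-* x y)) (ℤ.pos-* ∣ x ∣ ∣ y ∣)

  ∥∥-+ : ∀ x y → ∥ x + y ∥ ≤ ∥ x ∥ + ∥ y ∥
  ∥∥-+ x y = +≤+ (ℤ.∣i+j∣≤∣i∣+∣j∣ x y)

  ∥∥-neg : ∀ x → ∥ - x ∥ ≡ ∥ x ∥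
  ∥∥-neg x = cong +_ (ℤ.∣-i∣≡∣i∣ x)

  -- Gauss reduction; a pair of vectors a, b is given as the list of the pairs (aᵢ , bᵢ)

  sg : Fin 2 → ℤ
  sg 0F = 1ℤ
  sg 1F = - 1ℤ

  sign : ℤ → Fin 2
  sign (+ _) = 0F
  sign -[1+ _ ] = 1F

  sgn : ℤ → ℤ
  sgn x = sg (sign x)

  sgn-* : ∀ x → sgn x * x ≡ ∥ x ∥
  sgn-* (+ n) = ℤ.*-identityˡ (+ n)
  sgn-* -[1+ n ] = ℤ.-1*i≡-i -[1+ n ]

  sg-*-≤ : ∀ i x → sg i * x ≤ ∥ x ∥
  sg-*-≤ 0F x = subst (_≤ ∥ x ∥) (sym (ℤ.*-identityˡ x)) (x≤∥x∥ x)
  sg-*-≤ 1F x = subst (_≤ ∥ x ∥) (sym (ℤ.-1*i≡-i x)) (-x≤∥x∥ x)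

  Pair : Set
  Pair = ℤ × ℤ

  infix 7 _⨯_
  _⨯_ : Pair → Pair → ℤ
  (a , b) ⨯ (a′ , b′) = a * b′ - b * a′

  sum : (Pair → ℤ) → List Pair → ℤ
  sum f [] = 0ℤ
  sum f (p ∷ ps) = f p + sum f ps

  -- The ℓ¹ norms of a, of b and of the bivector a ∧ b.
  norm₁ norm₂ area : List Pair → ℤ
  norm₁ = sum (λ p → ∥ proj₁ p ∥)
  norm₂ = sum (λ p → ∥ proj₂ p ∥)
  area [] = 0ℤ
  area (p ∷ ps) = sum (λ q → ∥ p ⨯ q ∥) ps + area ps

  shear : ℤ → List Pair → List Pair
  shear r = map (λ (a , b) → a , b + r * a)

  sum-mono : ∀ {f g} → (∀ p → f p ≤ g p) → ∀ ps → sum f ps ≤ sum g ps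
  sum-mono f≤g [] = ≤-refl
  sum-mono f≤g (p ∷ ps) = +-mono-≤ (f≤g p) (sum-mono f≤g ps)

  sum-+ : ∀ f g ps → sum (λ p → f p + g p) ps ≡ sum f ps + sum g ps
  sum-+ f g [] = refl
  sum-+ f g (p ∷ ps) = trans (cong (λ z → f p + g p + z) (sum-+ f g ps)) (lem (f p) (g p) (sum f ps) (sum g ps))
    where
    lem = solve 4 (λ a b c d → a :+ b :+ (c :+ d) := a :+ c :+ (b :+ d)) refl

  sum-neg : ∀ f ps → sum (λ p → - f p) ps ≡ - sum f ps
  sum-neg f [] = refl
  sum-neg f (p ∷ ps) = trans (cong (λ z → - f p + z) (sum-neg f ps)) (sym (ℤ.neg-distrib-+ (f p) (sum f ps)))

  sum-map : ∀ f g ps → sum f (map g ps) ≡ sum (λ p → f (g p)) ps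
  sum-map f g [] = refl
  sum-map f g (p ∷ ps) = cong (λ z → f (g p) + z) (sum-map f g ps)

  sum-cong : ∀ {f g} → (∀ p → f p ≡ g p) → ∀ ps → sum f ps ≡ sum g ps
  sum-cong f≡g [] = refl
  sum-cong f≡g (p ∷ ps) = cong₂ _+_ (f≡g p) (sum-cong f≡g ps)

  sum-nonNeg : ∀ {f} → (∀ p → 0ℤ ≤ f p) → ∀ ps → 0ℤ ≤ sum f ps
  sum-nonNeg 0≤f [] = ≤-refl
  sum-nonNeg 0≤f (p ∷ ps) = 0≤-+ (0≤f p) (sum-nonNeg 0≤f ps)

  area-map : ∀ g → (∀ p q → ∥ g p ⨯ g q ∥ ≡ ∥ p ⨯ q ∥) → ∀ ps → area (map g ps) ≡ area ps
  area-map g inv [] = refl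
  area-map g inv (p ∷ ps) =
    cong₂ _+_ (trans (sum-map (λ q → ∥ g p ⨯ q ∥) g ps) (sum-cong (inv p) ps)) (area-map g inv ps)

  area-shear : ∀ r ps → area (shear r ps) ≡ area ps
  area-shear r = area-map _ λ (a , b) (a′ , b′) → cong ∥_∥ (lem r a b a′ b′)
    where
    lem = solve 5 (λ r a b a′ b′ → a :* (b′ :+ r :* a′) :- (b :+ r :* a) :* a′ := a :* b′ :- b :* a′) refl

  norm₁-shear : ∀ r ps → norm₁ (shear r ps) ≡ norm₁ ps
  norm₁-shear r ps = sum-map _ _ ps

  shear-shear : ∀ r r′ ps → shear r (shear r′ ps) ≡ shear (r′ + r) ps
  shear-shear r r′ [] = refl
  shear-shear r r′ ((a , b) ∷ ps) = cong₂ _∷_ (cong (a ,_) (lem r r′ a b)) (shear-shear r r′ ps)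
    where
    lem = solve 4 (λ r r′ a b → b :+ r′ :* a :+ r :* a := b :+ (r′ :+ r) :* a) refl

  -- With signs ε₀, ε₁, ε₂ those of a, b and a + b, the points Qᵢ = Σ εᵢ p of the
  -- zonotope Σ [- p , p], of area 4 Σ ∣ p ⨯ q ∣, span a hexagon ± Q₀, ± Q₂, ± Q₁.

  private
    ε₀ ε₁ ε₂ : Pair → Fin 2
    ε₀ (a , b) = sign a
    ε₁ (a , b) = sign b
    ε₂ (a , b) = sign (a + b)

    A₀ B₀ A₁ B₁ A₂ B₂ hexagon : List Pair → ℤ
    A₀ = sum (λ p → sg (ε₀ p) * proj₁ p)
    B₀ = sum (λ p → sg (ε₀ p) * proj₂ p)
    A₁ = sum (λ p → sg (ε₁ p) * proj₁ p)
    B₁ = sum (λ p → sg (ε₁ p) * proj₂ p)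
    A₂ = sum (λ p → sg (ε₂ p) * proj₁ p)
    B₂ = sum (λ p → sg (ε₂ p) * proj₂ p)
    hexagon ps = A₀ ps * B₂ ps - B₀ ps * A₂ ps + (A₂ ps * B₁ ps - B₂ ps * A₁ ps) - (A₁ ps * B₀ ps - B₁ ps * A₀ ps)

    coefficient : (i j k i′ j′ k′ : Fin 2) → ℤ
    coefficient i j k i′ j′ k′ = (sg i - sg j) * sg k′ + (sg k + sg i) * sg j′ - (sg k + sg j) * sg i′

    -- Of the factors `sg i - sg j`, `sg k + sg i`, `sg k + sg j` at most two are nonzero, and these
    -- are ± 2. The 64 sign patterns are simply evaluated.
    ∥coefficient∥≤4 : ∀ i j k i′ j′ k′ → ∥ coefficient i j k i′ j′ k′ ∥ ≤ + 4
    ∥coefficient∥≤4 = from-yes (all? λ i → all? λ j → all? λ k → all? λ i′ → all? λ j′ → all? λ k′ →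
      ∥ coefficient i j k i′ j′ k′ ∥ ≤? + 4)

    -- The growth of `hexagon` when the generator `p` is added to `ps`.
    edges : Pair → List Pair → ℤ
    edges p@(a , b) ps = (sg (ε₀ p) - sg (ε₁ p)) * (a * B₂ ps - b * A₂ ps)
      + (sg (ε₂ p) + sg (ε₀ p)) * (a * B₁ ps - b * A₁ ps)
                         - (sg (ε₂ p) + sg (ε₁ p)) * (a * B₀ ps - b * A₀ ps)

    edges-≤ : ∀ p ps → edges p ps ≤ + 4 * sum (λ q → ∥ p ⨯ q ∥) ps
    edges-≤ p [] = ≤-reflexive (lem (sg (ε₀ p)) (sg (ε₁ p)) (sg (ε₂ p)) (proj₁ p) (proj₂ p))
      where
      lem = solve 5 (λ e₀ e₁ e₂ a b →
        (e₀ :- e₁) :* (a :* con 0ℤ :- b :* con 0ℤ) :+ (e₂ :+ e₀) :* (a :* con 0ℤ :- b :* con 0ℤ)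
        :- (e₂ :+ e₁) :* (a :* con 0ℤ :- b :* con 0ℤ) := con (+ 4) :* con 0ℤ) refl
    edges-≤ p@(a , b) (q@(c , d) ∷ ps) = subst₂ _≤_
      (sym (lem (sg (ε₀ p)) (sg (ε₁ p)) (sg (ε₂ p)) a b (sg (ε₀ q)) (sg (ε₁ q)) (sg (ε₂ q)) c d (A₀ ps) (B₀ ps) (A₁ ps)
        (B₁ ps) (A₂ ps) (B₂ ps)))
      (sym (ℤ.*-distribˡ-+ (+ 4) ∥ p ⨯ q ∥ (sum (λ q → ∥ p ⨯ q ∥) ps)))
      (+-mono-≤ (≤-trans (x≤∥x∥ (c₀ * (p ⨯ q))) (subst (_≤ + 4 * ∥ p ⨯ q ∥) (sym (∥∥-* c₀ (p ⨯ q)))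
          (ℤ.*-monoʳ-≤-nonNeg ∥ p ⨯ q ∥ (∥coefficient∥≤4 (ε₀ p) (ε₁ p) (ε₂ p) (ε₀ q) (ε₁ q) (ε₂ q)))))
        (edges-≤ p ps))
      where
      c₀ = coefficient (ε₀ p) (ε₁ p) (ε₂ p) (ε₀ q) (ε₁ q) (ε₂ q)
      lem = solve 16 (λ e₀ e₁ e₂ a b f₀ f₁ f₂ c d A₀ B₀ A₁ B₁ A₂ B₂ →
        (e₀ :- e₁) :* (a :* (f₂ :* d :+ B₂) :- b :* (f₂ :* c :+ A₂))
          :+ (e₂ :+ e₀) :* (a :* (f₁ :* d :+ B₁) :- b :* (f₁ :* c :+ A₁))
          :- (e₂ :+ e₁) :* (a :* (f₀ :* d :+ B₀) :- b :* (f₀ :* c :+ A₀))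
        := ((e₀ :- e₁) :* f₂ :+ (e₂ :+ e₀) :* f₁ :- (e₂ :+ e₁) :* f₀) :* (a :* d :- b :* c)
          :+ ((e₀ :- e₁) :* (a :* B₂ :- b :* A₂) :+ (e₂ :+ e₀) :* (a :* B₁ :- b :* A₁)
            :- (e₂ :+ e₁) :* (a :* B₀ :- b :* A₀))) refl

    -- The hexagon is contained in the zonotope. Both areas are sums over pairs of generators, and
    -- the inequality already holds pair by pair.
    hexagon-≤ : ∀ ps → hexagon ps ≤ + 4 * area ps
    hexagon-≤ [] = ≤-refl
    hexagon-≤ (p@(a , b) ∷ ps) = subst₂ _≤_
      (sym (lem (sg (ε₀ p)) (sg (ε₁ p)) (sg (ε₂ p)) a b (A₀ ps) (B₀ ps) (A₁ ps) (B₁ ps) (A₂ ps) (B₂ ps)))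
      (sym (ℤ.*-distribˡ-+ (+ 4) (sum (λ q → ∥ p ⨯ q ∥) ps) (area ps)))
      (+-mono-≤ (edges-≤ p ps) (hexagon-≤ ps))
      where
      lem = solve 11 (λ e₀ e₁ e₂ a b A₀ B₀ A₁ B₁ A₂ B₂ →
        (e₀ :* a :+ A₀) :* (e₂ :* b :+ B₂) :- (e₀ :* b :+ B₀) :* (e₂ :* a :+ A₂)
          :+ ((e₂ :* a :+ A₂) :* (e₁ :* b :+ B₁) :- (e₂ :* b :+ B₂) :* (e₁ :* a :+ A₁))
          :- ((e₁ :* a :+ A₁) :* (e₀ :* b :+ B₀) :- (e₁ :* b :+ B₁) :* (e₀ :* a :+ A₀))
        := ((e₀ :- e₁) :* (a :* B₂ :- b :* A₂) :+ (e₂ :+ e₀) :* (a :* B₁ :- b :* A₁)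
          :- (e₂ :+ e₁) :* (a :* B₀ :- b :* A₀))
          :+ (A₀ :* B₂ :- B₀ :* A₂ :+ (A₂ :* B₁ :- B₂ :* A₁) :- (A₁ :* B₀ :- B₁ :* A₀))) refl

    -- Here Q₀ = (k , b₀), Q₁ = (a₁ , n₁) and Q₂ = (a₂ , n₂ - a₂). The area is affine in `b₀` with
    -- slope `- a₁ - a₂`; the sign of the slope decides whether the lower bound `- n₁` or the upper
    -- bound `n₂ - k` of `b₀` is inserted. What remains is a sum of products of nonnegative
    -- differences.
    hexagon-≥ : ∀ k b₀ a₁ n₁ a₂ n₂ → 0ℤ ≤ - a₁ → - a₁ ≤ k → 0ℤ ≤ a₂ → a₂ ≤ k → k ≤ n₁ → k ≤ n₂ → k + b₀ ≤ n₂ → - n₁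
      ≤ b₀ →
                + 2 * (k * k) ≤ k * (n₂ - a₂) - b₀ * a₂ + (a₂ * n₁ - (n₂ - a₂) * a₁) - (a₁ * b₀ - n₁ * k)
    hexagon-≥ k b₀ a₁ n₁ a₂ n₂ h₁ h₂ h₃ h₄ h₅ h₆ h₇ h₈ = [ below , above ]′ (≤-total a₂ (- a₁))
      where
      T = k * (n₂ - a₂) - b₀ * a₂ + (a₂ * n₁ - (n₂ - a₂) * a₁) - (a₁ * b₀ - n₁ * k)
      below : a₂ ≤ - a₁ → + 2 * (k * k) ≤ T
      below h = 0≤-⇒≤
          (0≤-+ (0≤-+ (0≤-+ (0≤-+ (0≤-+ (0≤-* (≤⇒0≤- h₅) (≤⇒0≤- h₂)) (0≤-* (+≤+ (ℕ.z≤n {2})) (0≤-* h₃ (≤⇒0≤- h₅))))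
            (0≤-* (≤-trans h₁ h₂) (≤⇒0≤- h₆)))
            (0≤-* h₁ (≤⇒0≤- h₆))) (0≤-* h₃ (≤⇒0≤- h₂))) (0≤-* (≤⇒0≤- h₈) (≤⇒0≤- h)))
          (lem k b₀ a₁ n₁ a₂ n₂)
        where
        lem = solve 6 (λ k b₀ a₁ n₁ a₂ n₂ →
         (n₁ :- k) :* (k :- :- a₁) :+ con (+ 2) :* (a₂ :* (n₁ :- k)) :+ k :* (n₂ :- k) :+ :- a₁ :* (n₂ :- k)
           :+ a₂ :* (k :- :- a₁) :+ (b₀ :- :- n₁) :* (:- a₁ :- a₂)
         := k :* (n₂ :- a₂) :- b₀ :* a₂ :+ (a₂ :* n₁ :- (n₂ :- a₂) :* a₁) :- (a₁ :* b₀ :- n₁ :* k)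
           :- con (+ 2) :* (k :* k)) refl
      above : - a₁ ≤ a₂ → + 2 * (k * k) ≤ T
      above h = 0≤-⇒≤
          (0≤-+ (0≤-+ (0≤-+ (0≤-+ (0≤-+ (0≤-* (≤-trans h₁ h₂) (≤⇒0≤- h₅)) (0≤-* h₃ (≤⇒0≤- h₅)))
            (0≤-* (≤⇒0≤- h₆) (≤⇒0≤- h₄)))
            (0≤-* (+≤+ (ℕ.z≤n {2})) (0≤-* h₁ (≤⇒0≤- h₆)))) (0≤-* h₁ (≤⇒0≤- h₄))) (0≤-* (≤⇒0≤- h₇) (≤⇒0≤- h)))
          (lem k b₀ a₁ n₁ a₂ n₂)
        where
        lem = solve 6 (λ k b₀ a₁ n₁ a₂ n₂ →
         k :* (n₁ :- k) :+ a₂ :* (n₁ :- k) :+ (n₂ :- k) :* (k :- a₂) :+ con (+ 2) :* (:- a₁ :* (n₂ :- k))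
           :+ :- a₁ :* (k :- a₂) :+ (n₂ :- (k :+ b₀)) :* (a₂ :- :- a₁)
         := k :* (n₂ :- a₂) :- b₀ :* a₂ :+ (a₂ :* n₁ :- (n₂ :- a₂) :* a₁) :- (a₁ :* b₀ :- n₁ :* k)
           :- con (+ 2) :* (k :* k)) refl

    -- Q₀, Q₁ and Q₂ maximise the first coordinate, the second coordinate and their sum on the
    -- zonotope, and the maxima are the norms of a, b and a + b. Minimality of the norms thus pushes
    -- these points outwards, and the areas compare as 2 k² ≤ hexagon ≤ 4 `area`.
    reduced : ∀ ps → norm₁ ps ≤ norm₂ ps → norm₂ ps ≤ norm₂ (shear 1ℤ ps) → A₁ ps ≤ 0ℤ → norm₁ ps * norm₁ ps
      ≤ + 2 * area ps
    reduced ps k≤n₁ n₁≤n₂ a₁≤0 =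
      ℤ.*-cancelˡ-≤-pos (norm₁ ps * norm₁ ps) (+ 2 * area ps) (+ 2)
      (subst (+ 2 * (norm₁ ps * norm₁ ps) ≤_) (lem (area ps))
      (≤-trans (hexagon-≥ (norm₁ ps) (B₀ ps) (A₁ ps) (norm₂ ps) (A₂ ps) n₂ (ℤ.neg-mono-≤ a₁≤0) -a₁≤k
         0≤a₂ (sum-mono (λ p → sg-*-≤ (ε₂ p) (proj₁ p)) ps) k≤n₁ (≤-trans k≤n₁ n₁≤n₂′) k+b₀≤n₂ -n₁≤b₀)
       (subst (_≤ + 4 * area ps) hexagon≡ (hexagon-≤ ps))))
      where
      n₂ = sum (λ p → ∥ proj₁ p + proj₂ p ∥) ps
      n₂≡ : norm₂ (shear 1ℤ ps) ≡ n₂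
      n₂≡ = trans (sum-map _ _ ps)
        (sum-cong (λ (a , b) → cong ∥_∥ (trans (cong (λ z → b + z) (ℤ.*-identityˡ a)) (ℤ.+-comm b a))) ps)
      n₁≤n₂′ : norm₂ ps ≤ n₂
      n₁≤n₂′ = subst (norm₂ ps ≤_) n₂≡ n₁≤n₂
      A₀≡ : A₀ ps ≡ norm₁ ps
      A₀≡ = sum-cong (λ (a , b) → sgn-* a) ps
      B₁≡ : B₁ ps ≡ norm₂ ps
      B₁≡ = sum-cong (λ (a , b) → sgn-* b) ps
      A₂+B₂≡ : A₂ ps + B₂ ps ≡ n₂
      A₂+B₂≡ = trans (sym (sum-+ _ _ ps))
        (sum-cong (λ (a , b) → trans (sym (ℤ.*-distribˡ-+ (sgn (a + b)) a b)) (sgn-* (a + b))) ps)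
      l₀ : ∀ a b → b ≡ a + b - a
      l₀ = solve-∀
      B₂≡ : B₂ ps ≡ n₂ - A₂ ps
      B₂≡ = trans (l₀ (A₂ ps) (B₂ ps)) (cong (_- A₂ ps) A₂+B₂≡)
      hexagon≡ : hexagon ps ≡ norm₁ ps * (n₂ - A₂ ps) - B₀ ps * A₂ ps + (A₂ ps * norm₂ ps - (n₂ - A₂ ps) * A₁ ps)
        - (A₁ ps * B₀ ps - norm₂ ps * norm₁ ps)
      hexagon≡ = trans (cong₂ (λ x y →
        x * B₂ ps - B₀ ps * A₂ ps + (A₂ ps * y - B₂ ps * A₁ ps) - (A₁ ps * B₀ ps - y * x)) A₀≡ B₁≡)
        (cong (λ z → norm₁ ps * z - B₀ ps * A₂ ps + (A₂ ps * norm₂ ps - z * A₁ ps)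
          - (A₁ ps * B₀ ps - norm₂ ps * norm₁ ps)) B₂≡)
      -a₁≤k : - A₁ ps ≤ norm₁ ps
      -a₁≤k = subst (_≤ norm₁ ps) (sum-neg _ ps)
        (sum-mono (λ (a , b) → subst₂ _≤_ (sym (ℤ.neg-distribʳ-* (sgn b) a)) (∥∥-neg a) (sg-*-≤ (sign b) (- a))) ps)
      -n₁≤b₀ : - norm₂ ps ≤ B₀ ps
      -n₁≤b₀ = subst (- norm₂ ps ≤_) (ℤ.neg-involutive (B₀ ps)) (ℤ.neg-mono-≤
        (subst (_≤ norm₂ ps) (sum-neg _ ps)
          (sum-mono (λ (a , b) → subst₂ _≤_ (sym (ℤ.neg-distribʳ-* (sgn a) b)) (∥∥-neg b) (sg-*-≤ (sign a) (- b))) ps)))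
      k+b₀≤n₂ : norm₁ ps + B₀ ps ≤ n₂
      k+b₀≤n₂ = subst (_≤ n₂) (trans (sum-+ _ _ ps) (cong (_+ B₀ ps) A₀≡))
        (sum-mono (λ (a , b) → subst (_≤ ∥ a + b ∥) (ℤ.*-distribˡ-+ (sgn a) a b) (sg-*-≤ (sign a) (a + b))) ps)
      0≤a₂ : 0ℤ ≤ A₂ ps
      -- `B₂` is at most the norm of b, which is at most the norm `A₂ + B₂` of a + b.
      0≤a₂ = 0≤-⇒≤ (0≤-+ (≤⇒0≤- (sum-mono (λ p → sg-*-≤ (ε₂ p) (proj₂ p)) ps)) (≤⇒0≤- n₁≤n₂′))
        (trans (cong (λ z → norm₂ ps - z + (n₂ - norm₂ ps)) B₂≡) (l₁ (norm₂ ps) n₂ (A₂ ps)))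
        where
        l₁ = solve 3 (λ n m a → n :- (m :- a) :+ (m :- n) := a :- con 0ℤ) refl
      lem : ∀ a → + 4 * a ≡ + 2 * (+ 2 * a)
      lem = solve-∀

    reflect : List Pair → List Pair
    reflect = map (λ (a , b) → - a , b)

    -- Replacing a by - a changes the sign of `A₁` and exchanges the shears by 1 and - 1, so that
    -- `A₁ ≤ 0` may be assumed.
    reduced± : ∀ ps → norm₁ ps ≤ norm₂ ps → norm₂ ps ≤ norm₂ (shear 1ℤ ps) → norm₂ ps ≤ norm₂ (shear (- 1ℤ) ps) →
               norm₁ ps * norm₁ ps ≤ + 2 * area ps
    reduced± ps h h⁺ h⁻ with ≤-total (A₁ ps) 0ℤ
    ... | inj₁ a₁≤0 = reduced ps h h⁺ a₁≤0
    ... | inj₂ 0≤a₁ = subst₂ _≤_ (cong₂ _*_ n₁≡ n₁≡)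
      (cong (+ 2 *_) (area-map _ (λ (a , b) (a′ , b′) → trans (cong ∥_∥ (l₁ a b a′ b′)) (∥∥-neg (a * b′ - b * a′))) ps))
          (reduced (reflect ps) (subst₂ _≤_ (sym n₁≡) (sym n₂≡) h) (subst₂ _≤_ (sym n₂≡) (sym shear≡) h⁻)
            (subst (_≤ 0ℤ) (sym (trans (sum-map _ _ ps)
              (trans (sum-cong (λ (a , b) → sym (ℤ.neg-distribʳ-* (sgn b) a)) ps) (sum-neg _ ps))))
              (ℤ.neg-mono-≤ 0≤a₁)))
      where
      l₁ = solve 4 (λ a b a′ b′ → :- a :* b′ :- b :* :- a′ := :- (a :* b′ :- b :* a′)) refl
      n₁≡ : norm₁ (reflect ps) ≡ norm₁ ps
      n₁≡ = trans (sum-map _ _ ps) (sum-cong (λ (a , b) → ∥∥-neg a) ps)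
      n₂≡ : norm₂ (reflect ps) ≡ norm₂ ps
      n₂≡ = sum-map _ _ ps
      l₂ : ∀ a b → b + 1ℤ * - a ≡ b + - 1ℤ * a
      l₂ = solve-∀
      shear≡ : norm₂ (shear 1ℤ (reflect ps)) ≡ norm₂ (shear (- 1ℤ) ps)
      shear≡ = trans (sum-map _ _ (reflect ps))
        (trans (sum-map _ _ ps) (trans (sum-cong (λ (a , b) → cong ∥_∥ (l₂ a b)) ps) (sym (sum-map _ _ ps))))

    Outcome : List Pair → Set
    Outcome ps = (∃[ r ] norm₂ (shear r ps) < norm₁ ps) ⊎ (norm₁ ps * norm₁ ps ≤ + 2 * area ps)

    unshear : ∀ r′ ps → Outcome (shear r′ ps) → Outcome ps
    unshear r′ ps (inj₁ (r , lt)) = inj₁ (r′ + r , subst₂ _<_ (cong norm₂ (shear-shear r r′ ps)) (norm₁-shear r′ ps) lt)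
    unshear r′ ps (inj₂ le) =
      inj₂ (subst₂ _≤_ (cong₂ _*_ (norm₁-shear r′ ps) (norm₁-shear r′ ps)) (cong (+ 2 *_) (area-shear r′ ps)) le)

    descend : ∀ {x y n} → x < y → y ≤ + suc n → x ≤ + n
    descend x<y y≤n = ℤ.i<j⇒i≤pred[j] (ℤ.<-≤-trans x<y y≤n)

    norm₂≮0 : ∀ {ps y} → norm₂ ps < y → ¬ y ≤ 0ℤ
    norm₂≮0 {ps} lt le = ℤ.≤⇒≯ (sum-nonNeg (λ p → 0≤∥∥ (proj₂ p)) ps) (ℤ.<-≤-trans lt le)

    -- The norm of b is a natural number and drops with every shear that helps. If neither of the
    -- shears by ± 1 does, then either b is shorter than a, and the caller exchanges the two, or the
    -- pair is reduced.
    gauss-fuel : ∀ n ps → norm₂ ps ≤ + n → Outcome ps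
    gauss-fuel n ps h with norm₂ (shear 1ℤ ps) <? norm₂ ps | norm₂ (shear (- 1ℤ) ps) <? norm₂ ps | norm₂ (shear 0ℤ ps)
      <? norm₁ ps
    gauss-fuel zero ps h | yes lt | _ | _ = contradiction h (norm₂≮0 {shear 1ℤ ps} lt)
    gauss-fuel (suc n) ps h | yes lt | _ | _ = unshear 1ℤ ps (gauss-fuel n (shear 1ℤ ps) (descend lt h))
    gauss-fuel zero ps h | no _ | yes lt | _ = contradiction h (norm₂≮0 {shear (- 1ℤ) ps} lt)
    gauss-fuel (suc n) ps h | no _ | yes lt | _ = unshear (- 1ℤ) ps (gauss-fuel n (shear (- 1ℤ) ps) (descend lt h))
    gauss-fuel n ps h | no _ | no _ | yes lt = inj₁ (0ℤ , lt)
    gauss-fuel n ps h | no ≮⁺ | no ≮⁻ | no ≮ =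
      inj₂ (reduced± ps (≤-trans (≮⇒≥ ≮) (≤-reflexive shear-0)) (≮⇒≥ ≮⁺) (≮⇒≥ ≮⁻))
      where
      shear-0 : norm₂ (shear 0ℤ ps) ≡ norm₂ ps
      shear-0 = trans (sum-map _ _ ps) (sum-cong (λ (a , b) → cong ∥_∥ (ℤ.+-identityʳ b)) ps)

  gauss : ∀ ps → (∃[ r ] norm₂ (shear r ps) < norm₁ ps) ⊎ (norm₁ ps * norm₁ ps ≤ + 2 * area ps)
  gauss ps = gauss-fuel ∣ norm₂ ps ∣ ps (x≤∥x∥ (norm₂ ps))

  -- Serves Plücker's relation in `no-4-cycle`, where the three products are known only up to sign.
  abs-+ : ∀ i j → (∣ i + j ∣ ≡ ∣ i ∣ ℕ.+ ∣ j ∣) ⊎ (∣ i ∣ ≡ ∣ i + j ∣ ℕ.+ ∣ j ∣) ⊎ (∣ j ∣ ≡ ∣ i + j ∣ ℕ.+ ∣ i ∣)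
  abs-+ (+ m) (+ n) = inj₁ refl
  abs-+ -[1+ m ] -[1+ n ] = inj₁ (cong suc (sym (ℕ.+-suc m n)))
  abs-+ (+ m) -[1+ n ] with ℕ.≤-total m (suc n)
  ... | inj₁ m≤n = inj₂ (inj₂ (sym (trans (cong (ℕ._+ m) (ℤ.∣⊖∣-≤ m≤n)) (ℕ.m∸n+n≡m m≤n))))
  ... | inj₂ n≤m = inj₂ (inj₁
    (sym (trans (cong (ℕ._+ suc n) (trans (ℤ.∣m⊖n∣≡∣n⊖m∣ m (suc n)) (ℤ.∣⊖∣-≤ n≤m))) (ℕ.m∸n+n≡m n≤m))))
  abs-+ -[1+ m ] (+ n) with ℕ.≤-total n (suc m)
  ... | inj₁ n≤m = inj₂ (inj₁ (sym (trans (cong (ℕ._+ n) (ℤ.∣⊖∣-≤ n≤m)) (ℕ.m∸n+n≡m n≤m))))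
  ... | inj₂ m≤n = inj₂ (inj₂
    (sym (trans (cong (ℕ._+ suc m) (trans (ℤ.∣m⊖n∣≡∣n⊖m∣ n (suc m)) (ℤ.∣⊖∣-≤ m≤n))) (ℕ.m∸n+n≡m m≤n))))

  -- Vectors in ℤ⁴ and their exterior products

  record Vector : Set where
    constructor vec
    field
      x₀ x₁ x₂ x₃ : ℤ

  open Vector

  ∥_∥₁ : List ℤ → ℤ
  ∥ [] ∥₁ = 0ℤ
  ∥ x ∷ xs ∥₁ = ∥ x ∥ + ∥ xs ∥₁

  comps : Vector → List ℤ
  comps (vec a b c d) = a ∷ b ∷ c ∷ d ∷ []

  _⊕_·_ : Vector → ℤ → Vector → Vector
  vec a b c d ⊕ r · vec a′ b′ c′ d′ = vec (a + r * a′) (b + r * b′) (c + r * c′) (d + r * d′)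

  neg : Vector → Vector
  neg (vec a b c d) = vec (- a) (- b) (- c) (- d)

  m₀₁ m₀₂ m₀₃ m₁₂ m₁₃ m₂₃ : Vector → Vector → ℤ
  m₀₁ v w = x₀ v * x₁ w - x₁ v * x₀ w
  m₀₂ v w = x₀ v * x₂ w - x₂ v * x₀ w
  m₀₃ v w = x₀ v * x₃ w - x₃ v * x₀ w
  m₁₂ v w = x₁ v * x₂ w - x₂ v * x₁ w
  m₁₃ v w = x₁ v * x₃ w - x₃ v * x₁ w
  m₂₃ v w = x₂ v * x₃ w - x₃ v * x₂ w

  bivector : Vector → Vector → List ℤ
  bivector v w = m₀₁ v w ∷ m₀₂ v w ∷ m₀₃ v w ∷ m₁₂ v w ∷ m₁₃ v w ∷ m₂₃ v w ∷ []

  -- The 3 × 3 minors, with the signs for which det is the pairing with the fourth row.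
  h₀ h₁ h₂ h₃ : (v w c : Vector) → ℤ
  h₀ v w c = m₁₃ v w * x₂ c - m₁₂ v w * x₃ c - m₂₃ v w * x₁ c
  h₁ v w c = m₀₂ v w * x₃ c + m₂₃ v w * x₀ c - m₀₃ v w * x₂ c
  h₂ v w c = m₀₃ v w * x₁ c - m₀₁ v w * x₃ c - m₁₃ v w * x₀ c
  h₃ v w c = m₀₁ v w * x₂ c + m₁₂ v w * x₀ c - m₀₂ v w * x₁ c

  trivector : (v w c : Vector) → List ℤ
  trivector v w c = h₀ v w c ∷ h₁ v w c ∷ h₂ v w c ∷ h₃ v w c ∷ []

  det : (v w c d : Vector) → ℤ
  det v w c d = h₀ v w c * x₀ d + h₁ v w c * x₁ d + h₂ v w c * x₂ d + h₃ v w c * x₃ d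

  det-polynomial : ∀ {n} (p01 p02 p03 p12 p13 p23 c0 c1 c2 c3 d0 d1 d2 d3 : Polynomial n) → Polynomial n
  det-polynomial p01 p02 p03 p12 p13 p23 c0 c1 c2 c3 d0 d1 d2 d3 =
    (p13 :* c2 :- p12 :* c3 :- p23 :* c1) :* d0 :+ (p02 :* c3 :+ p23 :* c0 :- p03 :* c2) :* d1
      :+ (p03 :* c1 :- p01 :* c3 :- p13 :* c0) :* d2 :+ (p01 :* c2 :+ p12 :* c0 :- p02 :* c1) :* d3

  plücker : Vector → Vector → ℤ
  plücker v w = m₀₁ v w * m₂₃ v w - m₀₂ v w * m₁₃ v w + m₀₃ v w * m₁₂ v w

  plücker≡0 : ∀ v w → plücker v w ≡ 0ℤ
  plücker≡0 (vec v0 v1 v2 v3) (vec w0 w1 w2 w3) = lem v0 v1 v2 v3 w0 w1 w2 w3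
    where
    lem = solve 8 (λ v0 v1 v2 v3 w0 w1 w2 w3 →
      (v0 :* w1 :- v1 :* w0) :* (v2 :* w3 :- v3 :* w2) :- (v0 :* w2 :- v2 :* w0) :* (v1 :* w3 :- v3 :* w1)
        :+ (v0 :* w3 :- v3 :* w0) :* (v1 :* w2 :- v2 :* w1) := con 0ℤ) refl

  -- The functionals `h v w c` and `h v w d` annihilate v and w, so their 2 × 2 minors are
  -- proportional to the complementary minors of v and w. Treating those minors as independent
  -- variables keeps the polynomial identity small, at the price of the Plücker term.
  sylvester₀₁ : ∀ v w c d → h₀ v w c * h₁ v w d - h₀ v w d * h₁ v w c ≡ m₂₃ v w * det v w c d - plücker v w * m₂₃ c d
  sylvester₀₁ v w (vec c0 c1 c2 c3) (vec d0 d1 d2 d3) = solve 14 (λ p01 p02 p03 p12 p13 p23 c0 c1 c2 c3 d0 d1 d2 d3 →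
    (p13 :* c2 :- p12 :* c3 :- p23 :* c1) :* (p02 :* d3 :+ p23 :* d0 :- p03 :* d2)
      :- (p13 :* d2 :- p12 :* d3 :- p23 :* d1) :* (p02 :* c3 :+ p23 :* c0 :- p03 :* c2)
    := p23 :* det-polynomial p01 p02 p03 p12 p13 p23 c0 c1 c2 c3 d0 d1 d2 d3
      :- (p01 :* p23 :- p02 :* p13 :+ p03 :* p12) :* (c2 :* d3 :- c3 :* d2)) refl
    (m₀₁ v w) (m₀₂ v w) (m₀₃ v w) (m₁₂ v w) (m₁₃ v w) (m₂₃ v w) c0 c1 c2 c3 d0 d1 d2 d3

  sylvester₀₂ : ∀ v w c d → h₀ v w c * h₂ v w d - h₀ v w d * h₂ v w c
    ≡ - (m₁₃ v w * det v w c d - plücker v w * m₁₃ c d)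
  sylvester₀₂ v w (vec c0 c1 c2 c3) (vec d0 d1 d2 d3) = solve 14 (λ p01 p02 p03 p12 p13 p23 c0 c1 c2 c3 d0 d1 d2 d3 →
    (p13 :* c2 :- p12 :* c3 :- p23 :* c1) :* (p03 :* d1 :- p01 :* d3 :- p13 :* d0)
      :- (p13 :* d2 :- p12 :* d3 :- p23 :* d1) :* (p03 :* c1 :- p01 :* c3 :- p13 :* c0)
    := :- (p13 :* det-polynomial p01 p02 p03 p12 p13 p23 c0 c1 c2 c3 d0 d1 d2 d3
      :- (p01 :* p23 :- p02 :* p13 :+ p03 :* p12) :* (c1 :* d3 :- c3 :* d1))) refl
    (m₀₁ v w) (m₀₂ v w) (m₀₃ v w) (m₁₂ v w) (m₁₃ v w) (m₂₃ v w) c0 c1 c2 c3 d0 d1 d2 d3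

  sylvester₀₃ : ∀ v w c d → h₀ v w c * h₃ v w d - h₀ v w d * h₃ v w c ≡ m₁₂ v w * det v w c d - plücker v w * m₁₂ c d
  sylvester₀₃ v w (vec c0 c1 c2 c3) (vec d0 d1 d2 d3) = solve 14 (λ p01 p02 p03 p12 p13 p23 c0 c1 c2 c3 d0 d1 d2 d3 →
    (p13 :* c2 :- p12 :* c3 :- p23 :* c1) :* (p01 :* d2 :+ p12 :* d0 :- p02 :* d1)
      :- (p13 :* d2 :- p12 :* d3 :- p23 :* d1) :* (p01 :* c2 :+ p12 :* c0 :- p02 :* c1)
    := p12 :* det-polynomial p01 p02 p03 p12 p13 p23 c0 c1 c2 c3 d0 d1 d2 d3
      :- (p01 :* p23 :- p02 :* p13 :+ p03 :* p12) :* (c1 :* d2 :- c2 :* d1)) refl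
    (m₀₁ v w) (m₀₂ v w) (m₀₃ v w) (m₁₂ v w) (m₁₃ v w) (m₂₃ v w) c0 c1 c2 c3 d0 d1 d2 d3

  sylvester₁₂ : ∀ v w c d → h₁ v w c * h₂ v w d - h₁ v w d * h₂ v w c ≡ m₀₃ v w * det v w c d - plücker v w * m₀₃ c d
  sylvester₁₂ v w (vec c0 c1 c2 c3) (vec d0 d1 d2 d3) = solve 14 (λ p01 p02 p03 p12 p13 p23 c0 c1 c2 c3 d0 d1 d2 d3 →
    (p02 :* c3 :+ p23 :* c0 :- p03 :* c2) :* (p03 :* d1 :- p01 :* d3 :- p13 :* d0)
      :- (p02 :* d3 :+ p23 :* d0 :- p03 :* d2) :* (p03 :* c1 :- p01 :* c3 :- p13 :* c0)
    := p03 :* det-polynomial p01 p02 p03 p12 p13 p23 c0 c1 c2 c3 d0 d1 d2 d3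
      :- (p01 :* p23 :- p02 :* p13 :+ p03 :* p12) :* (c0 :* d3 :- c3 :* d0)) refl
    (m₀₁ v w) (m₀₂ v w) (m₀₃ v w) (m₁₂ v w) (m₁₃ v w) (m₂₃ v w) c0 c1 c2 c3 d0 d1 d2 d3

  sylvester₁₃ : ∀ v w c d → h₁ v w c * h₃ v w d - h₁ v w d * h₃ v w c
    ≡ - (m₀₂ v w * det v w c d - plücker v w * m₀₂ c d)
  sylvester₁₃ v w (vec c0 c1 c2 c3) (vec d0 d1 d2 d3) = solve 14 (λ p01 p02 p03 p12 p13 p23 c0 c1 c2 c3 d0 d1 d2 d3 →
    (p02 :* c3 :+ p23 :* c0 :- p03 :* c2) :* (p01 :* d2 :+ p12 :* d0 :- p02 :* d1)
      :- (p02 :* d3 :+ p23 :* d0 :- p03 :* d2) :* (p01 :* c2 :+ p12 :* c0 :- p02 :* c1)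
    := :- (p02 :* det-polynomial p01 p02 p03 p12 p13 p23 c0 c1 c2 c3 d0 d1 d2 d3
      :- (p01 :* p23 :- p02 :* p13 :+ p03 :* p12) :* (c0 :* d2 :- c2 :* d0))) refl
    (m₀₁ v w) (m₀₂ v w) (m₀₃ v w) (m₁₂ v w) (m₁₃ v w) (m₂₃ v w) c0 c1 c2 c3 d0 d1 d2 d3

  sylvester₂₃ : ∀ v w c d → h₂ v w c * h₃ v w d - h₂ v w d * h₃ v w c ≡ m₀₁ v w * det v w c d - plücker v w * m₀₁ c d
  sylvester₂₃ v w (vec c0 c1 c2 c3) (vec d0 d1 d2 d3) = solve 14 (λ p01 p02 p03 p12 p13 p23 c0 c1 c2 c3 d0 d1 d2 d3 →
    (p03 :* c1 :- p01 :* c3 :- p13 :* c0) :* (p01 :* d2 :+ p12 :* d0 :- p02 :* d1)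
      :- (p03 :* d1 :- p01 :* d3 :- p13 :* d0) :* (p01 :* c2 :+ p12 :* c0 :- p02 :* c1)
    := p01 :* det-polynomial p01 p02 p03 p12 p13 p23 c0 c1 c2 c3 d0 d1 d2 d3
      :- (p01 :* p23 :- p02 :* p13 :+ p03 :* p12) :* (c0 :* d1 :- c1 :* d0)) refl
    (m₀₁ v w) (m₀₂ v w) (m₀₃ v w) (m₁₂ v w) (m₁₃ v w) (m₂₃ v w) c0 c1 c2 c3 d0 d1 d2 d3

  -- Plücker coordinates sharing an index: the three pairs of minors of a 2 × 3 block with a
  -- common first row, for the two ways of writing the 3 × 3 minor.
  private
    first⁺ : ∀ va vb vc wa wb wc xa xb xc →
      (va * wb - vb * wa) * (va * xc - vc * xa) - (va * xb - vb * xa) * (va * wc - vc * wa)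
      ≡ va * ((va * wb - vb * wa) * xc + (vb * wc - vc * wb) * xa - (va * wc - vc * wa) * xb)
    first⁺ = solve-∀

    first⁻ : ∀ va vb vc wa wb wc xa xb xc →
      (va * wb - vb * wa) * (va * xc - vc * xa) - (va * xb - vb * xa) * (va * wc - vc * wa)
      ≡ - (va * ((va * wc - vc * wa) * xb - (va * wb - vb * wa) * xc - (vb * wc - vc * wb) * xa))
    first⁻ = solve-∀

    second⁺ : ∀ va vb vc wa wb wc xa xb xc →
      (va * wb - vb * wa) * (vb * xc - vc * xb) - (va * xb - vb * xa) * (vb * wc - vc * wb)
      ≡ vb * ((va * wb - vb * wa) * xc + (vb * wc - vc * wb) * xa - (va * wc - vc * wa) * xb)
    second⁺ = solve-∀

    second⁻ : ∀ va vb vc wa wb wc xa xb xc →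
      (va * wb - vb * wa) * (vb * xc - vc * xb) - (va * xb - vb * xa) * (vb * wc - vc * wb)
      ≡ - (vb * ((va * wc - vc * wa) * xb - (va * wb - vb * wa) * xc - (vb * wc - vc * wb) * xa))
    second⁻ = solve-∀

    third⁺ : ∀ va vb vc wa wb wc xa xb xc →
      (va * wc - vc * wa) * (vb * xc - vc * xb) - (va * xc - vc * xa) * (vb * wc - vc * wb)
      ≡ vc * ((va * wb - vb * wa) * xc + (vb * wc - vc * wb) * xa - (va * wc - vc * wa) * xb)
    third⁺ = solve-∀

    third⁻ : ∀ va vb vc wa wb wc xa xb xc →
      (va * wc - vc * wa) * (vb * xc - vc * xb) - (va * xc - vc * xa) * (vb * wc - vc * wb)
      ≡ - (vc * ((va * wc - vc * wa) * xb - (va * wb - vb * wa) * xc - (vb * wc - vc * wb) * xa))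
    third⁻ = solve-∀

    shift : ∀ a b c d e f r → a * c - b * d + r * (a * e - b * f) ≡ a * (c + r * e) - b * (d + r * f)
    shift = solve-∀

    shift₃ : ∀ p q s a b c a′ b′ c′ r → p * a - q * b - s * c + r * (p * a′ - q * b′ - s * c′)
      ≡ p * (a + r * a′) - q * (b + r * b′) - s * (c + r * c′)
    shift₃ = solve-∀

    shift₃′ : ∀ p q s a b c a′ b′ c′ r → p * a + q * b - s * c + r * (p * a′ + q * b′ - s * c′)
      ≡ p * (a + r * a′) + q * (b + r * b′) - s * (c + r * c′)
    shift₃′ = solve-∀

    turn⁺ : ∀ va vb vc wa wb wc xa xb xc r →
      (va * (xb + r * wb) - vb * (xa + r * wa)) * (- wc) + (vb * (xc + r * wc) - vc * (xb + r * wb)) * (- wa)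
        - (va * (xc + r * wc) - vc * (xa + r * wa)) * (- wb)
      ≡ (va * wb - vb * wa) * xc + (vb * wc - vc * wb) * xa - (va * wc - vc * wa) * xb
    turn⁺ = solve-∀

    turn⁻ : ∀ va vb vc wa wb wc xa xb xc r →
      (va * (xc + r * wc) - vc * (xa + r * wa)) * (- wb) - (va * (xb + r * wb) - vb * (xa + r * wa)) * (- wc)
        - (vb * (xc + r * wc) - vc * (xb + r * wb)) * (- wa)
      ≡ (va * wc - vc * wa) * xb - (va * wb - vb * wa) * xc - (vb * wc - vc * wb) * xa
    turn⁻ = solve-∀

  share₀₁,₀₂ : ∀ v w c → m₀₁ v w * m₀₂ v c - m₀₁ v c * m₀₂ v w ≡ x₀ v * h₃ v w c
  share₀₁,₀₂ (vec v0 v1 v2 v3) (vec w0 w1 w2 w3) (vec c0 c1 c2 c3) = first⁺ v0 v1 v2 w0 w1 w2 c0 c1 c2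

  share₀₁,₀₃ : ∀ v w c → m₀₁ v w * m₀₃ v c - m₀₁ v c * m₀₃ v w ≡ - (x₀ v * h₂ v w c)
  share₀₁,₀₃ (vec v0 v1 v2 v3) (vec w0 w1 w2 w3) (vec c0 c1 c2 c3) = first⁻ v0 v1 v3 w0 w1 w3 c0 c1 c3

  share₀₁,₁₂ : ∀ v w c → m₀₁ v w * m₁₂ v c - m₀₁ v c * m₁₂ v w ≡ x₁ v * h₃ v w c
  share₀₁,₁₂ (vec v0 v1 v2 v3) (vec w0 w1 w2 w3) (vec c0 c1 c2 c3) = second⁺ v0 v1 v2 w0 w1 w2 c0 c1 c2

  share₀₁,₁₃ : ∀ v w c → m₀₁ v w * m₁₃ v c - m₀₁ v c * m₁₃ v w ≡ - (x₁ v * h₂ v w c)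
  share₀₁,₁₃ (vec v0 v1 v2 v3) (vec w0 w1 w2 w3) (vec c0 c1 c2 c3) = second⁻ v0 v1 v3 w0 w1 w3 c0 c1 c3

  share₀₁,₂₃ : ∀ v w c → m₀₁ v w * m₂₃ v c - m₀₁ v c * m₂₃ v w ≡ x₀ v * h₀ v w c + x₁ v * h₁ v w c
  share₀₁,₂₃ (vec v0 v1 v2 v3) (vec w0 w1 w2 w3) (vec c0 c1 c2 c3) = lem v0 v1 v2 v3 w0 w1 w2 w3 c0 c1 c2 c3
      where
      lem = solve 12 (λ v0 v1 v2 v3 w0 w1 w2 w3 c0 c1 c2 c3 →
        (v0 :* w1 :- v1 :* w0) :* (v2 :* c3 :- v3 :* c2) :- (v0 :* c1 :- v1 :* c0) :* (v2 :* w3 :- v3 :* w2)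
        := v0 :* ((v1 :* w3 :- v3 :* w1) :* c2 :- (v1 :* w2 :- v2 :* w1) :* c3 :- (v2 :* w3 :- v3 :* w2) :* c1)
          :+ v1 :* ((v0 :* w2 :- v2 :* w0) :* c3 :+ (v2 :* w3 :- v3 :* w2) :* c0 :- (v0 :* w3 :- v3 :* w0) :* c2)) refl

  share₀₂,₀₃ : ∀ v w c → m₀₂ v w * m₀₃ v c - m₀₂ v c * m₀₃ v w ≡ x₀ v * h₁ v w c
  share₀₂,₀₃ (vec v0 v1 v2 v3) (vec w0 w1 w2 w3) (vec c0 c1 c2 c3) = first⁺ v0 v2 v3 w0 w2 w3 c0 c2 c3

  share₀₂,₁₂ : ∀ v w c → m₀₂ v w * m₁₂ v c - m₀₂ v c * m₁₂ v w ≡ x₂ v * h₃ v w c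
  share₀₂,₁₂ (vec v0 v1 v2 v3) (vec w0 w1 w2 w3) (vec c0 c1 c2 c3) = third⁺ v0 v1 v2 w0 w1 w2 c0 c1 c2

  share₀₂,₁₃ : ∀ v w c → m₀₂ v w * m₁₃ v c - m₀₂ v c * m₁₃ v w ≡ - (x₀ v * h₀ v w c + x₂ v * h₂ v w c)
  share₀₂,₁₃ (vec v0 v1 v2 v3) (vec w0 w1 w2 w3) (vec c0 c1 c2 c3) = lem v0 v1 v2 v3 w0 w1 w2 w3 c0 c1 c2 c3
      where
      lem = solve 12 (λ v0 v1 v2 v3 w0 w1 w2 w3 c0 c1 c2 c3 →
        (v0 :* w2 :- v2 :* w0) :* (v1 :* c3 :- v3 :* c1) :- (v0 :* c2 :- v2 :* c0) :* (v1 :* w3 :- v3 :* w1)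
        := :- (v0 :* ((v1 :* w3 :- v3 :* w1) :* c2 :- (v1 :* w2 :- v2 :* w1) :* c3 :- (v2 :* w3 :- v3 :* w2) :* c1)
          :+ v2 :* ((v0 :* w3 :- v3 :* w0) :* c1 :- (v0 :* w1 :- v1 :* w0) :* c3 :- (v1 :* w3 :- v3 :* w1) :* c0))) refl

  share₀₂,₂₃ : ∀ v w c → m₀₂ v w * m₂₃ v c - m₀₂ v c * m₂₃ v w ≡ x₂ v * h₁ v w c
  share₀₂,₂₃ (vec v0 v1 v2 v3) (vec w0 w1 w2 w3) (vec c0 c1 c2 c3) = second⁺ v0 v2 v3 w0 w2 w3 c0 c2 c3

  share₀₃,₁₂ : ∀ v w c → m₀₃ v w * m₁₂ v c - m₀₃ v c * m₁₂ v w ≡ x₀ v * h₀ v w c + x₃ v * h₃ v w c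
  share₀₃,₁₂ (vec v0 v1 v2 v3) (vec w0 w1 w2 w3) (vec c0 c1 c2 c3) = lem v0 v1 v2 v3 w0 w1 w2 w3 c0 c1 c2 c3
      where
      lem = solve 12 (λ v0 v1 v2 v3 w0 w1 w2 w3 c0 c1 c2 c3 →
        (v0 :* w3 :- v3 :* w0) :* (v1 :* c2 :- v2 :* c1) :- (v0 :* c3 :- v3 :* c0) :* (v1 :* w2 :- v2 :* w1)
        := v0 :* ((v1 :* w3 :- v3 :* w1) :* c2 :- (v1 :* w2 :- v2 :* w1) :* c3 :- (v2 :* w3 :- v3 :* w2) :* c1)
          :+ v3 :* ((v0 :* w1 :- v1 :* w0) :* c2 :+ (v1 :* w2 :- v2 :* w1) :* c0 :- (v0 :* w2 :- v2 :* w0) :* c1)) refl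

  share₀₃,₁₃ : ∀ v w c → m₀₃ v w * m₁₃ v c - m₀₃ v c * m₁₃ v w ≡ - (x₃ v * h₂ v w c)
  share₀₃,₁₃ (vec v0 v1 v2 v3) (vec w0 w1 w2 w3) (vec c0 c1 c2 c3) = third⁻ v0 v1 v3 w0 w1 w3 c0 c1 c3

  share₀₃,₂₃ : ∀ v w c → m₀₃ v w * m₂₃ v c - m₀₃ v c * m₂₃ v w ≡ x₃ v * h₁ v w c
  share₀₃,₂₃ (vec v0 v1 v2 v3) (vec w0 w1 w2 w3) (vec c0 c1 c2 c3) = third⁺ v0 v2 v3 w0 w2 w3 c0 c2 c3

  share₁₂,₁₃ : ∀ v w c → m₁₂ v w * m₁₃ v c - m₁₂ v c * m₁₃ v w ≡ - (x₁ v * h₀ v w c)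
  share₁₂,₁₃ (vec v0 v1 v2 v3) (vec w0 w1 w2 w3) (vec c0 c1 c2 c3) = first⁻ v1 v2 v3 w1 w2 w3 c1 c2 c3

  share₁₂,₂₃ : ∀ v w c → m₁₂ v w * m₂₃ v c - m₁₂ v c * m₂₃ v w ≡ - (x₂ v * h₀ v w c)
  share₁₂,₂₃ (vec v0 v1 v2 v3) (vec w0 w1 w2 w3) (vec c0 c1 c2 c3) = second⁻ v1 v2 v3 w1 w2 w3 c1 c2 c3

  share₁₃,₂₃ : ∀ v w c → m₁₃ v w * m₂₃ v c - m₁₃ v c * m₂₃ v w ≡ - (x₃ v * h₀ v w c)
  share₁₃,₂₃ (vec v0 v1 v2 v3) (vec w0 w1 w2 w3) (vec c0 c1 c2 c3) = third⁻ v1 v2 v3 w1 w2 w3 c1 c2 c3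

  -- This is the determinant with rows v, w, c and again v.
  h·v≡0 : ∀ v w c → x₀ v * h₀ v w c + x₁ v * h₁ v w c + x₂ v * h₂ v w c + x₃ v * h₃ v w c ≡ 0ℤ
  h·v≡0 (vec v0 v1 v2 v3) (vec w0 w1 w2 w3) (vec c0 c1 c2 c3) = lem v0 v1 v2 v3 w0 w1 w2 w3 c0 c1 c2 c3
      where
      lem = solve 12 (λ v0 v1 v2 v3 w0 w1 w2 w3 c0 c1 c2 c3 →
        v0 :* ((v1 :* w3 :- v3 :* w1) :* c2 :- (v1 :* w2 :- v2 :* w1) :* c3 :- (v2 :* w3 :- v3 :* w2) :* c1)
          :+ v1 :* ((v0 :* w2 :- v2 :* w0) :* c3 :+ (v2 :* w3 :- v3 :* w2) :* c0 :- (v0 :* w3 :- v3 :* w0) :* c2)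
          :+ v2 :* ((v0 :* w3 :- v3 :* w0) :* c1 :- (v0 :* w1 :- v1 :* w0) :* c3 :- (v1 :* w3 :- v3 :* w1) :* c0)
          :+ v3 :* ((v0 :* w1 :- v1 :* w0) :* c2 :+ (v1 :* w2 :- v2 :* w1) :* c0 :- (v0 :* w2 :- v2 :* w0) :* c1)
        := con 0ℤ) refl

  h₀-⊕ : ∀ v w c d r → h₀ v w d + r * h₀ v w c ≡ h₀ v w (d ⊕ r · c)
  h₀-⊕ v w (vec c0 c1 c2 c3) (vec d0 d1 d2 d3) r = shift₃ (m₁₃ v w) (m₁₂ v w) (m₂₃ v w) d2 d3 d1 c2 c3 c1 r

  h₁-⊕ : ∀ v w c d r → h₁ v w d + r * h₁ v w c ≡ h₁ v w (d ⊕ r · c)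
  h₁-⊕ v w (vec c0 c1 c2 c3) (vec d0 d1 d2 d3) r = shift₃′ (m₀₂ v w) (m₂₃ v w) (m₀₃ v w) d3 d0 d2 c3 c0 c2 r

  h₂-⊕ : ∀ v w c d r → h₂ v w d + r * h₂ v w c ≡ h₂ v w (d ⊕ r · c)
  h₂-⊕ v w (vec c0 c1 c2 c3) (vec d0 d1 d2 d3) r = shift₃ (m₀₃ v w) (m₀₁ v w) (m₁₃ v w) d1 d3 d0 c1 c3 c0 r

  h₃-⊕ : ∀ v w c d r → h₃ v w d + r * h₃ v w c ≡ h₃ v w (d ⊕ r · c)
  h₃-⊕ v w (vec c0 c1 c2 c3) (vec d0 d1 d2 d3) r = shift₃′ (m₀₁ v w) (m₁₂ v w) (m₀₂ v w) d2 d0 d1 c2 c0 c1 r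

  -- The substitution of c + r w, - w for w, c has determinant 1 and preserves v ∧ w ∧ c. The minus
  -- sign makes the invariance exact, so that `det` stays 1.
  h₀-turn : ∀ v w c r → h₀ v (c ⊕ r · w) (neg w) ≡ h₀ v w c
  h₀-turn (vec v0 v1 v2 v3) (vec w0 w1 w2 w3) (vec c0 c1 c2 c3) r = turn⁻ v1 v2 v3 w1 w2 w3 c1 c2 c3 r

  h₁-turn : ∀ v w c r → h₁ v (c ⊕ r · w) (neg w) ≡ h₁ v w c
  h₁-turn (vec v0 v1 v2 v3) (vec w0 w1 w2 w3) (vec c0 c1 c2 c3) r = turn⁺ v0 v2 v3 w0 w2 w3 c0 c2 c3 r

  h₂-turn : ∀ v w c r → h₂ v (c ⊕ r · w) (neg w) ≡ h₂ v w c
  h₂-turn (vec v0 v1 v2 v3) (vec w0 w1 w2 w3) (vec c0 c1 c2 c3) r = turn⁻ v0 v1 v3 w0 w1 w3 c0 c1 c3 r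

  h₃-turn : ∀ v w c r → h₃ v (c ⊕ r · w) (neg w) ≡ h₃ v w c
  h₃-turn (vec v0 v1 v2 v3) (vec w0 w1 w2 w3) (vec c0 c1 c2 c3) r = turn⁺ v0 v1 v2 w0 w1 w2 c0 c1 c2 r

  m₀₁-⊕ : ∀ v w c r → m₀₁ v c + r * m₀₁ v w ≡ m₀₁ v (c ⊕ r · w)
  m₀₁-⊕ (vec v0 v1 v2 v3) (vec w0 w1 w2 w3) (vec c0 c1 c2 c3) r = shift v0 v1 c1 c0 w1 w0 r

  m₀₂-⊕ : ∀ v w c r → m₀₂ v c + r * m₀₂ v w ≡ m₀₂ v (c ⊕ r · w)
  m₀₂-⊕ (vec v0 v1 v2 v3) (vec w0 w1 w2 w3) (vec c0 c1 c2 c3) r = shift v0 v2 c2 c0 w2 w0 r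

  m₀₃-⊕ : ∀ v w c r → m₀₃ v c + r * m₀₃ v w ≡ m₀₃ v (c ⊕ r · w)
  m₀₃-⊕ (vec v0 v1 v2 v3) (vec w0 w1 w2 w3) (vec c0 c1 c2 c3) r = shift v0 v3 c3 c0 w3 w0 r

  m₁₂-⊕ : ∀ v w c r → m₁₂ v c + r * m₁₂ v w ≡ m₁₂ v (c ⊕ r · w)
  m₁₂-⊕ (vec v0 v1 v2 v3) (vec w0 w1 w2 w3) (vec c0 c1 c2 c3) r = shift v1 v2 c2 c1 w2 w1 r

  m₁₃-⊕ : ∀ v w c r → m₁₃ v c + r * m₁₃ v w ≡ m₁₃ v (c ⊕ r · w)
  m₁₃-⊕ (vec v0 v1 v2 v3) (vec w0 w1 w2 w3) (vec c0 c1 c2 c3) r = shift v1 v3 c3 c1 w3 w1 r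

  m₂₃-⊕ : ∀ v w c r → m₂₃ v c + r * m₂₃ v w ≡ m₂₃ v (c ⊕ r · w)
  m₂₃-⊕ (vec v0 v1 v2 v3) (vec w0 w1 w2 w3) (vec c0 c1 c2 c3) r = shift v2 v3 c3 c2 w3 w2 r

  det-turn : ∀ v w c d r → det v w (d ⊕ r · c) (neg c) ≡ det v w c d
  det-turn v w (vec c0 c1 c2 c3) (vec d0 d1 d2 d3) r = solve 15 (λ p01 p02 p03 p12 p13 p23 c0 c1 c2 c3 d0 d1 d2 d3 r →
    det-polynomial p01 p02 p03 p12 p13 p23 (d0 :+ r :* c0) (d1 :+ r :* c1) (d2 :+ r :* c2) (d3 :+ r :* c3) (:- c0)
      (:- c1) (:- c2) (:- c3)
    := det-polynomial p01 p02 p03 p12 p13 p23 c0 c1 c2 c3 d0 d1 d2 d3) refl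
    (m₀₁ v w) (m₀₂ v w) (m₀₃ v w) (m₁₂ v w) (m₁₃ v w) (m₂₃ v w) c0 c1 c2 c3 d0 d1 d2 d3 r

  det-turn′ : ∀ v w c d r → det v (c ⊕ r · w) (neg w) d ≡ det v w c d
  det-turn′ v w c d r = cong₂ _+_
    (cong₂ _+_ (cong₂ _+_ (cong (_* x₀ d) (h₀-turn v w c r)) (cong (_* x₁ d) (h₁-turn v w c r)))
    (cong (_* x₂ d) (h₂-turn v w c r))) (cong (_* x₃ d) (h₃-turn v w c r))

  -- Gauss reduction sees c, d through x ↦ v ∧ w ∧ x here, and w, c through x ↦ v ∧ x in `pairs`.
  -- Then `norm₁` is `K` or `A`, and `shear` is the substitution of d + r c for d or of c + r w for
  -- c.
  dual-pairs : (v w c d : Vector) → List Pair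
  dual-pairs v w c d = (h₀ v w c , h₀ v w d) ∷ (h₁ v w c , h₁ v w d) ∷ (h₂ v w c , h₂ v w d) ∷ (h₃ v w c , h₃ v w d)
    ∷ []

  pairs : (v w c : Vector) → List Pair
  pairs v w c = (m₀₁ v w , m₀₁ v c) ∷ (m₀₂ v w , m₀₂ v c) ∷ (m₀₃ v w , m₀₃ v c) ∷ (m₁₂ v w , m₁₂ v c)
    ∷ (m₁₃ v w , m₁₃ v c) ∷ (m₂₃ v w , m₂₃ v c) ∷ []

  -- By unimodularity, the 2 × 2 minors of two dual vectors are the complementary
  -- minors of v and w.
  area-dual : ∀ v w c d → det v w c d ≡ 1ℤ → area (dual-pairs v w c d) ≡ ∥ bivector v w ∥₁
  area-dual v w c d det≡1 = trans
    (cong₂ _+_ (row₃ (plus (m₂₃ v w) (m₂₃ c d) (sylvester₀₁ v w c d)) (minus (m₁₃ v w) (m₁₃ c d) (sylvester₀₂ v w c d))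
      (plus (m₁₂ v w) (m₁₂ c d) (sylvester₀₃ v w c d)))
      (cong₂ _+_ (row₂ (plus (m₀₃ v w) (m₀₃ c d) (sylvester₁₂ v w c d))
        (minus (m₀₂ v w) (m₀₂ c d) (sylvester₁₃ v w c d)))
        (cong (λ z → z + 0ℤ + (0ℤ + 0ℤ)) (plus (m₀₁ v w) (m₀₁ c d) (sylvester₂₃ v w c d)))))
    (reorder (∥ m₀₁ v w ∥) (∥ m₀₂ v w ∥) (∥ m₀₃ v w ∥) (∥ m₁₂ v w ∥) (∥ m₁₃ v w ∥) (∥ m₂₃ v w ∥))
    where
    collapse : ∀ m n → m * det v w c d - plücker v w * n ≡ m
    collapse m n = trans (cong₂ (λ x y → m * x - y * n) det≡1 (plücker≡0 v w)) (lem m n)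
      where
      lem : ∀ m n → m * 1ℤ - 0ℤ * n ≡ m
      lem = solve-∀
    plus : ∀ {x} m n → x ≡ m * det v w c d - plücker v w * n → ∥ x ∥ ≡ ∥ m ∥
    plus m n eq = cong ∥_∥ (trans eq (collapse m n))
    minus : ∀ {x} m n → x ≡ - (m * det v w c d - plücker v w * n) → ∥ x ∥ ≡ ∥ m ∥
    minus m n eq = trans (cong ∥_∥ (trans eq (cong -_ (collapse m n)))) (∥∥-neg m)
    row₃ : ∀ {a b c a′ b′ c′} → a ≡ a′ → b ≡ b′ → c ≡ c′ → a + (b + (c + 0ℤ)) ≡ a′ + (b′ + (c′ + 0ℤ))
    row₃ refl refl refl = refl
    row₂ : ∀ {a b a′ b′} → a ≡ a′ → b ≡ b′ → a + (b + 0ℤ) ≡ a′ + (b′ + 0ℤ)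
    row₂ refl refl = refl
    reorder = solve 6 (λ a b c d e f →
      f :+ (e :+ (d :+ con 0ℤ)) :+ (c :+ (b :+ con 0ℤ) :+ (a :+ con 0ℤ :+ (con 0ℤ :+ con 0ℤ)))
      := a :+ (b :+ (c :+ (d :+ (e :+ (f :+ con 0ℤ)))))) refl

  -- A choice of three signs e with sum E is balanced by the multiple c of the zero sum
  -- y₀ + y₁ + y₂ + y₃ for which E + c, e + c are all ± 1.
  hlawka : ∀ y₀ y₁ y₂ y₃ → y₀ + y₁ + y₂ + y₃ ≡ 0ℤ →
           ∥ y₀ + y₁ ∥ + ∥ y₀ + y₂ ∥ + ∥ y₀ + y₃ ∥ ≤ ∥ y₀ ∥ + ∥ y₁ ∥ + ∥ y₂ ∥ + ∥ y₃ ∥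
  hlawka y₀ y₁ y₂ y₃ Σ≡0 = subst (_≤ ∥ y₀ ∥ + ∥ y₁ ∥ + ∥ y₂ ∥ + ∥ y₃ ∥)
    (cong₂ _+_ (cong₂ _+_ (sgn-* (y₀ + y₁)) (sgn-* (y₀ + y₂))) (sgn-* (y₀ + y₃)))
    (signs (sign (y₀ + y₁)) (sign (y₀ + y₂)) (sign (y₀ + y₃)))
    where
    bound : ∀ a b d i j k l c → sg a + sg b + sg d + c ≡ sg i → sg a + c ≡ sg j → sg b + c ≡ sg k → sg d + c ≡ sg l →
            sg a * (y₀ + y₁) + sg b * (y₀ + y₂) + sg d * (y₀ + y₃) ≤ ∥ y₀ ∥ + ∥ y₁ ∥ + ∥ y₂ ∥ + ∥ y₃ ∥
    bound a b d i j k l c eq₀ eq₁ eq₂ eq₃ = subst (_≤ ∥ y₀ ∥ + ∥ y₁ ∥ + ∥ y₂ ∥ + ∥ y₃ ∥)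
      (trans (cong₂ _+_ (cong₂ _+_ (cong₂ _+_ (cong (_* y₀) (sym eq₀)) (cong (_* y₁) (sym eq₁)))
        (cong (_* y₂) (sym eq₂))) (cong (_* y₃) (sym eq₃)))
        (trans (lem (sg a) (sg b) (sg d) c y₀ y₁ y₂ y₃)
          (trans (cong (λ z → sg a * (y₀ + y₁) + sg b * (y₀ + y₂) + sg d * (y₀ + y₃) + c * z) Σ≡0)
          (lem′ (sg a * (y₀ + y₁) + sg b * (y₀ + y₂) + sg d * (y₀ + y₃)) c))))
      (+-mono-≤ (+-mono-≤ (+-mono-≤ (sg-*-≤ i y₀) (sg-*-≤ j y₁)) (sg-*-≤ k y₂)) (sg-*-≤ l y₃))
      where
      lem = solve 8 (λ e₁ e₂ e₃ c y₀ y₁ y₂ y₃ →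
        (e₁ :+ e₂ :+ e₃ :+ c) :* y₀ :+ (e₁ :+ c) :* y₁ :+ (e₂ :+ c) :* y₂ :+ (e₃ :+ c) :* y₃
            := e₁ :* (y₀ :+ y₁) :+ e₂ :* (y₀ :+ y₂) :+ e₃ :* (y₀ :+ y₃) :+ c :* (y₀ :+ y₁ :+ y₂ :+ y₃)) refl
      lem′ : ∀ x c → x + c * 0ℤ ≡ x
      lem′ = solve-∀
    signs : ∀ i j k → sg i * (y₀ + y₁) + sg j * (y₀ + y₂) + sg k * (y₀ + y₃) ≤ ∥ y₀ ∥ + ∥ y₁ ∥ + ∥ y₂ ∥ + ∥ y₃ ∥
    signs 0F 0F 0F = bound 0F 0F 0F 0F 1F 1F 1F (- + 2) refl refl refl refl
    signs 0F 0F 1F = bound 0F 0F 1F 0F 0F 0F 1F 0ℤ refl refl refl refl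
    signs 0F 1F 0F = bound 0F 1F 0F 0F 0F 1F 0F 0ℤ refl refl refl refl
    signs 0F 1F 1F = bound 0F 1F 1F 1F 0F 1F 1F 0ℤ refl refl refl refl
    signs 1F 0F 0F = bound 1F 0F 0F 0F 1F 0F 0F 0ℤ refl refl refl refl
    signs 1F 0F 1F = bound 1F 0F 1F 1F 1F 0F 1F 0ℤ refl refl refl refl
    signs 1F 1F 0F = bound 1F 1F 0F 1F 1F 1F 0F 0ℤ refl refl refl refl
    signs 1F 1F 1F = bound 1F 1F 1F 1F 0F 0F 0F (+ 2) refl refl refl refl

  -- Of the 15 pairs of minors, the 12 sharing an index yield each product ∣ xᵢ ∣ ∣ hⱼ ∣ with i ≠ j
  -- once. The three complementary pairs yield ∣ x₀ h₀ + xᵢ hᵢ ∣; the triangle inequality would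
  -- count x₀ h₀ three times, but as the xᵢ hᵢ sum to zero, `hlawka` bounds the three by the missing
  -- diagonal ∑ ∣ xᵢ hᵢ ∣.
  area-pairs : ∀ v w c → area (pairs v w c) ≤ ∥ comps v ∥₁ * ∥ trivector v w c ∥₁
  area-pairs v w c = subst₂ _≤_
    (sym (trans (cong₂ _+_ (cong₂ _+_ (plus (x₀ v) (h₃ v w c) (share₀₁,₀₂ v w c))
    (cong₂ _+_ (minus (x₀ v) (h₂ v w c) (share₀₁,₀₃ v w c))
    (cong₂ _+_ (plus (x₁ v) (h₃ v w c) (share₀₁,₁₂ v w c))
    (cong₂ _+_ (minus (x₁ v) (h₂ v w c) (share₀₁,₁₃ v w c)) (cong (_+ 0ℤ) (cong ∥_∥ (share₀₁,₂₃ v w c)))))))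
      (cong₂ _+_ (cong₂ _+_ (plus (x₀ v) (h₁ v w c) (share₀₂,₀₃ v w c))
        (cong₂ _+_ (plus (x₂ v) (h₃ v w c) (share₀₂,₁₂ v w c))
        (cong₂ _+_ (trans (cong ∥_∥ (share₀₂,₁₃ v w c)) (∥∥-neg (x₀ v * h₀ v w c + x₂ v * h₂ v w c)))
        (cong (_+ 0ℤ) (plus (x₂ v) (h₁ v w c) (share₀₂,₂₃ v w c))))))
      (cong₂ _+_ (cong₂ _+_ (cong ∥_∥ (share₀₃,₁₂ v w c))
        (cong₂ _+_ (minus (x₃ v) (h₂ v w c) (share₀₃,₁₃ v w c))
        (cong (_+ 0ℤ) (plus (x₃ v) (h₁ v w c) (share₀₃,₂₃ v w c)))))
      (cong₂ _+_ (cong₂ _+_ (minus (x₁ v) (h₀ v w c) (share₁₂,₁₃ v w c))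
        (cong (_+ 0ℤ) (minus (x₂ v) (h₀ v w c) (share₁₂,₂₃ v w c))))
      (cong (λ z → z + 0ℤ + (0ℤ + 0ℤ)) (minus (x₃ v) (h₀ v w c) (share₁₃,₂₃ v w c)))))))
    (collect (∥ x₀ v ∥) (∥ x₁ v ∥) (∥ x₂ v ∥) (∥ x₃ v ∥) (∥ h₀ v w c ∥) (∥ h₁ v w c ∥) (∥ h₂ v w c ∥) (∥ h₃ v w c ∥)
      (∥ x₀ v * h₀ v w c + x₁ v * h₁ v w c ∥) (∥ x₀ v * h₀ v w c + x₂ v * h₂ v w c ∥)
      (∥ x₀ v * h₀ v w c + x₃ v * h₃ v w c ∥))))
    (total (∥ x₀ v ∥) (∥ x₁ v ∥) (∥ x₂ v ∥) (∥ x₃ v ∥) (∥ h₀ v w c ∥) (∥ h₁ v w c ∥) (∥ h₂ v w c ∥) (∥ h₃ v w c ∥))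
    (ℤ.+-monoʳ-≤ others (subst (z ≤_) products
      (hlawka (x₀ v * h₀ v w c) (x₁ v * h₁ v w c) (x₂ v * h₂ v w c) (x₃ v * h₃ v w c) (h·v≡0 v w c))))
    where
    plus : ∀ {x} a b → x ≡ a * b → ∥ x ∥ ≡ ∥ a ∥ * ∥ b ∥
    plus a b eq = trans (cong ∥_∥ eq) (∥∥-* a b)
    minus : ∀ {x} a b → x ≡ - (a * b) → ∥ x ∥ ≡ ∥ a ∥ * ∥ b ∥
    minus a b eq = trans (cong ∥_∥ eq) (trans (∥∥-neg (a * b)) (∥∥-* a b))
    z = ∥ x₀ v * h₀ v w c + x₁ v * h₁ v w c ∥ + ∥ x₀ v * h₀ v w c + x₂ v * h₂ v w c ∥ + ∥ x₀ v * h₀ v w c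
      + x₃ v * h₃ v w c ∥
    others = (∥ x₁ v ∥ + ∥ x₂ v ∥ + ∥ x₃ v ∥) * ∥ h₀ v w c ∥ + (∥ x₀ v ∥ + ∥ x₂ v ∥ + ∥ x₃ v ∥) * ∥ h₁ v w c ∥
      + (∥ x₀ v ∥ + ∥ x₁ v ∥ + ∥ x₃ v ∥) * ∥ h₂ v w c ∥ + (∥ x₀ v ∥ + ∥ x₁ v ∥ + ∥ x₂ v ∥) * ∥ h₃ v w c ∥
    products : ∥ x₀ v * h₀ v w c ∥ + ∥ x₁ v * h₁ v w c ∥ + ∥ x₂ v * h₂ v w c ∥ + ∥ x₃ v * h₃ v w c ∥
      ≡ ∥ x₀ v ∥ * ∥ h₀ v w c ∥ + ∥ x₁ v ∥ * ∥ h₁ v w c ∥ + ∥ x₂ v ∥ * ∥ h₂ v w c ∥ + ∥ x₃ v ∥ * ∥ h₃ v w c ∥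
    products = cong₂ _+_ (cong₂ _+_ (cong₂ _+_ (∥∥-* (x₀ v) (h₀ v w c)) (∥∥-* (x₁ v) (h₁ v w c)))
      (∥∥-* (x₂ v) (h₂ v w c))) (∥∥-* (x₃ v) (h₃ v w c))
    collect = solve 11 (λ u0 u1 u2 u3 n0 n1 n2 n3 z1 z2 z3 →
      (u0 :* n3 :+ (u0 :* n2 :+ (u1 :* n3 :+ (u1 :* n2 :+ (z1 :+ (con 0ℤ)))))
      :+ (u0 :* n1 :+ (u2 :* n3 :+ (z2 :+ (u2 :* n1 :+ (con 0ℤ))))
      :+ (z3 :+ (u3 :* n2 :+ (u3 :* n1 :+ (con 0ℤ)))
      :+ (u1 :* n0 :+ (u2 :* n0 :+ (con 0ℤ)) :+ (u3 :* n0 :+ con 0ℤ :+ (con 0ℤ :+ con 0ℤ))))))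
      := (u1 :+ u2 :+ u3) :* n0 :+ (u0 :+ u2 :+ u3) :* n1 :+ (u0 :+ u1 :+ u3) :* n2 :+ (u0 :+ u1 :+ u2) :* n3
        :+ (z1 :+ z2 :+ z3)) refl
    total = solve 8 (λ u0 u1 u2 u3 n0 n1 n2 n3 →
      (u1 :+ u2 :+ u3) :* n0 :+ (u0 :+ u2 :+ u3) :* n1 :+ (u0 :+ u1 :+ u3) :* n2 :+ (u0 :+ u1 :+ u2) :* n3
      :+ (u0 :* n0 :+ u1 :* n1 :+ u2 :* n2 :+ u3 :* n3)
      := (u0 :+ (u1 :+ (u2 :+ (u3 :+ con 0ℤ)))) :* (n0 :+ (n1 :+ (n2 :+ (n3 :+ con 0ℤ))))) refl

  -- Unimodular flags and their simultaneous reduction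

  record Flag (v : Vector) : Set where
    constructor flag
    field
      w c d : Vector
      unimodular : det v w c d ≡ 1ℤ

    A K : ℤ
    A = ∥ bivector v w ∥₁
    K = ∥ trivector v w c ∥₁

  ∥∥₁-nonNeg : ∀ xs → 0ℤ ≤ ∥ xs ∥₁
  ∥∥₁-nonNeg [] = ≤-refl
  ∥∥₁-nonNeg (x ∷ xs) = 0≤-+ (0≤∥∥ x) (∥∥₁-nonNeg xs)

  cong₄ : ∀ {a b c d a′ b′ c′ d′ : ℤ} → a ≡ a′ → b ≡ b′ → c ≡ c′ → d ≡ d′ → ∥ a ∷ b ∷ c ∷ d ∷ [] ∥₁
    ≡ ∥ a′ ∷ b′ ∷ c′ ∷ d′ ∷ [] ∥₁
  cong₄ refl refl refl refl = refl

  cong₆ : ∀ {a b c d e f a′ b′ c′ d′ e′ f′ : ℤ} → a ≡ a′ → b ≡ b′ → c ≡ c′ → d ≡ d′ → e ≡ e′ → f ≡ f′ →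
          ∥ a ∷ b ∷ c ∷ d ∷ e ∷ f ∷ [] ∥₁ ≡ ∥ a′ ∷ b′ ∷ c′ ∷ d′ ∷ e′ ∷ f′ ∷ [] ∥₁
  cong₆ refl refl refl refl refl refl = refl

  Reduced : ∀ {v} → Flag v → Set
  Reduced {v} F = K * K ≤ + 2 * A × A * A ≤ + 2 * (∥ comps v ∥₁ * K)
    where open Flag F

  private
    -- A dual step puts d + r c in the place of c; it lowers `K` and leaves `A`, which depends on v
    -- and w only. A primal step puts c + r w in the place of w; it lowers `A` and leaves `K`. So
    -- `K + A` decreases until both pairs are reduced.
    reduce-fuel : ∀ n {v} (F : Flag v) → Flag.K F + Flag.A F ≤ + n → ∃[ F′ ] Reduced {v} F′
    reduce-fuel n {v} F@(flag w c d unimodular) h = dual (gauss (dual-pairs v w c d))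
      where
      open Flag F using (A; K)
      recurse : ∀ n (F′ : Flag v) → Flag.K F′ + Flag.A F′ < K + A → K + A ≤ + n → ∃[ F″ ] Reduced {v} F″
      recurse zero F′ lt h = contradiction (ℤ.<-≤-trans lt h)
        (ℤ.≤⇒≯ (0≤-+ (∥∥₁-nonNeg (trivector v (Flag.w F′) (Flag.c F′))) (∥∥₁-nonNeg (bivector v (Flag.w F′)))))
      recurse (suc n) F′ lt h = reduce-fuel n F′ (ℤ.i<j⇒i≤pred[j] (ℤ.<-≤-trans lt h))
      primal : K * K ≤ + 2 * A → (∃[ r ] norm₂ (shear r (pairs v w c)) < norm₁ (pairs v w c))
        ⊎ (norm₁ (pairs v w c) * norm₁ (pairs v w c) ≤ + 2 * area (pairs v w c)) →
               ∃[ F″ ] Reduced {v} F″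
      primal KK≤2A (inj₁ (r , lt)) = recurse n
        (flag (c ⊕ r · w) (neg w) d (trans (det-turn′ v w c d r) unimodular))
        (subst (λ z → z + ∥ bivector v (c ⊕ r · w) ∥₁ < K + A)
          (sym (cong₄ (h₀-turn v w c r) (h₁-turn v w c r) (h₂-turn v w c r) (h₃-turn v w c r)))
          (ℤ.+-monoʳ-< K (subst (_< A)
            (cong₆ (m₀₁-⊕ v w c r) (m₀₂-⊕ v w c r) (m₀₃-⊕ v w c r) (m₁₂-⊕ v w c r) (m₁₃-⊕ v w c r) (m₂₃-⊕ v w c r))
            lt))) h
      primal KK≤2A (inj₂ le) = F , KK≤2A , ≤-trans le (ℤ.*-monoˡ-≤-nonNeg (+ 2) (area-pairs v w c))
      dual : (∃[ r ] norm₂ (shear r (dual-pairs v w c d)) < norm₁ (dual-pairs v w c d))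
        ⊎ (norm₁ (dual-pairs v w c d) * norm₁ (dual-pairs v w c d) ≤ + 2 * area (dual-pairs v w c d)) →
             ∃[ F″ ] Reduced {v} F″
      dual (inj₁ (r , lt)) = recurse n
        (flag w (d ⊕ r · c) (neg c) (trans (det-turn v w c d r) unimodular))
        (ℤ.+-monoˡ-< A (subst (_< K) (cong₄ (h₀-⊕ v w c d r) (h₁-⊕ v w c d r) (h₂-⊕ v w c d r) (h₃-⊕ v w c d r)) lt)) h
      dual (inj₂ le) = primal (subst (λ z → K * K ≤ + 2 * z) (area-dual v w c d unimodular) le) (gauss (pairs v w c))

  reduce : ∀ {v} → Flag v → ∃[ F ] Reduced {v} F
  reduce F = reduce-fuel ∣ K + A ∣ F (x≤∥x∥ (K + A))
    where open Flag F

  -- Distance from w to the line of v and from c to the plane of v and w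

  total : Vector → ℤ
  total (vec a b c d) = a + b + c + d

  private
    part₃ : ∀ a b c x y z → a + b + c ≤ a + (b + (c + 0ℤ)) + (∥ x ∥ + ∥ y ∥ + ∥ z ∥)
    part₃ a b c x y z = 0≤-⇒≤ (0≤-+ (0≤-+ (0≤∥∥ x) (0≤∥∥ y)) (0≤∥∥ z)) (lem a b c (∥ x ∥ + ∥ y ∥ + ∥ z ∥))
      where
      lem = solve 4 (λ a b c e → e := a :+ (b :+ (c :+ con 0ℤ)) :+ e :- (a :+ b :+ c)) refl

    ∥∥-+₃ : ∀ x y z → ∥ x + y + z ∥ ≤ ∥ x ∥ + ∥ y ∥ + ∥ z ∥
    ∥∥-+₃ x y z = ≤-trans (∥∥-+ (x + y) z) (ℤ.+-monoˡ-≤ ∥ z ∥ (∥∥-+ x y))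

    ∥sg*∥≤ : ∀ i x → ∥ sg i * x ∥ ≤ ∥ x ∥
    ∥sg*∥≤ 0F x = ≤-reflexive (cong ∥_∥ (ℤ.*-identityˡ x))
    ∥sg*∥≤ 1F x = ≤-reflexive (trans (cong ∥_∥ (ℤ.-1*i≡-i x)) (∥∥-neg x))

    -- The outer signs come from `weigh`, the inner ones from the orientation of the minors; `p`,
    -- `q`, `r` are the components that do not occur in the sum.
    weighted : ∀ i a j b k c x y z p q r → ∥ sg i * (sg a * x) + sg j * (sg b * y) + sg k * (sg c * z) ∥
               ≤ ∥ x ∥ + (∥ y ∥ + (∥ z ∥ + 0ℤ)) + (∥ p ∥ + ∥ q ∥ + ∥ r ∥)
    weighted i a j b k c x y z p q r = ≤-trans (∥∥-+₃ (sg i * (sg a * x)) (sg j * (sg b * y)) (sg k * (sg c * z)))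
      (≤-trans (+-mono-≤ (+-mono-≤ (twice i a x) (twice j b y)) (twice k c z)) (part₃ (∥ x ∥) (∥ y ∥) (∥ z ∥) p q r))
      where
      twice : ∀ i a x → ∥ sg i * (sg a * x) ∥ ≤ ∥ x ∥
      twice i a x = ≤-trans (∥sg*∥≤ i (sg a * x)) (∥sg*∥≤ a x)

  -- The difference is the sum of vⱼ w₀ - v₀ wⱼ over j, that is, three minors up to sign. Dividing
  -- by S, w lies within A/S of a multiple of v.
  row-bound₀ : ∀ v w → ∥ total v * x₀ w - x₀ v * total w ∥ ≤ ∥ bivector v w ∥₁
  row-bound₀ v@(vec v0 v1 v2 v3) w@(vec w0 w1 w2 w3) = subst₂ _≤_ (cong ∥_∥ (sym (lem v0 v1 v2 v3 w0 w1 w2 w3)))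
    (reorder (∥ m₀₁ v w ∥) (∥ m₀₂ v w ∥) (∥ m₀₃ v w ∥) (∥ m₁₂ v w ∥) (∥ m₁₃ v w ∥) (∥ m₂₃ v w ∥))
    (weighted 0F 1F 0F 1F 0F 1F (m₀₁ v w) (m₀₂ v w) (m₀₃ v w) (m₁₂ v w) (m₁₃ v w) (m₂₃ v w))
    where
    lem = solve 8 (λ v0 v1 v2 v3 w0 w1 w2 w3 →
      (v0 :+ v1 :+ v2 :+ v3) :* w0 :- v0 :* (w0 :+ w1 :+ w2 :+ w3)
      := con 1ℤ :* (con (- 1ℤ) :* (v0 :* w1 :- v1 :* w0)) :+ con 1ℤ :* (con (- 1ℤ) :* (v0 :* w2 :- v2 :* w0))
        :+ con 1ℤ :* (con (- 1ℤ) :* (v0 :* w3 :- v3 :* w0))) refl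
    reorder = solve 6 (λ a b c d e f → a :+ (b :+ (c :+ con 0ℤ)) :+ (d :+ e :+ f)
      := a :+ (b :+ (c :+ (d :+ (e :+ (f :+ con 0ℤ)))))) refl

  row-bound₁ : ∀ v w → ∥ total v * x₁ w - x₁ v * total w ∥ ≤ ∥ bivector v w ∥₁
  row-bound₁ v@(vec v0 v1 v2 v3) w@(vec w0 w1 w2 w3) = subst₂ _≤_ (cong ∥_∥ (sym (lem v0 v1 v2 v3 w0 w1 w2 w3)))
    (reorder (∥ m₀₁ v w ∥) (∥ m₀₂ v w ∥) (∥ m₀₃ v w ∥) (∥ m₁₂ v w ∥) (∥ m₁₃ v w ∥) (∥ m₂₃ v w ∥))
    (weighted 0F 0F 0F 1F 0F 1F (m₀₁ v w) (m₁₂ v w) (m₁₃ v w) (m₀₂ v w) (m₀₃ v w) (m₂₃ v w))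
    where
    lem = solve 8 (λ v0 v1 v2 v3 w0 w1 w2 w3 →
      (v0 :+ v1 :+ v2 :+ v3) :* w1 :- v1 :* (w0 :+ w1 :+ w2 :+ w3)
      := con 1ℤ :* (con 1ℤ :* (v0 :* w1 :- v1 :* w0)) :+ con 1ℤ :* (con (- 1ℤ) :* (v1 :* w2 :- v2 :* w1))
        :+ con 1ℤ :* (con (- 1ℤ) :* (v1 :* w3 :- v3 :* w1))) refl
    reorder = solve 6 (λ a b c d e f → a :+ (d :+ (e :+ con 0ℤ)) :+ (b :+ c :+ f)
      := a :+ (b :+ (c :+ (d :+ (e :+ (f :+ con 0ℤ)))))) refl

  row-bound₂ : ∀ v w → ∥ total v * x₂ w - x₂ v * total w ∥ ≤ ∥ bivector v w ∥₁
  row-bound₂ v@(vec v0 v1 v2 v3) w@(vec w0 w1 w2 w3) = subst₂ _≤_ (cong ∥_∥ (sym (lem v0 v1 v2 v3 w0 w1 w2 w3)))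
    (reorder (∥ m₀₁ v w ∥) (∥ m₀₂ v w ∥) (∥ m₀₃ v w ∥) (∥ m₁₂ v w ∥) (∥ m₁₃ v w ∥) (∥ m₂₃ v w ∥))
    (weighted 0F 0F 0F 0F 0F 1F (m₀₂ v w) (m₁₂ v w) (m₂₃ v w) (m₀₁ v w) (m₀₃ v w) (m₁₃ v w))
    where
    lem = solve 8 (λ v0 v1 v2 v3 w0 w1 w2 w3 →
      (v0 :+ v1 :+ v2 :+ v3) :* w2 :- v2 :* (w0 :+ w1 :+ w2 :+ w3)
      := con 1ℤ :* (con 1ℤ :* (v0 :* w2 :- v2 :* w0)) :+ con 1ℤ :* (con 1ℤ :* (v1 :* w2 :- v2 :* w1))
        :+ con 1ℤ :* (con (- 1ℤ) :* (v2 :* w3 :- v3 :* w2))) refl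
    reorder = solve 6 (λ a b c d e f → b :+ (d :+ (f :+ con 0ℤ)) :+ (a :+ c :+ e)
      := a :+ (b :+ (c :+ (d :+ (e :+ (f :+ con 0ℤ)))))) refl

  row-bound₃ : ∀ v w → ∥ total v * x₃ w - x₃ v * total w ∥ ≤ ∥ bivector v w ∥₁
  row-bound₃ v@(vec v0 v1 v2 v3) w@(vec w0 w1 w2 w3) = subst₂ _≤_ (cong ∥_∥ (sym (lem v0 v1 v2 v3 w0 w1 w2 w3)))
    (reorder (∥ m₀₁ v w ∥) (∥ m₀₂ v w ∥) (∥ m₀₃ v w ∥) (∥ m₁₂ v w ∥) (∥ m₁₃ v w ∥) (∥ m₂₃ v w ∥))
    (weighted 0F 0F 0F 0F 0F 0F (m₀₃ v w) (m₁₃ v w) (m₂₃ v w) (m₀₁ v w) (m₀₂ v w) (m₁₂ v w))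
    where
    lem = solve 8 (λ v0 v1 v2 v3 w0 w1 w2 w3 →
      (v0 :+ v1 :+ v2 :+ v3) :* w3 :- v3 :* (w0 :+ w1 :+ w2 :+ w3)
      := con 1ℤ :* (con 1ℤ :* (v0 :* w3 :- v3 :* w0)) :+ con 1ℤ :* (con 1ℤ :* (v1 :* w3 :- v3 :* w1))
        :+ con 1ℤ :* (con 1ℤ :* (v2 :* w3 :- v3 :* w2))) refl
    reorder = solve 6 (λ a b c d e f → c :+ (e :+ (f :+ con 0ℤ)) :+ (a :+ b :+ d)
      := a :+ (b :+ (c :+ (d :+ (e :+ (f :+ con 0ℤ)))))) refl

  -- The average, with weights ∣ m ∣, of the combinations of v and w that agree with c
  -- in two coordinates.
  weigh : (v w a b : Vector) → ℤ
  weigh v w a b = sgn (m₀₁ v w) * m₀₁ a b + sgn (m₀₂ v w) * m₀₂ a b + sgn (m₀₃ v w) * m₀₃ a b + sgn (m₁₂ v w) * m₁₂ a b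
    + sgn (m₁₃ v w) * m₁₃ a b + sgn (m₂₃ v w) * m₂₃ a b

  weigh-self : ∀ v w → weigh v w v w ≡ ∥ bivector v w ∥₁
  weigh-self v w = trans (cong₂ _+_
    (cong₂ _+_ (cong₂ _+_ (cong₂ _+_ (cong₂ _+_ (sgn-* (m₀₁ v w)) (sgn-* (m₀₂ v w))) (sgn-* (m₀₃ v w)))
    (sgn-* (m₁₂ v w))) (sgn-* (m₁₃ v w))) (sgn-* (m₂₃ v w)))
    (lem (∥ m₀₁ v w ∥) (∥ m₀₂ v w ∥) (∥ m₀₃ v w ∥) (∥ m₁₂ v w ∥) (∥ m₁₃ v w ∥) (∥ m₂₃ v w ∥))
    where
    lem = solve 6 (λ a b c d e f → a :+ b :+ c :+ d :+ e :+ f := a :+ (b :+ (c :+ (d :+ (e :+ (f :+ con 0ℤ)))))) refl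

  private
    weigh-polynomial : ∀ {n} (s01 s02 s03 s12 s13 s23 v0 v1 v2 v3 w0 w1 w2 w3 : Polynomial n) → Polynomial n
    weigh-polynomial s01 s02 s03 s12 s13 s23 v0 v1 v2 v3 w0 w1 w2 w3 =
      s01 :* (v0 :* w1 :- v1 :* w0) :+ s02 :* (v0 :* w2 :- v2 :* w0) :+ s03 :* (v0 :* w3 :- v3 :* w0)
        :+ s12 :* (v1 :* w2 :- v2 :* w1) :+ s13 :* (v1 :* w3 :- v3 :* w1) :+ s23 :* (v2 :* w3 :- v3 :* w2)

  -- The term of `weigh` with indices i, j contributes, by Laplace expansion, the 3 × 3 minor of v,
  -- w, c in the columns i, j, 0. It vanishes if 0 is one of i, j, and the other three are
  -- components of the trivector up to sign. Dividing by A, c lies within K/A of the plane of v and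
  -- w.
  mean-bound₀ : ∀ v w c → ∥ weigh v w v w * x₀ c + x₀ v * weigh v w w c - x₀ w * weigh v w v c ∥ ≤ ∥ trivector v w c ∥₁
  mean-bound₀ v@(vec v0 v1 v2 v3) w@(vec w0 w1 w2 w3) c@(vec c0 c1 c2 c3) = subst₂ _≤_
    (cong ∥_∥ (sym (lem v0 v1 v2 v3 w0 w1 w2 w3 c0 c1 c2 c3 (sgn (m₀₁ v w)) (sgn (m₀₂ v w)) (sgn (m₀₃ v w))
      (sgn (m₁₂ v w)) (sgn (m₁₃ v w)) (sgn (m₂₃ v w)))))
    (reorder (∥ h₀ v w c ∥) (∥ h₁ v w c ∥) (∥ h₂ v w c ∥) (∥ h₃ v w c ∥))
    (weighted (sign (m₁₂ v w)) 0F (sign (m₁₃ v w)) 1F (sign (m₂₃ v w)) 0F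
      (h₃ v w c) (h₂ v w c) (h₁ v w c) (h₀ v w c) 0ℤ 0ℤ)
    where
    lem = solve 18 (λ v0 v1 v2 v3 w0 w1 w2 w3 c0 c1 c2 c3 s01 s02 s03 s12 s13 s23 →
      let W = weigh-polynomial s01 s02 s03 s12 s13 s23
      in W v0 v1 v2 v3 w0 w1 w2 w3 :* c0 :+ v0 :* W w0 w1 w2 w3 c0 c1 c2 c3 :- w0 :* W v0 v1 v2 v3 c0 c1 c2 c3
         := s12 :* (con 1ℤ :* ((v0 :* w1 :- v1 :* w0) :* c2 :+ (v1 :* w2 :- v2 :* w1) :* c0
           :- (v0 :* w2 :- v2 :* w0) :* c1))
           :+ s13 :* (con (- 1ℤ) :* ((v0 :* w3 :- v3 :* w0) :* c1 :- (v0 :* w1 :- v1 :* w0) :* c3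
           :- (v1 :* w3 :- v3 :* w1) :* c0))
           :+ s23 :* (con 1ℤ :* ((v0 :* w2 :- v2 :* w0) :* c3 :+ (v2 :* w3 :- v3 :* w2) :* c0
           :- (v0 :* w3 :- v3 :* w0) :* c2))) refl
    reorder = solve 4 (λ a b c d → d :+ (c :+ (b :+ con 0ℤ)) :+ (a :+ con 0ℤ :+ con 0ℤ)
      := a :+ (b :+ (c :+ (d :+ con 0ℤ)))) refl

  mean-bound₁ : ∀ v w c → ∥ weigh v w v w * x₁ c + x₁ v * weigh v w w c - x₁ w * weigh v w v c ∥ ≤ ∥ trivector v w c ∥₁
  mean-bound₁ v@(vec v0 v1 v2 v3) w@(vec w0 w1 w2 w3) c@(vec c0 c1 c2 c3) = subst₂ _≤_
    (cong ∥_∥ (sym (lem v0 v1 v2 v3 w0 w1 w2 w3 c0 c1 c2 c3 (sgn (m₀₁ v w)) (sgn (m₀₂ v w)) (sgn (m₀₃ v w))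
      (sgn (m₁₂ v w)) (sgn (m₁₃ v w)) (sgn (m₂₃ v w)))))
    (reorder (∥ h₀ v w c ∥) (∥ h₁ v w c ∥) (∥ h₂ v w c ∥) (∥ h₃ v w c ∥))
    (weighted (sign (m₀₂ v w)) 1F (sign (m₀₃ v w)) 0F (sign (m₂₃ v w)) 1F
      (h₃ v w c) (h₂ v w c) (h₀ v w c) (h₁ v w c) 0ℤ 0ℤ)
    where
    lem = solve 18 (λ v0 v1 v2 v3 w0 w1 w2 w3 c0 c1 c2 c3 s01 s02 s03 s12 s13 s23 →
      let W = weigh-polynomial s01 s02 s03 s12 s13 s23
      in W v0 v1 v2 v3 w0 w1 w2 w3 :* c1 :+ v1 :* W w0 w1 w2 w3 c0 c1 c2 c3 :- w1 :* W v0 v1 v2 v3 c0 c1 c2 c3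
         := s02 :* (con (- 1ℤ) :* ((v0 :* w1 :- v1 :* w0) :* c2 :+ (v1 :* w2 :- v2 :* w1) :* c0
           :- (v0 :* w2 :- v2 :* w0) :* c1))
           :+ s03 :* (con 1ℤ :* ((v0 :* w3 :- v3 :* w0) :* c1 :- (v0 :* w1 :- v1 :* w0) :* c3
           :- (v1 :* w3 :- v3 :* w1) :* c0))
           :+ s23 :* (con (- 1ℤ) :* ((v1 :* w3 :- v3 :* w1) :* c2 :- (v1 :* w2 :- v2 :* w1) :* c3
           :- (v2 :* w3 :- v3 :* w2) :* c1))) refl
    reorder = solve 4 (λ a b c d → d :+ (c :+ (a :+ con 0ℤ)) :+ (b :+ con 0ℤ :+ con 0ℤ)
      := a :+ (b :+ (c :+ (d :+ con 0ℤ)))) refl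

  mean-bound₂ : ∀ v w c → ∥ weigh v w v w * x₂ c + x₂ v * weigh v w w c - x₂ w * weigh v w v c ∥ ≤ ∥ trivector v w c ∥₁
  mean-bound₂ v@(vec v0 v1 v2 v3) w@(vec w0 w1 w2 w3) c@(vec c0 c1 c2 c3) = subst₂ _≤_
    (cong ∥_∥ (sym (lem v0 v1 v2 v3 w0 w1 w2 w3 c0 c1 c2 c3 (sgn (m₀₁ v w)) (sgn (m₀₂ v w)) (sgn (m₀₃ v w))
      (sgn (m₁₂ v w)) (sgn (m₁₃ v w)) (sgn (m₂₃ v w)))))
    (reorder (∥ h₀ v w c ∥) (∥ h₁ v w c ∥) (∥ h₂ v w c ∥) (∥ h₃ v w c ∥))
    (weighted (sign (m₀₁ v w)) 0F (sign (m₀₃ v w)) 1F (sign (m₁₃ v w)) 0F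
      (h₃ v w c) (h₁ v w c) (h₀ v w c) (h₂ v w c) 0ℤ 0ℤ)
    where
    lem = solve 18 (λ v0 v1 v2 v3 w0 w1 w2 w3 c0 c1 c2 c3 s01 s02 s03 s12 s13 s23 →
      let W = weigh-polynomial s01 s02 s03 s12 s13 s23
      in W v0 v1 v2 v3 w0 w1 w2 w3 :* c2 :+ v2 :* W w0 w1 w2 w3 c0 c1 c2 c3 :- w2 :* W v0 v1 v2 v3 c0 c1 c2 c3
         := s01 :* (con 1ℤ :* ((v0 :* w1 :- v1 :* w0) :* c2 :+ (v1 :* w2 :- v2 :* w1) :* c0
           :- (v0 :* w2 :- v2 :* w0) :* c1))
           :+ s03 :* (con (- 1ℤ) :* ((v0 :* w2 :- v2 :* w0) :* c3 :+ (v2 :* w3 :- v3 :* w2) :* c0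
           :- (v0 :* w3 :- v3 :* w0) :* c2))
           :+ s13 :* (con 1ℤ :* ((v1 :* w3 :- v3 :* w1) :* c2 :- (v1 :* w2 :- v2 :* w1) :* c3
           :- (v2 :* w3 :- v3 :* w2) :* c1))) refl
    reorder = solve 4 (λ a b c d → d :+ (b :+ (a :+ con 0ℤ)) :+ (c :+ con 0ℤ :+ con 0ℤ)
      := a :+ (b :+ (c :+ (d :+ con 0ℤ)))) refl

  mean-bound₃ : ∀ v w c → ∥ weigh v w v w * x₃ c + x₃ v * weigh v w w c - x₃ w * weigh v w v c ∥ ≤ ∥ trivector v w c ∥₁
  mean-bound₃ v@(vec v0 v1 v2 v3) w@(vec w0 w1 w2 w3) c@(vec c0 c1 c2 c3) = subst₂ _≤_
    (cong ∥_∥ (sym (lem v0 v1 v2 v3 w0 w1 w2 w3 c0 c1 c2 c3 (sgn (m₀₁ v w)) (sgn (m₀₂ v w)) (sgn (m₀₃ v w))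
      (sgn (m₁₂ v w)) (sgn (m₁₃ v w)) (sgn (m₂₃ v w)))))
    (reorder (∥ h₀ v w c ∥) (∥ h₁ v w c ∥) (∥ h₂ v w c ∥) (∥ h₃ v w c ∥))
    (weighted (sign (m₀₁ v w)) 1F (sign (m₀₂ v w)) 0F (sign (m₁₂ v w)) 1F
      (h₂ v w c) (h₁ v w c) (h₀ v w c) (h₃ v w c) 0ℤ 0ℤ)
    where
    lem = solve 18 (λ v0 v1 v2 v3 w0 w1 w2 w3 c0 c1 c2 c3 s01 s02 s03 s12 s13 s23 →
      let W = weigh-polynomial s01 s02 s03 s12 s13 s23
      in W v0 v1 v2 v3 w0 w1 w2 w3 :* c3 :+ v3 :* W w0 w1 w2 w3 c0 c1 c2 c3 :- w3 :* W v0 v1 v2 v3 c0 c1 c2 c3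
         := s01 :* (con (- 1ℤ) :* ((v0 :* w3 :- v3 :* w0) :* c1 :- (v0 :* w1 :- v1 :* w0) :* c3
           :- (v1 :* w3 :- v3 :* w1) :* c0))
           :+ s02 :* (con 1ℤ :* ((v0 :* w2 :- v2 :* w0) :* c3 :+ (v2 :* w3 :- v3 :* w2) :* c0
           :- (v0 :* w3 :- v3 :* w0) :* c2))
           :+ s12 :* (con (- 1ℤ) :* ((v1 :* w3 :- v3 :* w1) :* c2 :- (v1 :* w2 :- v2 :* w1) :* c3
           :- (v2 :* w3 :- v3 :* w2) :* c1))) refl
    reorder = solve 4 (λ a b c d → c :+ (b :+ (a :+ con 0ℤ)) :+ (d :+ con 0ℤ :+ con 0ℤ)
      := a :+ (b :+ (c :+ (d :+ con 0ℤ)))) refl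

  -- Integer relations of small weight between distinct positive integers

  relation : List (ℕ × ℤ) → ℤ
  relation [] = 0ℤ
  relation ((n , h) ∷ L) = + n * h + relation L

  weight : List (ℕ × ℤ) → ℕ
  weight [] = 0
  weight ((n , h) ∷ L) = ∣ h ∣ ℕ.+ weight L

  private
    drop-zero : ∀ n L → relation ((n , 0ℤ) ∷ L) ≡ relation L
    drop-zero n L = trans (cong (_+ relation L) (ℤ.*-zeroʳ (+ n))) (ℤ.+-identityˡ (relation L))

    weight-0 : ∀ L → weight L ≡ 0 → relation L ≡ 0ℤ
    weight-0 [] _ = refl
    weight-0 ((n , h) ∷ L) eq = trans (cong (λ h → relation ((n , h) ∷ L)) (ℤ.∣i∣≡0⇒i≡0 (ℕ.m+n≡0⇒m≡0 (∣ h ∣) eq)))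
      (trans (drop-zero n L) (weight-0 L (ℕ.m+n≡0⇒n≡0 (∣ h ∣) eq)))

    -- With weight at most 1 there is at most one nonzero coefficient, and it is ± 1; the absolute
    -- value of the relation would be 0 or one of the `n`.
    weight-1 : ∀ m L → 0 ℕ.< m → All (λ (n , _) → m ≢ n) L → ∣ relation L ∣ ≡ m → ¬ weight L ℕ.≤ 1
    weight-1 m [] 0<m _ eq _ = ℕ.<⇒≢ 0<m eq
    weight-1 m ((n , h) ∷ L) 0<m (m≢n ∷ distinct) eq = go (∣ h ∣) refl
      where
      go : ∀ k → ∣ h ∣ ≡ k → ¬ ∣ h ∣ ℕ.+ weight L ℕ.≤ 1
      go 0 ∣h∣≡0 le = weight-1 m L 0<m distinct
        (trans (cong ∣_∣ (sym (trans (cong (λ h → relation ((n , h) ∷ L)) (ℤ.∣i∣≡0⇒i≡0 ∣h∣≡0)) (drop-zero n L)))) eq)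
        (subst (λ k → k ℕ.+ weight L ℕ.≤ 1) ∣h∣≡0 le)
      go (suc k) ∣h∣≡ le = m≢n (trans (sym eq) (trans (cong ∣_∣ (trans
          (cong (λ z → + n * h + z) (weight-0 L (ℕ.m+n≡0⇒n≡0 k rest≡0))) (ℤ.+-identityʳ (+ n * h))))
        (trans (ℤ.abs-* (+ n) h) (trans (cong (n ℕ.*_) (trans ∣h∣≡ (cong suc (ℕ.m+n≡0⇒m≡0 k rest≡0))))
          (ℕ.*-identityʳ n)))))
        where
        rest≡0 : k ℕ.+ weight L ≡ 0
        rest≡0 = ℕ.n≤0⇒n≡0 (ℕ.s≤s⁻¹ (subst (λ k → k ℕ.+ weight L ℕ.≤ 1) ∣h∣≡ le))

  -- A relation with a coefficient ± 1 leaves weight 1 for the others, hence m = n for two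
  -- of the integers.
  weight≥3 : ∀ L → All (λ (n , _) → 0 ℕ.< n) L → AllPairs (λ (m , _) (n , _) → m ≢ n) L → relation L ≡ 0ℤ →
             ¬ All (λ (_ , h) → h ≡ 0ℤ) L → 3 ℕ.≤ weight L
  weight≥3 [] _ _ _ nonzero = contradiction [] nonzero
  weight≥3 ((n , h) ∷ L) (0<n ∷ positive) (distinct ∷ rest) eq nonzero = go (∣ h ∣) refl
    where
    ∣rest∣≡ : ∣ relation L ∣ ≡ n ℕ.* ∣ h ∣
    ∣rest∣≡ = trans (cong ∣_∣
      (trans (lem (+ n * h) (relation L)) (trans (cong (_- + n * h) eq) (ℤ.+-identityˡ (- (+ n * h))))))
      (trans (ℤ.∣-i∣≡∣i∣ (+ n * h)) (ℤ.abs-* (+ n) h))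
      where
      lem : ∀ x y → y ≡ x + y - x
      lem = solve-∀
    go : ∀ k → ∣ h ∣ ≡ k → 3 ℕ.≤ ∣ h ∣ ℕ.+ weight L
    go 0 ∣h∣≡0 = ℕ.≤-trans (weight≥3 L positive rest
        (trans (sym (trans (cong (λ h → relation ((n , h) ∷ L)) (ℤ.∣i∣≡0⇒i≡0 ∣h∣≡0)) (drop-zero n L))) eq)
        (λ zeros → nonzero (ℤ.∣i∣≡0⇒i≡0 ∣h∣≡0 ∷ zeros)))
      (ℕ.m≤n+m (weight L) (∣ h ∣))
    go 1 ∣h∣≡1 = subst (λ k → 3 ℕ.≤ k ℕ.+ weight L) (sym ∣h∣≡1) (ℕ.s≤s (ℕ.≰⇒>
      (weight-1 n L 0<n distinct (trans ∣rest∣≡ (trans (cong (n ℕ.*_) ∣h∣≡1) (ℕ.*-identityʳ n))))))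
    -- Here a single further unit of weight is enough; without it the relation would reduce to n h =
    -- 0.
    go (suc (suc k)) ∣h∣≡ = subst (λ k → 3 ℕ.≤ k ℕ.+ weight L) (sym ∣h∣≡) (ℕ.s≤s (ℕ.s≤s (ℕ.≤-trans
      (ℕ.n≢0⇒n>0 λ weight≡0 → ℕ.<⇒≢ (ℕ.*-mono-< 0<n (ℕ.s≤s ℕ.z≤n))
        (trans (cong ∣_∣ (sym (weight-0 L weight≡0))) (trans ∣rest∣≡ (cong (n ℕ.*_) ∣h∣≡))))
      (ℕ.m≤n+m (weight L) k))))

  -- Completing a primitive vector to a unimodular flag

  bézout : ∀ m n → ∃₂ λ x y → x * + m + y * + n ≡ + ℕ.gcd m n
  bézout m n with ℕ.Bézout.identity (ℕ.gcd-GCD m n)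
  ... | ℕ.Bézout.Identity.+- x y eq = + x ,
    - + y , trans (cong (λ u → u + - + y * + n)
    (trans (sym (ℤ.pos-* x m))
    (trans (cong +_ (sym eq)) (trans (ℤ.pos-+ d (y ℕ.* n)) (cong (λ z → + d + z) (ℤ.pos-* y n))))))
    (lem (+ d) (+ y) (+ n))
    where
    d = ℕ.gcd m n
    lem : ∀ d y n → d + y * n + - y * n ≡ d
    lem = solve-∀
  ... | ℕ.Bézout.Identity.-+ x y eq = - + x ,
    + y , trans (cong (λ v → - + x * + m + v)
    (trans (sym (ℤ.pos-* y n))
    (trans (cong +_ (sym eq)) (trans (ℤ.pos-+ d (x ℕ.* m)) (cong (λ z → + d + z) (ℤ.pos-* x m))))))
    (lem (+ d) (+ x) (+ m))
    where
    d = ℕ.gcd m n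
    lem : ∀ d x m → - x * m + (d + x * m) ≡ d
    lem = solve-∀

  primitive-pair : ∀ m n → 0 ℕ.< m → ∃₂ λ p q → ∃₂ λ x y →
                   + m ≡ + ℕ.gcd m n * p × + n ≡ + ℕ.gcd m n * q × x * p + y * q ≡ 1ℤ
  primitive-pair m n 0<m = quotients (ℕ.gcd[m,n]∣m m n) (ℕ.gcd[m,n]∣n m n) (bézout m n)
    where
    g = ℕ.gcd m n
    quotients : g ℕ.∣ m → g ℕ.∣ n → (∃₂ λ x y → x * + m + y * + n ≡ + g) →
                ∃₂ λ p q → ∃₂ λ x y → + m ≡ + g * p × + n ≡ + g * q × x * p + y * q ≡ 1ℤ
    quotients (ℕ.divides p m≡pg) (ℕ.divides q n≡qg) (x , y , eq) = + p , + q , x , y , m≡gp , n≡gq ,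
      ℤ.*-cancelˡ-≡ (+ g) (x * + p + y * + q) 1ℤ {{ℕ.≢-nonZero g≢0}}
        (trans (lem (+ g) x (+ p) y (+ q))
          (trans (cong₂ (λ u v → x * u + y * v) (sym m≡gp) (sym n≡gq)) (trans eq (sym (ℤ.*-identityʳ (+ g))))))
      where
      m≡gp : + m ≡ + g * + p
      m≡gp = trans (cong +_ (trans m≡pg (ℕ.*-comm p g))) (ℤ.pos-* g p)
      n≡gq : + n ≡ + g * + q
      n≡gq = trans (cong +_ (trans n≡qg (ℕ.*-comm q g))) (ℤ.pos-* g q)
      g≢0 : g ≢ 0
      g≢0 g≡0 = ℕ.<⇒≢ 0<m (sym (trans m≡pg (trans (cong (p ℕ.*_) g≡0) (ℕ.*-zeroʳ p))))
      lem = solve 5 (λ g x p y q → g :* (x :* p :+ y :* q) := x :* (g :* p) :+ y :* (g :* q)) refl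

  -- With u′ = p e₂ + q e₃ and u = p′ e₁ + q′ u′, the vector is v = n₀ e₀ + g₁ u. Each Bézout pair
  -- supplies the partner in its plane: w = - y″ e₀ + x″ u, c = - y′ e₁ + x′ u′ and d = - y e₂ + x
  -- e₃. The determinant is the product of the three Bézout sums.
  complete : ∀ n₀ n₁ n₂ n₃ → 0 ℕ.< n₁ → 0 ℕ.< n₂ → ℕ.gcd n₀ (ℕ.gcd n₁ (ℕ.gcd n₂ n₃)) ≡ 1 →
    Flag (vec (+ n₀) (+ n₁) (+ n₂) (+ n₃))
  complete n₀ n₁ n₂ n₃ 0<n₁ 0<n₂ gcd≡1 =
    let g₂ = ℕ.gcd n₂ n₃
        g₁ = ℕ.gcd n₁ g₂
        p , q , x , y , n₂≡ , n₃≡ , e = primitive-pair n₂ n₃ 0<n₂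
        p′ , q′ , x′ , y′ , n₁≡ , g₂≡ , e′ = primitive-pair n₁ g₂ 0<n₁
        x″ , y″ , e″ = bézout n₀ g₁
        w = vec (- y″) (x″ * p′) (x″ * (q′ * p)) (x″ * (q′ * q))
        c = vec 0ℤ (- y′) (x′ * p) (x′ * q)
        d = vec 0ℤ 0ℤ (- y) x
    in flag w c d (trans (cong₂ (λ a b → det (vec (+ n₀) a b (+ n₃)) w c d) n₁≡ (trans n₂≡ (cong (_* p) g₂≡)))
         (trans (cong (λ b → det (vec (+ n₀) (+ g₁ * p′) (+ g₁ * q′ * p) b) w c d) (trans n₃≡ (cong (_* q) g₂≡)))
         (trans (lem (+ n₀) (+ g₁) p q x y p′ q′ x′ y′ x″ y″)
           (trans (cong₂ (λ a b → a * b * (x * p + y * q)) (trans e″ (cong +_ gcd≡1)) e′) (cong (1ℤ * 1ℤ *_) e)))))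
    where
    lem = solve 12 (λ n g p q x y p′ q′ x′ y′ x″ y″ →
      let m₀₁ = n :* (x″ :* p′) :- g :* p′ :* (:- y″)
          m₀₂ = n :* (x″ :* (q′ :* p)) :- g :* q′ :* p :* (:- y″)
          m₀₃ = n :* (x″ :* (q′ :* q)) :- g :* q′ :* q :* (:- y″)
          m₁₂ = g :* p′ :* (x″ :* (q′ :* p)) :- g :* q′ :* p :* (x″ :* p′)
          m₁₃ = g :* p′ :* (x″ :* (q′ :* q)) :- g :* q′ :* q :* (x″ :* p′)
          m₂₃ = g :* q′ :* p :* (x″ :* (q′ :* q)) :- g :* q′ :* q :* (x″ :* (q′ :* p))
      in det-polynomial m₀₁ m₀₂ m₀₃ m₁₂ m₁₃ m₂₃ (con 0ℤ) (:- y′) (x′ :* p) (x′ :* q) (con 0ℤ) (con 0ℤ) (:- y) x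
         := (x″ :* n :+ y″ :* g) :* (x′ :* p′ :+ y′ :* q′) :* (x :* p :+ y :* q)) refl

-- Inequalities between natural numbers

module Estimate where

  open import Data.Nat.Base as ℕ using (ℕ; zero; suc; _+_; _*_; _∸_; _≤_; _<_)
  import Data.Nat.Properties as ℕ
  import Data.Nat.Tactic.RingSolver as ℕR
  open import Data.Product.Base using (_×_; _,_)
  open import Data.Sum.Base using (_⊎_; inj₁; inj₂; [_,_]′)
  open import Relation.Binary.PropositionalEquality using (_≡_; _≢_; refl; sym; trans; cong; subst)
  open import Relation.Nullary using (contradiction)
  open import Relation.Nullary.Decidable using (from-yes; _⊎-dec_)

  -- The inequality is the hypothesis `room` of `three-coprime`, written without subtraction. For 1,
  -- 2, 3 it would read 10 ≤ 9; that triple is left to `speeds-1-2-3`.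
  room : ∀ a b c → 0 < a → a < b → b < c →
         (a ≡ 1 × b ≡ 2 × c ≡ 3) ⊎ (2 * (a * b) + 2 * c ≤ c * (a + b))
  room a b c 0<a a<b b<c with ℕ.m≤n⇒∃[o]m+o≡n 0<a | ℕ.m≤n⇒∃[o]m+o≡n a<b | ℕ.m≤n⇒∃[o]m+o≡n b<c
  ... | zero , refl | zero , refl | zero , refl = inj₁ (refl , refl , refl)
  ... | zero , refl | zero , refl | suc l , refl = inj₂ (ℕ.m+n≤o⇒m≤o _ (ℕ.≤-reflexive (lem l)))
    where
    lem : ∀ l → (2 * (1 * 2) + 2 * (4 + l)) + l ≡ (4 + l) * (1 + 2)
    lem = ℕR.solve-∀
  ... | zero , refl | suc j , refl | l , refl = inj₂ (ℕ.m+n≤o⇒m≤o _ (ℕ.≤-reflexive (lem j l)))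
    where
    lem : ∀ j l → (2 * (1 * (3 + j)) + 2 * (4 + j + l)) + (2 + 4 * j + j * j + l * (2 + j))
          ≡ (4 + j + l) * (1 + (3 + j))
    lem = ℕR.solve-∀
  ... | suc i , refl | j , refl | l , refl = inj₂ (ℕ.m+n≤o⇒m≤o _ (ℕ.≤-reflexive (lem i j l)))
    where
    lem : ∀ i j l → (2 * ((2 + i) * (3 + i + j)) + 2 * (4 + i + j + l))
            + (l * (3 + 2 * i + j) + i + j + j * (2 + i + j))
          ≡ (4 + i + j + l) * (2 + i + (3 + i + j))
    lem = ℕR.solve-∀

  -- Infinite descent: a solution has y < x, and then (y , x - y) is a smaller one.
  golden : ∀ n x y → x ≤ n → 0 < y → x * x ≢ y * x + y * y
  golden n x y x≤n 0<y eq with ℕ.<-≤-connex y x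
  golden n x y x≤n 0<y eq | inj₂ x≤y =
    ℕ.<-irrefl eq (ℕ.≤-<-trans (ℕ.*-monoˡ-≤ x x≤y) (ℕ.m<m+n (y * x) (ℕ.*-mono-< 0<y 0<y)))
  golden zero x y x≤n 0<y eq | inj₁ y<x = contradiction (ℕ.≤-trans y<x x≤n) λ()
  golden (suc n) x y x≤n 0<y eq | inj₁ y<x with ℕ.m≤n⇒∃[o]m+o≡n y<x
  ... | d , refl = golden n y (suc d) (ℕ.≤-trans (ℕ.m≤m+n y d) (ℕ.s≤s⁻¹ x≤n)) (ℕ.s≤s ℕ.z≤n)
        (sym (ℕ.+-cancelˡ-≡ (y * y + y * suc d) _ _ (trans (l₁ y d) (trans eq (l₂ y d)))))
    where
    l₁ : ∀ y d → (y * y + y * suc d) + (suc d * y + suc d * suc d) ≡ (suc y + d) * (suc y + d)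
    l₁ = ℕR.solve-∀
    l₂ : ∀ y d → y * (suc y + d) + y * y ≡ (y * y + y * suc d) + y * y
    l₂ = ℕR.solve-∀

  xy≢x²+y² : ∀ x y → 0 < x → 0 < y → y * x ≢ x * x + y * y
  xy≢x²+y² x y 0<x 0<y eq with ℕ.≤-total x y
  ... | inj₁ x≤y = ℕ.<-irrefl eq (ℕ.≤-<-trans (ℕ.*-monoʳ-≤ y x≤y) (ℕ.m<n+m (y * y) (ℕ.*-mono-< 0<x 0<x)))
  ... | inj₂ y≤x = ℕ.<-irrefl eq (ℕ.≤-<-trans (ℕ.*-monoˡ-≤ x y≤x) (ℕ.m<m+n (x * x) (ℕ.*-mono-< 0<y 0<y)))

  private
    -- The first three alternatives contradict the hypotheses of `dichotomy`, where A ≥ 20 because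
    -- 10 · 19 < 196. The last two are sufficient for `ratios`: one eliminates A² by A² ≤ 2SK, the
    -- other is the inequality itself at S = 196.
    Small : ℕ → ℕ → Set
    Small K A = K < 3 ⊎ A < 20 ⊎ 2 * A < K * K ⊎ 15 * (K * K) + 5 * A < 3 * (K * A)
                ⊎ 5 * (K * (A * A)) + 196 * (5 * (K * K) + 5 * A) < 196 * (3 * (K * A))

    small : ∀ {K} → K < 12 → ∀ {A} → A < 66 → Small K A
    small = from-yes (ℕ.allUpTo? (λ K → ℕ.allUpTo? (λ A →
      (K ℕ.<? 3) ⊎-dec (A ℕ.<? 20) ⊎-dec (2 * A ℕ.<? K * K) ⊎-dec (15 * (K * K) + 5 * A ℕ.<? 3 * (K * A))
      ⊎-dec (5 * (K * (A * A)) + 196 * (5 * (K * K) + 5 * A) ℕ.<? 196 * (3 * (K * A)))) 66) 12)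

    small₆₆ : ∀ {K} → K < 12 → K < 3 ⊎ 15 * (K * K) + 5 * 66 < 3 * K * 66
    small₆₆ = from-yes (ℕ.allUpTo? (λ K → (K ℕ.<? 3) ⊎-dec (15 * (K * K) + 5 * 66 ℕ.<? 3 * K * 66)) 12)

    -- Both sides are affine in A, with slopes 5 and 3K ≥ 9. The check at 66 therefore settles all
    -- larger A.
    grow : ∀ {K} u b → 3 ≤ K → 15 * (K * K) + 5 * u < 3 * K * u → 15 * (K * K) + 5 * (u + b) < 3 * (K * (u + b))
    grow {K} u b 3≤K lt = begin-strict
      15 * (K * K) + 5 * (u + b)        ≡⟨ cong (15 * (K * K) +_) (ℕ.*-distribˡ-+ 5 u b) ⟩
      15 * (K * K) + (5 * u + 5 * b)  ≡⟨ ℕ.+-assoc (15 * (K * K)) (5 * u) (5 * b) ⟨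
      15 * (K * K) + 5 * u + 5 * b    <⟨ ℕ.+-mono-<-≤ lt (ℕ.*-monoˡ-≤ b (ℕ.≤-trans (ℕ.m≤m+n 5 4) (ℕ.*-monoʳ-≤ 3 3≤K))) ⟩
      3 * K * u + 3 * K * b             ≡⟨ ℕ.*-distribˡ-+ (3 * K) u b ⟨
      3 * K * (u + b)                       ≡⟨ ℕ.*-assoc 3 K (u + b) ⟩
      3 * (K * (u + b))                     ∎
      where open ℕ.≤-Reasoning

    large-A : ∀ {K A} → 3 ≤ K → K < 12 → 66 ≤ A → 15 * (K * K) + 5 * A < 3 * (K * A)
    large-A {K} {A} 3≤K K<12 66≤A = [ (λ K<3 → contradiction 3≤K (ℕ.<⇒≱ K<3))
      , (λ lt → subst (λ A → 15 * (K * K) + 5 * A < 3 * (K * A)) (ℕ.m+[n∸m]≡n 66≤A) (grow 66 (A ∸ 66) 3≤K lt)) ]′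
        (small₆₆ K<12)

    -- K² ≤ 2A gives 15 K² ≤ 30 A < 31 A, and 31 + 5 = 3 · 12; hence the bound 12.
    large-K : ∀ {K A} → 12 ≤ K → K * K ≤ 2 * A → 15 * (K * K) + 5 * A < 3 * (K * A)
    large-K {K} {A} 12≤K KK≤2A = begin-strict
      15 * (K * K) + 5 * A   <⟨ ℕ.+-monoˡ-< (5 * A) (ℕ.*-cancelˡ-< 2 (15 * (K * K)) (31 * A) (begin-strict
        2 * (15 * (K * K))       ≡⟨ ℕ.*-assoc 2 15 (K * K) ⟨
        30 * (K * K)               <⟨ ℕ.*-monoˡ-< (K * K) {{ℕ.>-nonZero (ℕ.*-mono-< 0<K 0<K)}} (ℕ.n<1+n 30) ⟩
        31 * (K * K)               ≤⟨ ℕ.*-monoʳ-≤ 31 KK≤2A ⟩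
        31 * (2 * A)               ≡⟨ ℕ.*-assoc 31 2 A ⟨
        62 * A                       ≡⟨ ℕ.*-assoc 2 31 A ⟩
        2 * (31 * A)               ∎)) ⟩
      31 * A + 5 * A           ≡⟨ ℕ.*-distribʳ-+ A 31 5 ⟨
      36 * A                       ≤⟨ ℕ.*-monoˡ-≤ A (ℕ.*-monoʳ-≤ 3 12≤K) ⟩
      3 * K * A                  ≡⟨ ℕ.*-assoc 3 K A ⟩
      3 * (K * A)                ∎
      where
      open ℕ.≤-Reasoning
      0<K : 0 < K
      0<K = ℕ.≤-trans (ℕ.m≤m+n 1 11) 12≤K

    dichotomy : ∀ {S A K} → 196 ≤ S → 3 ≤ K → K * K ≤ 2 * A → S ≤ 10 * A →
                15 * (K * K) + 5 * A < 3 * (K * A)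
                ⊎ 5 * (K * (A * A)) + 196 * (5 * (K * K) + 5 * A) < 196 * (3 * (K * A))
    dichotomy {S} {A} {K} 196≤S 3≤K KK≤2A S≤10A = go (ℕ.<-≤-connex K 12) (ℕ.<-≤-connex A 66)
      where
      Goal = 15 * (K * K) + 5 * A < 3 * (K * A)
             ⊎ 5 * (K * (A * A)) + 196 * (5 * (K * K) + 5 * A) < 196 * (3 * (K * A))
      checked : Small K A → Goal
      checked (inj₁ K<3) = contradiction 3≤K (ℕ.<⇒≱ K<3)
      checked (inj₂ (inj₁ A<20)) =
        contradiction (ℕ.≤-trans 196≤S (ℕ.≤-trans S≤10A (ℕ.*-monoʳ-≤ 10 (ℕ.s≤s⁻¹ A<20)))) (ℕ.<⇒≱ (ℕ.m≤m+n 191 5))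
      checked (inj₂ (inj₂ (inj₁ 2A<KK))) = contradiction KK≤2A (ℕ.<⇒≱ 2A<KK)
      checked (inj₂ (inj₂ (inj₂ alternatives))) = alternatives
      go : K < 12 ⊎ 12 ≤ K → A < 66 ⊎ 66 ≤ A → Goal
      go (inj₂ 12≤K) _ = inj₁ (large-K 12≤K KK≤2A)
      go (inj₁ K<12) (inj₂ 66≤A) = inj₁ (large-A 3≤K K<12 66≤A)
      go (inj₁ K<12) (inj₁ A<66) = checked (small K<12 A<66)

  -- This is ½ (1/K + K/A + A/S) < 3/10 multiplied by 10 A K S. If A² ≤ 2SK is inserted, S cancels.
  -- Otherwise the inequality is known at 196 and extends to larger S: the sides grow with S at the
  -- rates `E` and 3KA, and `E` ≤ 3KA is implied by the inequality at 196.
  ratios : ∀ {S A K} → 196 ≤ S → 3 ≤ K → K * K ≤ 2 * A → A * A ≤ 2 * (S * K) → S ≤ 10 * A →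
           5 * (A * A * K + K * K * S + A * S) < 3 * (A * K * S)
  ratios {S} {A} {K} 196≤S 3≤K KK≤2A AA≤2SK S≤10A = [ using-S , using-196 196 196≤S ]′ (dichotomy 196≤S 3≤K KK≤2A S≤10A)
    where
    open ℕ.≤-Reasoning
    Goal = 5 * (A * A * K + K * K * S + A * S) < 3 * (A * K * S)
    l₁ : ∀ S A K → 5 * (A * A * K + K * K * S + A * S) ≡ 5 * K * (A * A) + (5 * (K * K * S) + 5 * (A * S))
    l₁ = ℕR.solve-∀
    l₂ : ∀ S A K → 5 * K * (2 * (S * K)) + (5 * (K * K * S) + 5 * (A * S)) ≡ S * (15 * (K * K) + 5 * A)
    l₂ = ℕR.solve-∀
    l₃ : ∀ S A K → S * (3 * (K * A)) ≡ 3 * (A * K * S)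
    l₃ = ℕR.solve-∀
    l₄ : ∀ S A K → 5 * (A * A * K + K * K * S + A * S) ≡ 5 * (K * (A * A)) + S * (5 * (K * K) + 5 * A)
    l₄ = ℕR.solve-∀
    using-S : 15 * (K * K) + 5 * A < 3 * (K * A) → Goal
    using-S lt = begin-strict
      5 * (A * A * K + K * K * S + A * S)                           ≡⟨ l₁ S A K ⟩
      5 * K * (A * A) + (5 * (K * K * S) + 5 * (A * S))         ≤⟨ ℕ.+-monoˡ-≤ (5 * (K * K * S) + 5 * (A * S))
        (ℕ.*-monoʳ-≤ (5 * K) AA≤2SK) ⟩
      5 * K * (2 * (S * K)) + (5 * (K * K * S) + 5 * (A * S)) ≡⟨ l₂ S A K ⟩
      S * (15 * (K * K) + 5 * A)                                          <⟨ ℕ.*-monoʳ-< S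
        {{ℕ.>-nonZero (ℕ.≤-trans (ℕ.m≤m+n 1 195) 196≤S)}} lt ⟩
      S * (3 * (K * A))                                                       ≡⟨ l₃ S A K ⟩
      3 * (A * K * S)                                                         ∎
    using-196 : ∀ c → c ≤ S → 5 * (K * (A * A)) + c * (5 * (K * K) + 5 * A) < c * (3 * (K * A)) → Goal
    using-196 c c≤S lt = begin-strict
      5 * (A * A * K + K * K * S + A * S)               ≡⟨ l₄ S A K ⟩
      5 * (K * (A * A)) + S * E                               ≡⟨ cong (λ z → 5 * (K * (A * A)) + z * E)
        (ℕ.m+[n∸m]≡n c≤S) ⟨
      5 * (K * (A * A)) + (c + (S ∸ c)) * E               ≡⟨ l₅ (5 * (K * (A * A))) c (S ∸ c) E ⟩
      5 * (K * (A * A)) + c * E + (S ∸ c) * E           <⟨ ℕ.+-mono-<-≤ lt (ℕ.*-monoʳ-≤ (S ∸ c) E≤) ⟩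
      c * (3 * (K * A)) + (S ∸ c) * (3 * (K * A))       ≡⟨ ℕ.*-distribʳ-+ (3 * (K * A)) c (S ∸ c) ⟨
      (c + (S ∸ c)) * (3 * (K * A))                           ≡⟨ cong (_* (3 * (K * A))) (ℕ.m+[n∸m]≡n c≤S) ⟩
      S * (3 * (K * A))                                           ≡⟨ l₃ S A K ⟩
      3 * (A * K * S)                                             ∎
      where
      E = 5 * (K * K) + 5 * A
      l₅ : ∀ x c r E → x + (c + r) * E ≡ x + c * E + r * E
      l₅ = ℕR.solve-∀
      E≤ : E ≤ 3 * (K * A)
      E≤ = ℕ.<⇒≤ (ℕ.*-cancelˡ-< c E (3 * (K * A)) (ℕ.≤-<-trans (ℕ.m≤n+m (c * E) (5 * (K * (A * A)))) lt))

-- Rational positions, lonely runners and the covering estimate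

module Rational where

  open import Data.Empty using (⊥; ⊥-elim)
  open import Data.Fin.Base using (Fin)
  open import Data.Fin.Patterns using (0F; 1F; 2F; 3F)
  open import Data.Integer.Base as ℤ using (ℤ; +_; -[1+_]; 0ℤ; 1ℤ)
  import Data.Integer.DivMod as ℤ
  import Data.Integer.Properties as ℤ
  import Data.Integer.Tactic.RingSolver as ℤR
  open import Data.List.Base using ([]; _∷_)
  open import Data.List.Relation.Unary.All using ([]; _∷_)
  open import Data.List.Relation.Unary.AllPairs.Core using ([]; _∷_)
  open import Data.Nat.Base as ℕ using (ℕ; suc)
  import Data.Nat.Divisibility as ℕ
  import Data.Nat.GCD as ℕ
  import Data.Nat.Properties as ℕ
  import Data.Nat.Tactic.RingSolver as ℕR
  open import Data.Product.Base using (∃₂; ∃-syntax; _×_; _,_; proj₁; proj₂)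
  open import Data.Rational.Base as ℚ using (ℚ; mkℚ; 0ℚ; 1ℚ; ½; _/_; _+_; _*_; _-_; -_; _≤_; _<_; ∣_∣; ↥_; ↧_)
  open import Data.Rational.Properties as ℚ
  open import Data.Rational.Solver using (module +-*-Solver)
  import Data.Rational.Unnormalised.Base as ℚᵘ
  import Data.Rational.Unnormalised.Properties as ℚᵘ
  open import Data.Sum.Base using (_⊎_; inj₁; inj₂; [_,_]′)
  open import Level using (0ℓ)
  open import Relation.Binary.Definitions using (tri<; tri≈; tri>)
  open import Relation.Binary.PropositionalEquality using (_≡_; _≢_; refl; sym; trans; cong; cong₂; subst; subst₂)
  open import Relation.Nullary using (¬_; Dec; yes; no; contradiction)
  open import Relation.Nullary.Decidable.Core using (dec⇒maybe)
  open import Tactic.RingSolver using (solve-∀)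
  import Tactic.RingSolver.Core.AlmostCommutativeRing as ACR
  open +-*-Solver using (solve; Polynomial; con; _:=_; _:+_; _:*_; _:-_; :-_)
  open Estimate
  open Integral hiding (0≤-+; 0≤-*; ≤⇒0≤-; 0≤-⇒≤; plücker; sum; det-polynomial)
  open Vector

  ℚ-ring : ACR.AlmostCommutativeRing 0ℓ 0ℓ
  ℚ-ring = ACR.fromCommutativeRing +-*-commutativeRing λ q → dec⇒maybe (0ℚ ≟ q)

  ¼ : ℚ
  ¼ = + 1 / 4

  0≤-+ : ∀ {x y} → 0ℚ ≤ x → 0ℚ ≤ y → 0ℚ ≤ x + y
  0≤-+ = +-mono-≤

  0≤-* : ∀ {x y} → 0ℚ ≤ x → 0ℚ ≤ y → 0ℚ ≤ x * y
  0≤-* {x} {y} p q = nonNegative⁻¹ (x * y)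
    {{nonNeg*nonNeg⇒nonNeg x {{ℚ.nonNegative p}} y {{ℚ.nonNegative q}}}}

  0<-* : ∀ {x y} → 0ℚ < x → 0ℚ < y → 0ℚ < x * y
  0<-* {x} {y} p q = positive⁻¹ (x * y) {{pos*pos⇒pos x {{ℚ.positive p}} y {{ℚ.positive q}}}}

  ≤⇒0≤- : ∀ {x y} → x ≤ y → 0ℚ ≤ y - x
  ≤⇒0≤- {x} {y} p = subst (_≤ y - x) (+-inverseʳ x) (+-monoˡ-≤ (- x) p)

  0≤-⇒≤ : ∀ {x y e} → 0ℚ ≤ e → e ≡ y - x → x ≤ y
  0≤-⇒≤ {x} {y} p refl = subst₂ _≤_ (+-identityˡ x) (lem y x) (+-monoˡ-≤ x p)
    where
    lem : ∀ y x → y - x + x ≡ y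
    lem = solve-∀ ℚ-ring

  <⇒0<- : ∀ {x y} → x < y → 0ℚ < y - x
  <⇒0<- {x} {y} p = subst (_< y - x) (+-inverseʳ x) (+-monoˡ-< (- x) p)

  0<-⇒< : ∀ {x y e} → 0ℚ < e → e ≡ y - x → x < y
  0<-⇒< {x} {y} p refl = subst₂ _<_ (+-identityˡ x) (lem y x) (+-monoˡ-< x p)
    where
    lem : ∀ y x → y - x + x ≡ y
    lem = solve-∀ ℚ-ring

  *-mono-≤ : ∀ {w x y z} → 0ℚ ≤ w → 0ℚ ≤ z → w ≤ x → y ≤ z → w * y ≤ x * z
  *-mono-≤ {w} {x} {y} {z} 0≤w 0≤z w≤x y≤z = ≤-trans
    (*-monoˡ-≤-nonNeg w {{ℚ.nonNegative 0≤w}} y≤z) (*-monoʳ-≤-nonNeg z {{ℚ.nonNegative 0≤z}} w≤x)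

  inverse : ∀ p → p ≢ 0ℚ → ∃[ r ] p * r ≡ 1ℚ
  inverse p p≢0 = ℚ.1/_ p {{ℚ.≢-nonZero p≢0}} , *-inverseʳ p {{ℚ.≢-nonZero p≢0}}

  x≤∣x∣ : ∀ x → x ≤ ∣ x ∣
  x≤∣x∣ x with ≤-total 0ℚ x
  ... | inj₁ 0≤x = ≤-reflexive (sym (0≤p⇒∣p∣≡p 0≤x))
  ... | inj₂ x≤0 = ≤-trans x≤0 (0≤∣p∣ x)

  ∣x∣≤e⇒x≤e : ∀ {x e} → ∣ x ∣ ≤ e → x ≤ e
  ∣x∣≤e⇒x≤e {x} = ≤-trans (x≤∣x∣ x)

  ∣x∣≤e⇒-x≤e : ∀ {x e} → ∣ x ∣ ≤ e → - x ≤ e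
  ∣x∣≤e⇒-x≤e {x} {e} p = ∣x∣≤e⇒x≤e (subst (_≤ e) (sym (∣-p∣≡∣p∣ x)) p)

  ∣x∣≤e : ∀ {x e} → x ≤ e → - x ≤ e → ∣ x ∣ ≤ e
  ∣x∣≤e {x} {e} p q with ∣p∣≡p∨∣p∣≡-p x
  ... | inj₁ eq = subst (_≤ e) (sym eq) p
  ... | inj₂ eq = subst (_≤ e) (sym eq) q

  ∣∣-cong : ∀ {x y e} → x ≡ y → ∣ x ∣ ≤ e → ∣ y ∣ ≤ e
  ∣∣-cong refl p = p

  ∣∣-+ : ∀ {x y d e} → ∣ x ∣ ≤ d → ∣ y ∣ ≤ e → ∣ x + y ∣ ≤ d + e
  ∣∣-+ {x} {y} p q = ≤-trans (∣p+q∣≤∣p∣+∣q∣ x y) (+-mono-≤ p q)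

  ∣∣-* : ∀ {x y d e} → ∣ x ∣ ≤ d → ∣ y ∣ ≤ e → ∣ x * y ∣ ≤ d * e
  ∣∣-* {x} {y} {d} {e} p q = subst (_≤ d * e) (sym (∣p*q∣≡∣p∣*∣q∣ x y))
    (*-mono-≤ (0≤∣p∣ x) (≤-trans (0≤∣p∣ y) q) p q)

  ∣∣-neg : ∀ {x e} → ∣ x ∣ ≤ e → ∣ - x ∣ ≤ e
  ∣∣-neg {x} {e} = subst (_≤ e) (sym (∣-p∣≡∣p∣ x))

  -- Integers inside ℚ

  opaque
    ι : ℤ → ℚ
    ι n = n / 1

    ιᵘ : ∀ n → ℚ.toℚᵘ (ι n) ℚᵘ.≃ ℚᵘ.mkℚᵘ n 0
    ιᵘ n = toℚᵘ-fromℚᵘ (ℚᵘ.mkℚᵘ n 0)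

    ι-+ : ∀ m n → ι (m ℤ.+ n) ≡ ι m + ι n
    ι-+ m n = toℚᵘ-injective (ℚᵘ.≃-trans (ιᵘ (m ℤ.+ n)) (ℚᵘ.≃-sym (ℚᵘ.≃-trans (toℚᵘ-homo-+ (ι m) (ι n))
      (ℚᵘ.≃-trans (ℚᵘ.+-cong (ιᵘ m) (ιᵘ n)) (ℚᵘ.*≡* (lem m n))))))
      where
      lem : ∀ m n → (m ℤ.* + 1 ℤ.+ n ℤ.* + 1) ℤ.* + 1 ≡ (m ℤ.+ n) ℤ.* + 1
      lem = ℤR.solve-∀

    ι-* : ∀ m n → ι (m ℤ.* n) ≡ ι m * ι n
    ι-* m n = toℚᵘ-injective (ℚᵘ.≃-trans (ιᵘ (m ℤ.* n)) (ℚᵘ.≃-sym (ℚᵘ.≃-trans (toℚᵘ-homo-* (ι m) (ι n))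
      (ℚᵘ.*-cong (ιᵘ m) (ιᵘ n)))))

    ι-neg : ∀ n → ι (ℤ.- n) ≡ - ι n
    ι-neg n = toℚᵘ-injective (ℚᵘ.≃-trans (ιᵘ (ℤ.- n))
        (ℚᵘ.≃-trans (ℚᵘ.-‿cong (ℚᵘ.≃-sym (ιᵘ n))) (ℚᵘ.≃-sym (toℚᵘ-homo‿- (ι n)))))

    ι-mono-≤ : ∀ {m n} → m ℤ.≤ n → ι m ≤ ι n
    ι-mono-≤ {m} {n} p = toℚᵘ-cancel-≤
        (ℚᵘ.≤-respˡ-≃ (ℚᵘ.≃-sym (ιᵘ m)) (ℚᵘ.≤-respʳ-≃ (ℚᵘ.≃-sym (ιᵘ n))
          (ℚᵘ.*≤* (ℤ.*-monoʳ-≤-nonNeg (+ 1) p))))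

    ι-mono-< : ∀ {m n} → m ℤ.< n → ι m < ι n
    ι-mono-< {m} {n} p = toℚᵘ-cancel-<
        (ℚᵘ.<-respˡ-≃ (ℚᵘ.≃-sym (ιᵘ m)) (ℚᵘ.<-respʳ-≃ (ℚᵘ.≃-sym (ιᵘ n))
          (ℚᵘ.*<* (ℤ.*-monoʳ-<-pos (+ 1) p))))

    ι-def : ∀ n → ι n ≡ n / 1
    ι-def n = refl

    ι0≡0 : ι 0ℤ ≡ 0ℚ
    ι0≡0 = refl

    ι1≡1 : ι 1ℤ ≡ 1ℚ
    ι1≡1 = refl

  ι-- : ∀ m n → ι (m ℤ.- n) ≡ ι m - ι n
  ι-- m n = trans (ι-+ m (ℤ.- n)) (cong (λ z → ι m + z) (ι-neg n))

  ι-injective : ∀ {m n} → ι m ≡ ι n → m ≡ n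
  ι-injective {m} {n} eq with ℤ.<-cmp m n
  ... | tri< m<n _ _ = contradiction eq (<⇒≢ (ι-mono-< m<n))
  ... | tri≈ _ m≡n _ = m≡n
  ... | tri> _ _ n<m = contradiction (sym eq) (<⇒≢ (ι-mono-< n<m))

  ι≢0 : ∀ {n} → n ≢ 0ℤ → ι n ≢ 0ℚ
  ι≢0 n≢0 eq = n≢0 (ι-injective (trans eq (sym ι0≡0)))

  ∣ι∣ : ∀ n → ∣ ι n ∣ ≡ ι (+ ℤ.∣ n ∣)
  ∣ι∣ n@(+ _) = 0≤p⇒∣p∣≡p (subst (_≤ ι n) ι0≡0 (ι-mono-≤ {0ℤ} {n} (ℤ.+≤+ ℕ.z≤n)))
  ∣ι∣ n@(-[1+ k ]) = trans (sym (∣-p∣≡∣p∣ (ι n))) (trans (cong ∣_∣ (sym (ι-neg n))) (∣ι∣ (+ suc k)))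

  private
    *-↧ : ∀ q → q * ι (↧ q) ≡ ι (↥ q)
    *-↧ q@(mkℚ a d-1 _) = toℚᵘ-injective (ℚᵘ.≃-trans (toℚᵘ-homo-* q (ι (↧ q)))
      (ℚᵘ.≃-trans (ℚᵘ.*-congˡ {ℚ.toℚᵘ q} (ιᵘ (↧ q))) (ℚᵘ.≃-trans (ℚᵘ.*≡* (lem a (↧ q)))
        (ℚᵘ.≃-sym (ιᵘ a)))))
      where
      lem : ∀ a d → (a ℤ.* d) ℤ.* + 1 ≡ a ℤ.* (d ℤ.* + 1)
      lem = ℤR.solve-∀

  floor-bounds : ∀ q → ∃[ n ] (ι n ≤ q × q ≤ ι n + 1ℚ)
  floor-bounds q@(mkℚ a d-1 _) = n
    , *-cancelʳ-≤-pos D {{ℚ.positive 0<D}} (subst₂ _≤_ (ι-* n (↧ q)) (sym (*-↧ q)) (ι-mono-≤ (ℤ.[n/d]*d≤n a (↧ q))))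
    , *-cancelʳ-≤-pos D {{ℚ.positive 0<D}} (subst₂ _≤_ (sym (*-↧ q)) eq
        (ι-mono-≤ (ℤ.<⇒≤ (subst (a ℤ.<_) (cong (λ z → ℤ.suc z ℤ.* ↧ q) (sym (ℤ.div-pos-is-/ℕ a (suc d-1))))
          (ℤ.n<s[n/ℕd]*d a (suc d-1))))))
    where
    n = a ℤ./ (↧ q)
    D = ι (↧ q)
    0<D : 0ℚ < D
    0<D = subst (_< D) ι0≡0 (ι-mono-< {0ℤ} (ℤ.+<+ (ℕ.s≤s ℕ.z≤n)))
    eq : ι (ℤ.suc n ℤ.* ↧ q) ≡ (ι n + 1ℚ) * D
    eq = trans (ι-* (ℤ.suc n) (↧ q)) (cong (_* D) (trans (ι-+ 1ℤ n) (trans (cong (_+ ι n) ι1≡1) (+-comm 1ℚ (ι n)))))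

  -- Away e q says that q is within e of a half-integer, that is ‖ q ‖ ≥ ½ - e.
  record Away (e q : ℚ) : Set where
    constructor away
    field
      base : ℤ
      near : ∣ q - (ι base + ½) ∣ ≤ e

  away-½ : ∀ q → Away ½ q
  away-½ q =
    let n , n≤q , q≤n+1 = floor-bounds q
    in away n (∣x∣≤e (0≤-⇒≤ (≤⇒0≤- q≤n+1) (l₁ q (ι n))) (0≤-⇒≤ (≤⇒0≤- n≤q) (l₂ q (ι n))))
    where
    l₁ = solve 2 (λ q n → n :+ con 1ℚ :- q := con ½ :- (q :- (n :+ con ½))) refl
    l₂ = solve 2 (λ q n → q :- n := con ½ :- (:- (q :- (n :+ con ½)))) refl

  nearest : ∀ q → ∃[ n ] ∣ q - ι n ∣ ≤ ½
  nearest q = let away n p = away-½ (q + ½) in n , ∣∣-cong (lem q (ι n)) p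
    where
    lem : ∀ q n → q + ½ - (n + ½) ≡ q - n
    lem = solve-∀ ℚ-ring

  away-cong : ∀ {e p q} → p ≡ q → Away e p → Away e q
  away-cong refl a = a

  away-mono : ∀ {d e q} → d ≤ e → Away d q → Away e q
  away-mono d≤e (away n p) = away n (≤-trans p d≤e)

  away-+ι : ∀ {e q} m → Away e q → Away e (q + ι m)
  away-+ι {q = q} m (away n p) = away (n ℤ.+ m)
    (∣∣-cong (trans (lem q (ι n) (ι m)) (cong (λ z → q + ι m - (z + ½)) (sym (ι-+ n m)))) p)
    where
    lem = solve 3 (λ q n m → q :- (n :+ con ½) := q :+ m :- (n :+ m :+ con ½)) refl

  away-neg : ∀ {e q} → Away e q → Away e (- q)
  away-neg {q = q} (away n p) = away (ℤ.- n ℤ.- 1ℤ) (∣∣-cong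
    (trans (lem q (ι n)) (cong (λ z → - q - (z + ½)) (sym (trans (ι-- (ℤ.- n) 1ℤ) (cong₂ _-_ (ι-neg n) ι1≡1)))))
      (∣∣-neg {q - (ι n + ½)} p))
    where
    lem = solve 2 (λ q n → :- (q :- (n :+ con ½)) := :- q :- (:- n :- con 1ℚ :+ con ½)) refl

  away-+ : ∀ {d e q x} → ∣ x ∣ ≤ d → Away e q → Away (e + d) (q + x)
  away-+ {q = q} {x} h (away n p) = away n (∣∣-cong (lem q (ι n) x) (∣∣-+ p h))
    where
    lem = solve 3 (λ q n x → q :- (n :+ con ½) :+ x := q :+ x :- (n :+ con ½)) refl

  -- Equations modulo hypotheses: the ring solver checks that the difference of
  -- the two sides is a combination of the differences in the hypotheses.

  by-eq : ∀ {l r p q} W → p ≡ q → l - r ≡ W * (p - q) → l ≡ r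
  by-eq {l} {r} {p} W refl eq = trans (l₁ l r) (trans (cong (_+ r) eq) (l₂ W p r))
    where
    l₁ : ∀ l r → l ≡ l - r + r
    l₁ = solve-∀ ℚ-ring
    l₂ : ∀ W p r → W * (p - p) + r ≡ r
    l₂ = solve-∀ ℚ-ring

  by-eq₂ : ∀ {l r p q p′ q′} W W′ → p ≡ q → p′ ≡ q′ → l - r ≡ W * (p - q) + W′ * (p′ - q′) → l ≡ r
  by-eq₂ {l} {r} {p} {p′ = p′} W W′ refl refl eq = trans (l₁ l r) (trans (cong (_+ r) eq) (l₂ W W′ p p′ r))
    where
    l₁ : ∀ l r → l ≡ l - r + r
    l₁ = solve-∀ ℚ-ring
    l₂ = solve 5 (λ W W′ p p′ r → W :* (p :- p) :+ W′ :* (p′ :- p′) :+ r := r) refl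

  by-eq₃ : ∀ {l r p q p′ q′ p″ q″} W W′ W″ → p ≡ q → p′ ≡ q′ → p″ ≡ q″ →
           l - r ≡ W * (p - q) + W′ * (p′ - q′) + W″ * (p″ - q″) → l ≡ r
  by-eq₃ {l} {r} {p} {p′ = p′} {p″ = p″} W W′ W″ refl refl refl eq =
    trans (l₁ l r) (trans (cong (_+ r) eq) (l₂ W W′ W″ p p′ p″ r))
    where
    l₁ : ∀ l r → l ≡ l - r + r
    l₁ = solve-∀ ℚ-ring
    l₂ = solve 7 (λ W W′ W″ p p′ p″ r → W :* (p :- p) :+ W′ :* (p′ :- p′) :+ W″ :* (p″ :- p″) :+ r := r) refl

  2ℚ : ℚ
  2ℚ = + 2 / 1

  -- Up to three runners

  -- Every point is within ½ of a half-integer; going half of the way costs at most ¼ and leaves at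
  -- most ¼.
  centre : ∀ y → ∃[ δ ] (∣ δ ∣ ≤ ¼ × Away ¼ (y + δ))
  centre y =
    let away n p = away-½ y
        r = y - (ι n + ½)
    in - ½ * r , ∣∣-* {x = - ½} {y = r} ≤-refl p , away n (∣∣-cong (lem y (ι n)) (∣∣-* {x = ½} {y = r} ≤-refl p))
    where
    lem = solve 2 (λ y n → con ½ :* (y :- (n :+ con ½)) := y :+ :- con ½ :* (y :- (n :+ con ½)) :- (n :+ con ½)) refl

  one-runner : ∀ p → p ≢ 0ℚ → ∀ c → ∃[ t ] Away ¼ (p * t + c)
  one-runner p p≢0 c =
    let r , pr≡1 = inverse p p≢0
        δ , _ , a = centre c
    in δ * r , away-cong (by-eq δ (sym pr≡1) (lem p r δ c)) a
    where
    lem = solve 4 (λ p r δ c → c :+ δ :- (p :* (δ :* r) :+ c) := δ :* (con 1ℚ :- p :* r)) refl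

  private
    -- The slower runner is put at ½ exactly. While the faster one is centred by a move of at most
    -- ¼, the slower one moves no further than that.
    two-ordered : ∀ p q → p ≢ 0ℚ → q ≢ 0ℚ → ∣ p ∣ ≤ ∣ q ∣ → ∀ c d → ∃[ t ] (Away ¼ (p * t + c) × Away ¼ (q * t + d))
    two-ordered p q p≢0 q≢0 ∣p∣≤∣q∣ c d =
      let r , pr≡1 = inverse p p≢0
          r′ , qr′≡1 = inverse q q≢0
          t₀ = (½ - c) * r
          δ , ∣δ∣≤¼ , a = centre (q * t₀ + d)
          ∣pr′∣≤1 : ∣ p * r′ ∣ ≤ 1ℚ
          ∣pr′∣≤1 = subst₂ _≤_ (sym (∣p*q∣≡∣p∣*∣q∣ p r′)) (trans (sym (∣p*q∣≡∣p∣*∣q∣ q r′)) (cong ∣_∣ qr′≡1))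
            (*-monoʳ-≤-nonNeg ∣ r′ ∣ {{∣-∣-nonNeg r′}} ∣p∣≤∣q∣)
      in t₀ + δ * r′
        , away 0ℤ (∣∣-cong {x = (p * r′) * δ}
          (by-eq (½ - c) (sym pr≡1)
          (trans (cong (λ z → (p * r′) * δ - (p * (t₀ + δ * r′) + c - (z + ½))) ι0≡0) (l₁ p r r′ δ c)))
            (∣∣-* {x = p * r′} {y = δ} ∣pr′∣≤1 ∣δ∣≤¼))
        , away-cong (by-eq δ (sym qr′≡1) (l₂ q t₀ r′ δ d)) a
      where
      l₁ = solve 5 (λ p r r′ δ c → p :* r′ :* δ :- (p :* ((con ½ :- c) :* r :+ δ :* r′) :+ c :- (con 0ℚ :+ con ½))
        := (con ½ :- c) :* (con 1ℚ :- p :* r)) refl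
      l₂ = solve 5 (λ q t r δ d → q :* t :+ d :+ δ :- (q :* (t :+ δ :* r) :+ d) := δ :* (con 1ℚ :- q :* r)) refl

  two-runners : ∀ p q → p ≢ 0ℚ → q ≢ 0ℚ → ∀ c d → ∃[ t ] (Away ¼ (p * t + c) × Away ¼ (q * t + d))
  two-runners p q p≢0 q≢0 c d with ≤-total ∣ p ∣ ∣ q ∣
  ... | inj₁ p≤q = two-ordered p q p≢0 q≢0 p≤q c d
  ... | inj₂ q≤p = let t , a , b = two-ordered q p q≢0 p≢0 q≤p d c in t , b , a

  -- The steps γ m move along the circle by the nonzero signed distance f from γ
  -- to its nearest integer; since ∣ f ∣ ≤ ½, they cannot jump over the arc [¼ , ¾].
  step : ∀ γ → (∀ n → γ ≢ ι n) → ∀ c → ∃[ m ] Away ¼ (γ * ι m + c)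
  step γ γ∉ℤ c =
    let n , ∣f∣≤½ = nearest γ
        f = γ - ι n
        r , fr≡1 = inverse f (λ f≡0 → γ∉ℤ n (trans (l₀ γ (ι n)) (trans (cong (_+ ι n) f≡0) (+-identityˡ (ι n)))))
        x = (½ - c) * r
        m , ∣x-m∣≤½ = nearest x
    in m , away (n ℤ.* m) (∣∣-cong
         (by-eq (½ - c) (sym fr≡1)
           (trans (cong (λ z → - f * (x - ι m) - (γ * ι m + c - (z + ½))) (ι-* n m)) (l₁ γ (ι n) r (ι m) c)))
         (∣∣-* {x = - f} {y = x - ι m} (∣∣-neg {f} ∣f∣≤½) ∣x-m∣≤½))
    where
    l₀ : ∀ γ n → γ ≡ γ - n + n
    l₀ = solve-∀ ℚ-ring
    l₁ = solve 5 (λ γ n r m c → :- (γ :- n) :* ((con ½ :- c) :* r :- m) :- (γ :* m :+ c :- (n :* m :+ con ½))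
      := (con ½ :- c) :* (con 1ℚ :- (γ :- n) :* r)) refl

  away-either : ∀ y → Away ¼ y ⊎ Away ¼ (y + ½)
  away-either y = go (away-½ y)
    where
    go : Away ½ y → Away ¼ y ⊎ Away ¼ (y + ½)
    go (away n p) with ≤-total (y - (ι n + ½)) ¼ | ≤-total (- (y - (ι n + ½))) ¼
    ... | inj₁ u | inj₁ v = inj₁ (away n (∣x∣≤e u v))
    ... | inj₂ u | _ = inj₂ (away (n ℤ.+ 1ℤ)
      (subst (λ z → ∣ y + ½ - (z + ½) ∣ ≤ ¼) (sym (trans (ι-+ n 1ℤ) (cong (λ z → ι n + z) ι1≡1)))
          (∣x∣≤e (0≤-⇒≤ (0≤-+ (≤⇒0≤- (∣x∣≤e⇒x≤e p)) (nonNegative⁻¹ ¼)) (k₁ y (ι n)))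
                 (0≤-⇒≤ (≤⇒0≤- u) (k₂ y (ι n))))))
      where
      k₁ = solve 2 (λ y n → con ½ :- (y :- (n :+ con ½)) :+ con ¼ := con ¼ :- (y :+ con ½ :- (n :+ con 1ℚ :+ con ½)))
        refl
      k₂ = solve 2 (λ y n → y :- (n :+ con ½) :- con ¼ := con ¼ :- (:- (y :+ con ½ :- (n :+ con 1ℚ :+ con ½)))) refl
    ... | inj₁ _ | inj₂ v = inj₂ (away n (∣x∣≤e (0≤-⇒≤ (≤⇒0≤- v) (k₁ y (ι n)))
          (0≤-⇒≤ (0≤-+ (≤⇒0≤- (∣x∣≤e⇒-x≤e {y - (ι n + ½)} p)) (nonNegative⁻¹ ¼)) (k₂ y (ι n)))))
      where
      k₁ = solve 2 (λ y n → :- (y :- (n :+ con ½)) :- con ¼ := con ¼ :- (y :+ con ½ :- (n :+ con ½))) refl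
      k₂ = solve 2 (λ y n → con ½ :- :- (y :- (n :+ con ½)) :+ con ¼ := con ¼ :- (:- (y :+ con ½ :- (n :+ con ½)))) refl

  inverse⁺ : ∀ p → 0ℚ < p → ∃[ r ] (p * r ≡ 1ℚ × 0ℚ < r)
  inverse⁺ p 0<p = r , *-inverseʳ p {{nz}} , positive⁻¹ r {{1/pos⇒pos p {{ℚ.positive 0<p}}}}
    where
    nz = pos⇒nonZero p {{ℚ.positive 0<p}}
    r = ℚ.1/_ p {{nz}}

  ∣∣-nonNeg : ∀ {x} → 0ℚ ≤ x → ∣ x ∣ ≤ x
  ∣∣-nonNeg 0≤x = ≤-reflexive (0≤p⇒∣p∣≡p 0≤x)

  private
    -- Distributes the error of `three-coprime` between the first two runners, in the proportions θ
    -- and 1 - θ that each can bear.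
    split : ∀ U V → 0ℚ ≤ U → 0ℚ ≤ V → 2ℚ ≤ U + V →
            ∃[ θ ] (0ℚ ≤ θ × 0ℚ ≤ 1ℚ - θ × 2ℚ * θ ≤ U × 2ℚ * (1ℚ - θ) ≤ V)
    split U V 0≤U 0≤V 2≤U+V with ≤-total U 2ℚ
    ... | inj₂ 2≤U = 1ℚ , nonNegative⁻¹ 1ℚ , nonNegative⁻¹ 0ℚ , 2≤U , 0≤V
    ... | inj₁ U≤2 = ½ * U , 0≤-* (nonNegative⁻¹ ½) 0≤U
          , subst (0ℚ ≤_) (l₁ U) (0≤-* (nonNegative⁻¹ ½) (≤⇒0≤- U≤2))
          , ≤-reflexive (l₂ U) , 0≤-⇒≤ (≤⇒0≤- 2≤U+V) (l₃ U V)
      where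
      l₁ : ∀ U → ½ * (2ℚ - U) ≡ 1ℚ - ½ * U
      l₁ = solve-∀ ℚ-ring
      l₂ : ∀ U → 2ℚ * (½ * U) ≡ U
      l₂ = solve-∀ ℚ-ring
      l₃ = solve 2 (λ U V → U :+ V :- con 2ℚ := V :- con 2ℚ :* (con 1ℚ :- con ½ :* U)) refl

    -- The first term is the share of the error given to a runner of speed A, the second its path
    -- while the fastest runner, of speed C, moves by ¼.
    margin : ∀ {A B rB rC θ} → 0ℚ ≤ rB → B * rB ≡ 1ℚ → 2ℚ * θ ≤ B * (1ℚ - A * rC) →
             ½ * (θ * rB) + A * (¼ * rC) ≤ ¼
    margin {A} {B} {rB} {rC} {θ} 0≤rB BrB≡1 h = 0≤-⇒≤ (0≤-* (0≤-* (nonNegative⁻¹ ¼) 0≤rB) (≤⇒0≤- h))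
      (by-eq (¼ * (1ℚ - A * rC)) BrB≡1 (lem A B rB rC θ))
      where
      lem = solve 5 (λ A B rB rC θ →
        con ¼ :* rB :* (B :* (con 1ℚ :- A :* rC) :- con 2ℚ :* θ)
        :- (con ¼ :- (con ½ :* (θ :* rB) :+ A :* (con ¼ :* rC)))
            := con ¼ :* (con 1ℚ :- A :* rC) :* (B :* rB :- con 1ℚ)) refl

  -- Let the first runner be at ½ and, by Bézout, the second within 1/(2a) of ½.
  -- Moving the time by E θ /(ab) keeps both so far inside their arcs that there
  -- is room for half a turn of the fastest runner.
  three-coprime : ∀ a b (C : ℚ) x y → 0ℚ < ι a → 0ℚ < ι b → ι a ≤ C → ι b ≤ C →
                  x ℤ.* b ℤ.- y ℤ.* a ≡ 1ℤ → 2ℚ * (ι a * ι b) ≤ C * (ι a + ι b - 2ℚ) →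
                  ∀ s₁ s₂ s₃ → ∃[ t ] (Away ¼ (ι a * t + s₁) × Away ¼ (ι b * t + s₂) × Away ¼ (C * t + s₃))
  three-coprime a b C x y 0<A 0<B A≤C B≤C bézout room s₁ s₂ s₃ =
    let rA , ArA≡1 , 0<rA = inverse⁺ A 0<A
        rB , BrB≡1 , 0<rB = inverse⁺ B 0<B
        rC , CrC≡1 , 0<rC = inverse⁺ C (<-≤-trans 0<A A≤C)
        0≤rA = <⇒≤ 0<rA
        0≤rB = <⇒≤ 0<rB
        0≤rC = <⇒≤ 0<rC
        N , ∣E∣≤½ = nearest (A * (B * ((½ - s₁) * rA) + s₂ - ½))
        E = A * (B * ((½ - s₁) * rA) + s₂ - ½) - ι N
        -- After k extra turns the first runner is back at ½, while the second has gained k B/A. As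
        -- k B ≡ - N modulo A, this cancels N/A up to the integer n and leaves the second runner at
        -- distance ∣ E ∣/A from a half-integer.
        k = ℤ.- (N ℤ.* x)
        n = ℤ.- (N ℤ.* y)
        0≤1-ArC : 0ℚ ≤ 1ℚ - A * rC
        0≤1-ArC = subst (0ℚ ≤_) (by-eq 1ℚ CrC≡1 (l₁ C A rC)) (0≤-* (≤⇒0≤- A≤C) 0≤rC)
        0≤1-BrC : 0ℚ ≤ 1ℚ - B * rC
        0≤1-BrC = subst (0ℚ ≤_) (by-eq 1ℚ CrC≡1 (l₁ C B rC)) (0≤-* (≤⇒0≤- B≤C) 0≤rC)
        θ , 0≤θ , 0≤1-θ , hA , hB = split (B * (1ℚ - A * rC)) (A * (1ℚ - B * rC))
          (0≤-* (<⇒≤ 0<B) 0≤1-ArC) (0≤-* (<⇒≤ 0<A) 0≤1-BrC)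
          (0≤-⇒≤ (0≤-* 0≤rC (≤⇒0≤- room)) (by-eq (A + B - 2ℚ) CrC≡1 (l₂ A B C rC)))
        -- In terms of the first runner's position: it moves by - E θ/B, and the second runner's
        -- error shrinks from E/A to (1 - θ) E/A.
        Θ = - (E * (θ * rB))
        t₁ = (½ - s₁ + ι k) * rA + Θ * rA
        δ , ∣δ∣≤¼ , away₃ = centre (C * t₁ + s₃)
        Nk : ι N + ι k * B ≡ ι n * A
        Nk = trans (cong (λ z → ι N + z) (sym (ι-* k b))) (trans (sym (ι-+ N (k ℤ.* b)))
               (trans (cong ι (trans (l₃ N x b y a)
                 (trans (cong (λ z → n ℤ.* a ℤ.+ N ℤ.* (1ℤ ℤ.- z)) bézout) (l₄ (n ℤ.* a) N)))) (ι-* n a)))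
    in t₁ + δ * rC
     , away k (∣∣-cong {x = Θ + A * (δ * rC)} (by-eq (½ - s₁ + ι k + Θ) (sym ArA≡1) (l₅ A rA s₁ (ι k) Θ δ rC))
             (≤-trans (∣∣-+ {Θ} {A * (δ * rC)}
               (∣∣-neg {E * (θ * rB)} (∣∣-* {E} {θ * rB} ∣E∣≤½ (∣∣-nonNeg (0≤-* 0≤θ 0≤rB))))
                            (∣∣-* {A} {δ * rC} (∣∣-nonNeg (<⇒≤ 0<A)) (∣∣-* {δ} {rC} ∣δ∣≤¼ (∣∣-nonNeg 0≤rC))))
                      (margin {A} {B} {rB} {rC} {θ} 0≤rB BrB≡1 hA)))
     , away n (∣∣-cong {x = E * ((1ℚ - θ) * rA) + B * (δ * rC)}
             (by-eq₃
                (B * ((½ - s₁) * rA) + s₂ - ½ - ι n) (E * θ * rA) (- rA) ArA≡1 BrB≡1 Nk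
                (l₆ A B rA rB s₁ s₂ (ι k) (ι n) (ι N) θ (δ * rC)))
             (≤-trans (∣∣-+ {E * ((1ℚ - θ) * rA)} {B * (δ * rC)}
                            (∣∣-* {E} {(1ℚ - θ) * rA} ∣E∣≤½ (∣∣-nonNeg (0≤-* 0≤1-θ 0≤rA)))
                            (∣∣-* {B} {δ * rC} (∣∣-nonNeg (<⇒≤ 0<B)) (∣∣-* {δ} {rC} ∣δ∣≤¼ (∣∣-nonNeg 0≤rC))))
                      (margin {B} {A} {rA} {rC} {1ℚ - θ} 0≤rA ArA≡1 hB)))
     , away-cong (by-eq δ (sym CrC≡1) (l₇ C rC δ t₁ s₃)) away₃
    where
    A = ι a
    B = ι b
    l₁ = solve 3 (λ C A r → (C :- A) :* r :- (con 1ℚ :- A :* r) := con 1ℚ :* (C :* r :- con 1ℚ)) refl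
    l₂ = solve 4 (λ A B C r →
      r :* (C :* (A :+ B :- con 2ℚ) :- con 2ℚ :* (A :* B))
      :- (B :* (con 1ℚ :- A :* r) :+ A :* (con 1ℚ :- B :* r) :- con 2ℚ)
         := (A :+ B :- con 2ℚ) :* (C :* r :- con 1ℚ)) refl
    l₃ : ∀ N x b y a → N ℤ.+ ℤ.- (N ℤ.* x) ℤ.* b ≡ ℤ.- (N ℤ.* y) ℤ.* a ℤ.+ N ℤ.* (1ℤ ℤ.- (x ℤ.* b ℤ.- y ℤ.* a))
    l₃ = ℤR.solve-∀
    l₄ : ∀ p N → p ℤ.+ N ℤ.* (1ℤ ℤ.- 1ℤ) ≡ p
    l₄ = ℤR.solve-∀
    l₅ = solve 7 (λ A r s k Θ δ rC →
      Θ :+ A :* (δ :* rC) :- (A :* ((con ½ :- s :+ k) :* r :+ Θ :* r :+ δ :* rC) :+ s :- (k :+ con ½))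
         := (con ½ :- s :+ k :+ Θ) :* (con 1ℚ :- A :* r)) refl
    l₆ = solve 11 (λ A B r rB s s′ k n N θ z →
       (A :* (B :* ((con ½ :- s) :* r) :+ s′ :- con ½) :- N) :* ((con 1ℚ :- θ) :* r) :+ B :* z
         :- (B :* ((con ½ :- s :+ k) :* r
           :+ :- ((A :* (B :* ((con ½ :- s) :* r) :+ s′ :- con ½) :- N) :* (θ :* rB)) :* r :+ z) :+ s′ :- (n :+ con ½))
       := (B :* ((con ½ :- s) :* r) :+ s′ :- con ½ :- n) :* (A :* r :- con 1ℚ)
         :+ (A :* (B :* ((con ½ :- s) :* r) :+ s′ :- con ½) :- N) :* θ :* r :* (B :* rB :- con 1ℚ)
         :+ :- r :* (N :+ k :* B :- n :* A)) refl
    l₇ = solve 5 (λ C r δ t s → C :* t :+ s :+ δ :- (C :* (t :+ δ :* r) :+ s) := δ :* (con 1ℚ :- C :* r)) refl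

  ν : ℕ → ℚ
  ν n = ι (+ n)

  ν-* : ∀ m n → ν (m ℕ.* n) ≡ ν m * ν n
  ν-* m n = trans (cong ι (ℤ.pos-* m n)) (ι-* (+ m) (+ n))

  ν-+ : ∀ m n → ν (m ℕ.+ n) ≡ ν m + ν n
  ν-+ m n = ι-+ (+ m) (+ n)

  ν-mono-≤ : ∀ {m n} → m ℕ.≤ n → ν m ≤ ν n
  ν-mono-≤ m≤n = ι-mono-≤ (ℤ.+≤+ m≤n)

  0<ν : ∀ {n} → 0 ℕ.< n → 0ℚ < ν n
  0<ν {n} 0<n = subst (_< ν n) ι0≡0 (ι-mono-< (ℤ.+<+ 0<n))

  ν2≡2 : ν 2 ≡ 2ℚ
  ν2≡2 = ι-def (+ 2)

  private
    ⅓ : ℚ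
    ⅓ = + 1 / 3

    3ℚ : ℚ
    3ℚ = + 3 / 1

    away-quarter : ∀ N → Away ¼ (¼ + ½ * ι N)
    away-quarter N with N ℤ.%ℕ 2 | ℤ.n%ℕd<d N 2 | ℤ.a≡a%ℕn+[a/ℕn]*n N 2
    ... | 0 | _ | eq = away n
      (∣∣-cong (trans (l₁ (ι n)) (cong (λ z → ¼ + ½ * z - (ι n + ½)) (sym N≡))) (≤-refl { ∣ - ¼ ∣ }))
      where
      n = N ℤ./ℕ 2
      N≡ : ι N ≡ 0ℚ + ι n * 2ℚ
      N≡ = trans (cong ι eq) (trans (ι-+ 0ℤ (n ℤ.* + 2))
        (cong₂ _+_ ι0≡0 (trans (ι-* n (+ 2)) (cong (λ z → ι n * z) ν2≡2))))
      l₁ = solve 1 (λ n → :- con ¼ := con ¼ :+ con ½ :* (con 0ℚ :+ n :* con 2ℚ) :- (n :+ con ½)) refl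
    ... | 1 | _ | eq = away n
      (∣∣-cong (trans (l₁ (ι n)) (cong (λ z → ¼ + ½ * z - (ι n + ½)) (sym N≡))) (≤-refl { ∣ ¼ ∣ }))
      where
      n = N ℤ./ℕ 2
      N≡ : ι N ≡ 1ℚ + ι n * 2ℚ
      N≡ = trans (cong ι eq) (trans (ι-+ 1ℤ (n ℤ.* + 2))
        (cong₂ _+_ ι1≡1 (trans (ι-* n (+ 2)) (cong (λ z → ι n * z) ν2≡2))))
      l₁ = solve 1 (λ n → con ¼ := con ¼ :+ con ½ :* (con 1ℚ :+ n :* con 2ℚ) :- (n :+ con ½)) refl
    ... | suc (suc _) | ℕ.s≤s (ℕ.s≤s ()) | _

    -- With the second runner in its arc and the third exactly at the boundary of
    -- its arc, half a period later this is still the case, and the first runner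
    -- has moved to the antipodal point.
    speeds-1-2-3 : ∀ s₁ s₂ s₃ → ∃[ t ] (Away ¼ (1ℚ * t + s₁) × Away ¼ (2ℚ * t + s₂) × Away ¼ (3ℚ * t + s₃))
    speeds-1-2-3 s₁ s₂ s₃ =
      let t₀ = (½ - s₂) * ½
          -- The boundary points of the arcs are ¼ + N/2. The time `t₀` puts the second runner at ½;
          -- correcting it by e/6 puts the third on the boundary and moves the second by e/3, at
          -- most 1/6.
          N , ∣e∣≤½ = nearest (2ℚ * (3ℚ * t₀ + s₃ - ¼))
          e = 2ℚ * (3ℚ * t₀ + s₃ - ¼) - ι N
          t = t₀ - ½ * e * ⅓
          a₂ : Away ¼ (2ℚ * t + s₂)
          a₂ = away 0ℤ (≤-trans (∣∣-cong {x = - ⅓ * e} (trans (l₂ s₂ e) (cong (λ z → 2ℚ * t + s₂ - (z + ½)) (sym ι0≡0)))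
            (∣∣-* {x = - ⅓} {y = e} ≤-refl ∣e∣≤½)) (≤ᵇ⇒≤ {∣ - ⅓ ∣ * ½} {¼} _))
      in finish t N a₂ (l₃ s₂ s₃ (ι N)) (away-either (1ℚ * t + s₁))
      where
      finish : ∀ t N → Away ¼ (2ℚ * t + s₂) → ¼ + ½ * ι N ≡ 3ℚ * t + s₃ → Away ¼ (1ℚ * t + s₁)
        ⊎ Away ¼ (1ℚ * t + s₁ + ½) →
               ∃[ t ] (Away ¼ (1ℚ * t + s₁) × Away ¼ (2ℚ * t + s₂) × Away ¼ (3ℚ * t + s₃))
      finish t N a₂ eq₃ (inj₁ a₁) = t , a₁ , a₂ , away-cong eq₃ (away-quarter N)
      finish t N a₂ eq₃ (inj₂ a₁) = t + ½ , away-cong (k₁ t s₁) a₁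
        , away-cong (trans (cong (λ z → 2ℚ * t + s₂ + z) ι1≡1) (k₂ t s₂)) (away-+ι 1ℤ a₂)
        , away-cong (trans (cong (λ z → ¼ + ½ * z) (trans (ι-+ N (+ 3)) (cong (λ z → ι N + z) (ι-def (+ 3)))))
            (trans (k₃ (ι N)) (trans (cong (λ z → z + 3ℚ * ½) eq₃) (k₄ t s₃)))) (away-quarter (N ℤ.+ + 3))
        where
        k₁ = solve 2 (λ t s → con 1ℚ :* t :+ s :+ con ½ := con 1ℚ :* (t :+ con ½) :+ s) refl
        k₂ = solve 2 (λ t s → con 2ℚ :* t :+ s :+ con 1ℚ := con 2ℚ :* (t :+ con ½) :+ s) refl
        k₃ = solve 1 (λ N → con ¼ :+ con ½ :* (N :+ con 3ℚ) := con ¼ :+ con ½ :* N :+ con 3ℚ :* con ½) refl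
        k₄ = solve 2 (λ t s → con 3ℚ :* t :+ s :+ con 3ℚ :* con ½ := con 3ℚ :* (t :+ con ½) :+ s) refl
      l₂ = solve 2 (λ s e → :- con ⅓ :* e
        := con 2ℚ :* ((con ½ :- s) :* con ½ :- con ½ :* e :* con ⅓) :+ s :- (con 0ℚ :+ con ½)) refl
      l₃ = solve 3 (λ s s′ N → con ¼ :+ con ½ :* N
        := con 3ℚ :* ((con ½ :- s) :* con ½
        :- con ½ :* (con 2ℚ :* (con 3ℚ :* ((con ½ :- s) :* con ½) :+ s′ :- con ¼) :- N) :* con ⅓) :+ s′) refl

  record Lonely₃ (A B C : ℚ) : Set where
    constructor lonely
    field
      meet : ∀ s₁ s₂ s₃ → ∃[ t ] (Away ¼ (A * t + s₁) × Away ¼ (B * t + s₂) × Away ¼ (C * t + s₃))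

  open Lonely₃

  private
    coprime-speeds : ∀ a b c x y → 0 ℕ.< a → a ℕ.< b → b ℕ.< c → x ℤ.* + b ℤ.- y ℤ.* + a ≡ 1ℤ →
      Lonely₃ (ν a) (ν b) (ν c)
    coprime-speeds a b c x y 0<a a<b b<c eq with room a b c 0<a a<b b<c
    ... | inj₁ (refl , refl , refl) = lonely λ s₁ s₂ s₃ →
      let t , a₁ , a₂ , a₃ = speeds-1-2-3 s₁ s₂ s₃
      in t , away-cong (cong (λ z → z * t + s₁) (sym ι1≡1)) a₁ , away-cong (cong (λ z → z * t + s₂) (sym ν2≡2)) a₂
         , away-cong (cong (λ z → z * t + s₃) (sym (ι-def (+ 3)))) a₃
    ... | inj₂ h = lonely (three-coprime (+ a) (+ b) (ν c) x y (0<ν 0<a) (0<ν (ℕ.<-trans 0<a a<b))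
          (ν-mono-≤ (ℕ.<⇒≤ (ℕ.<-trans a<b b<c))) (ν-mono-≤ (ℕ.<⇒≤ b<c)) eq
          (0≤-⇒≤ (≤⇒0≤- (ν-mono-≤ h)) (trans (cong₂ _-_ (trans (ν-* c (a ℕ.+ b)) (cong (λ z → ν c * z) (ν-+ a b)))
              (trans (ν-+ (2 ℕ.* (a ℕ.* b)) (2 ℕ.* c))
                (cong₂ _+_ (trans (ν-* 2 (a ℕ.* b)) (cong₂ _*_ ν2≡2 (ν-* a b)))
                (trans (ν-* 2 c) (cong (_* ν c) ν2≡2)))))
            (lem (ν a) (ν b) (ν c)))))
      where
      lem = solve 3 (λ a b c → c :* (a :+ b) :- (con 2ℚ :* (a :* b) :+ con 2ℚ :* c)
        := c :* (a :+ b :- con 2ℚ) :- con 2ℚ :* (a :* b)) refl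

    -- If the common period of the first two runners does not bring back the third,
    -- two lonely runners can wait for the third one.
    incommensurable : ∀ (a b : ℤ) γ → a ≢ 0ℤ → b ≢ 0ℤ → (∀ n → γ ≢ ι n) → Lonely₃ (ι a) (ι b) γ
    incommensurable a b γ a≢0 b≢0 γ∉ℤ = lonely λ s₁ s₂ s₃ →
      let t , a₁ , a₂ = two-runners (ι a) (ι b) (ι≢0 a≢0) (ι≢0 b≢0) s₁ s₂
          m , a₃ = step γ γ∉ℤ (γ * t + s₃)
      in t + ι m , away-cong (trans (cong (λ z → ι a * t + s₁ + z) (ι-* a m)) (l₁ (ι a) t s₁ (ι m)))
        (away-+ι (a ℤ.* m) a₁)
         , away-cong (trans (cong (λ z → ι b * t + s₂ + z) (ι-* b m)) (l₁ (ι b) t s₂ (ι m))) (away-+ι (b ℤ.* m) a₂)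
         , away-cong (l₂ γ t s₃ (ι m)) a₃
      where
      l₁ = solve 4 (λ a t s m → a :* t :+ s :+ a :* m := a :* (t :+ m) :+ s) refl
      l₂ = solve 4 (λ a t s m → a :* m :+ (a :* t :+ s) := a :* (t :+ m) :+ s) refl

    rescale : ∀ {A B C A′ B′ C′} g r → g * r ≡ 1ℚ → A′ * g ≡ A → B′ * g ≡ B → C′ * g ≡ C → Lonely₃ A′ B′ C′ →
      Lonely₃ A B C
    rescale {A′ = A′} {B′} {C′} g r gr≡1 refl refl refl L = lonely λ s₁ s₂ s₃ →
      let t , a₁ , a₂ , a₃ = meet L s₁ s₂ s₃
      in t * r , away-cong (by-eq (A′ * t) (sym gr≡1) (lem A′ g r t s₁)) a₁
         , away-cong (by-eq (B′ * t) (sym gr≡1) (lem B′ g r t s₂)) a₂ , away-cong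
           (by-eq (C′ * t) (sym gr≡1) (lem C′ g r t s₃)) a₃
      where
      lem = solve 5 (λ a g r t s → a :* t :+ s :- (a :* g :* (t :* r) :+ s) := a :* t :* (con 1ℚ :- g :* r)) refl

    -- Once time is scaled by the gcd of a and b, the first two runners have coprime integral speeds
    -- and common period 1. Either the third speed becomes integral too, or the third runner
    -- advances by a non-integer in every period.
    sorted-speeds : ∀ a b c → 0 ℕ.< a → a ℕ.< b → b ℕ.< c → Lonely₃ (ν a) (ν b) (ν c)
    sorted-speeds a b c 0<a a<b b<c with ℕ.gcd a b in geq | ℕ.gcd[m,n]∣m a b | ℕ.gcd[m,n]∣n a b
    ... | 0 | ℕ.divides q refl | _ = contradiction (subst (0 ℕ.<_) (ℕ.*-zeroʳ q) 0<a) λ()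
    ... | g@(suc g-1) | ℕ.divides a′ refl | ℕ.divides b′ refl = go (g ℕ.∣? c)
      where
      x = proj₁ (bézout (a′ ℕ.* g) (b′ ℕ.* g))
      y = proj₁ (proj₂ (bézout (a′ ℕ.* g) (b′ ℕ.* g)))
      bez : y ℤ.* + b′ ℤ.- (ℤ.- x) ℤ.* + a′ ≡ 1ℤ
      bez = ℤ.*-cancelʳ-≡ _ _ (+ g)
        (trans (lem x y (+ a′) (+ b′) (+ g))
        (trans (trans (cong₂ (λ u v → x ℤ.* u ℤ.+ y ℤ.* v) (sym (ℤ.pos-* a′ g)) (sym (ℤ.pos-* b′ g)))
              (trans (proj₂ (proj₂ (bézout (a′ ℕ.* g) (b′ ℕ.* g)))) (cong +_ geq))) (sym (ℤ.*-identityˡ (+ g)))))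
        where
        lem : ∀ x y a b g → (y ℤ.* b ℤ.- (ℤ.- x) ℤ.* a) ℤ.* g ≡ x ℤ.* (a ℤ.* g) ℤ.+ y ℤ.* (b ℤ.* g)
        lem = ℤR.solve-∀
      inv = inverse (ν g) (ι≢0 {+ g} λ())
      r = proj₁ inv
      0<a′ : 0 ℕ.< a′
      0<a′ = ℕ.*-cancelʳ-< g 0 a′ 0<a
      a′<b′ : a′ ℕ.< b′
      a′<b′ = ℕ.*-cancelʳ-< g a′ b′ a<b
      go : Dec (g ℕ.∣ c) → Lonely₃ (ν (a′ ℕ.* g)) (ν (b′ ℕ.* g)) (ν c)
      go (yes (ℕ.divides c′ refl)) = rescale (ν g) r (proj₂ inv) (sym (ν-* a′ g)) (sym (ν-* b′ g)) (sym (ν-* c′ g))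
        (coprime-speeds a′ b′ c′ y (ℤ.- x) 0<a′ a′<b′ (ℕ.*-cancelʳ-< g b′ c′ b<c) bez)
      go (no g∤c) = rescale (ν g) r (proj₂ inv) (sym (ν-* a′ g)) (sym (ν-* b′ g))
        (by-eq (ν c) (proj₂ inv) (lem (ν c) (ν g) r))
        (incommensurable (+ a′) (+ b′) (ν c * r) (λ eq → ℕ.<⇒≢ 0<a′ (sym (ℤ.+-injective eq)))
          (λ eq → ℕ.<⇒≢ (ℕ.<-trans 0<a′ a′<b′) (sym (ℤ.+-injective eq)))
          λ n eq → g∤c (ℕ.divides ℤ.∣ n ∣ (trans (cong ℤ.∣_∣ (ι-injective {+ c} {n ℤ.* + g}
            (trans (by-eq (ν c) (sym (proj₂ inv)) (lem′ (ν c) (ν g) r))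
              (trans (cong (_* ν g) eq) (sym (ι-* n (+ g))))))) (ℤ.abs-* n (+ g)))))
        where
        lem : ∀ c g r → c * r * g - c ≡ c * (g * r - 1ℚ)
        lem = solve-∀ ℚ-ring
        lem′ = solve 3 (λ c g r → c :- c :* r :* g := c :* (con 1ℚ :- g :* r)) refl

    distinct-speeds : ∀ a b c → 0 ℕ.< a → 0 ℕ.< b → 0 ℕ.< c → a ≢ b → a ≢ c → b ≢ c → Lonely₃ (ν a) (ν b) (ν c)
    distinct-speeds a b c 0<a 0<b 0<c a≢b a≢c b≢c with ℕ.<-cmp a b | ℕ.<-cmp b c | ℕ.<-cmp a c
    ... | tri≈ _ eq _ | _ | _ = contradiction eq a≢b
    ... | _ | tri≈ _ eq _ | _ = contradiction eq b≢c
    ... | _ | _ | tri≈ _ eq _ = contradiction eq a≢c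
    ... | tri< a<b _ _ | tri< b<c _ _ | _ = sorted-speeds a b c 0<a a<b b<c
    ... | tri> _ _ b<a | _ | tri< a<c _ _ = lonely λ s₁ s₂ s₃ →
        let t , x , y , z = meet (sorted-speeds b a c 0<b b<a a<c) s₂ s₁ s₃
        in t , y , x , z
    ... | tri< a<b _ _ | _ | tri> _ _ c<a = lonely λ s₁ s₂ s₃ →
        let t , x , y , z = meet (sorted-speeds c a b 0<c c<a a<b) s₃ s₁ s₂
        in t , y , z , x
    ... | _ | tri> _ _ c<b | tri< a<c _ _ = lonely λ s₁ s₂ s₃ →
        let t , x , y , z = meet (sorted-speeds a c b 0<a a<c c<b) s₁ s₃ s₂
        in t , x , z , y
    ... | _ | tri< b<c _ _ | tri> _ _ c<a = lonely λ s₁ s₂ s₃ →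
        let t , x , y , z = meet (sorted-speeds b c a 0<b b<c c<a) s₂ s₃ s₁
        in t , z , x , y
    ... | tri> _ _ b<a | tri> _ _ c<b | _ = lonely λ s₁ s₂ s₃ →
        let t , x , y , z = meet (sorted-speeds c b a 0<c c<b b<a) s₃ s₂ s₁
        in t , z , y , x

    ι-sign : ∀ x → ι x ≡ ν ℤ.∣ x ∣ ⊎ ι x ≡ - ν ℤ.∣ x ∣
    ι-sign (+ n) = inj₁ refl
    ι-sign -[1+ n ] = inj₂ (ι-neg (+ suc n))

  three-runners : ∀ x y z → x ≢ 0ℤ → y ≢ 0ℤ → z ≢ 0ℤ → ℤ.∣ x ∣ ≢ ℤ.∣ y ∣ → ℤ.∣ x ∣ ≢ ℤ.∣ z ∣ → ℤ.∣ y ∣ ≢ ℤ.∣ z ∣ →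
                  Lonely₃ (ι x) (ι y) (ι z)
  three-runners x y z x≢0 y≢0 z≢0 x≢y x≢z y≢z = sign₁ (ι-sign x) (sign₂ (ι-sign y) (sign₃ (ι-sign z)
    (distinct-speeds ℤ.∣ x ∣ ℤ.∣ y ∣ ℤ.∣ z ∣ (pos x≢0) (pos y≢0) (pos z≢0) x≢y x≢z y≢z)))
    where
    pos : ∀ {x} → x ≢ 0ℤ → 0 ℕ.< ℤ.∣ x ∣
    pos x≢0 = ℕ.n≢0⇒n>0 λ eq → x≢0 (ℤ.∣i∣≡0⇒i≡0 eq)
    turn : ∀ a t s → - (a * t + - s) ≡ - a * t + s
    turn = solve-∀ ℚ-ring
    sign₁ : ∀ {A A′ B C} → A ≡ A′ ⊎ A ≡ - A′ → Lonely₃ A′ B C → Lonely₃ A B C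
    sign₁ (inj₁ refl) L = L
    sign₁ {A′ = A′} (inj₂ refl) L = lonely λ s₁ s₂ s₃ →
        let t , a₁ , a₂ , a₃ = meet L (- s₁) s₂ s₃
        in t , away-cong (turn A′ t s₁) (away-neg a₁) , a₂ , a₃
    sign₂ : ∀ {A B B′ C} → B ≡ B′ ⊎ B ≡ - B′ → Lonely₃ A B′ C → Lonely₃ A B C
    sign₂ (inj₁ refl) L = L
    sign₂ {B′ = B′} (inj₂ refl) L = lonely λ s₁ s₂ s₃ →
        let t , a₁ , a₂ , a₃ = meet L s₁ (- s₂) s₃
        in t , a₁ , away-cong (turn B′ t s₂) (away-neg a₂) , a₃
    sign₃ : ∀ {A B C C′} → C ≡ C′ ⊎ C ≡ - C′ → Lonely₃ A B C′ → Lonely₃ A B C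
    sign₃ (inj₁ refl) L = L
    sign₃ {C′ = C′} (inj₂ refl) L = lonely λ s₁ s₂ s₃ →
        let t , a₁ , a₂ , a₃ = meet L s₁ s₂ (- s₃)
        in t , a₁ , a₂ , away-cong (turn C′ t s₃) (away-neg a₃)

  -- Runners with two-dimensional time

  record Runner : Set where
    constructor runner
    field
      vᵢ wᵢ : ℤ
      sᵢ : ℚ
      vᵢ≢0 : vᵢ ≢ 0ℤ

  open Runner

  pos : Runner → ℚ → ℚ → ℚ
  pos R α β = ι (vᵢ R) * α + ι (wᵢ R) * β + sᵢ R

  minor : Runner → Runner → ℤ
  minor R R′ = vᵢ R ℤ.* wᵢ R′ ℤ.- wᵢ R ℤ.* vᵢ R′

  Together : (R₁ R₂ R₃ R₄ : Runner) → Set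
  Together R₁ R₂ R₃ R₄ = ∃₂ λ α β → Away ¼ (pos R₁ α β) × Away ¼ (pos R₂ α β) × Away ¼ (pos R₃ α β)
    × Away ¼ (pos R₄ α β)

  ι-minor : ∀ R R′ → ι (minor R R′) ≡ ι (vᵢ R) * ι (wᵢ R′) - ι (wᵢ R) * ι (vᵢ R′)
  ι-minor R R′ = trans (ι-- (vᵢ R ℤ.* wᵢ R′) (wᵢ R ℤ.* vᵢ R′)) (cong₂ _-_ (ι-* (vᵢ R) (wᵢ R′)) (ι-* (wᵢ R) (vᵢ R′)))

  minor-self : ∀ R → minor R R ≡ 0ℤ
  minor-self R = lem (vᵢ R) (wᵢ R)
    where
    lem : ∀ v w → v ℤ.* w ℤ.- w ℤ.* v ≡ 0ℤ
    lem = ℤR.solve-∀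

  minor-swap : ∀ R R′ → minor R R′ ≡ ℤ.- minor R′ R
  minor-swap R R′ = lem (vᵢ R) (wᵢ R) (vᵢ R′) (wᵢ R′)
    where
    lem : ∀ v w v′ w′ → v ℤ.* w′ ℤ.- w ℤ.* v′ ≡ ℤ.- (v′ ℤ.* w ℤ.- w′ ℤ.* v)
    lem = ℤR.solve-∀

  minor-swap-≢0 : ∀ R R′ → minor R R′ ≢ 0ℤ → minor R′ R ≢ 0ℤ
  minor-swap-≢0 R R′ h eq = h (trans (minor-swap R R′) (cong ℤ.-_ eq))

  size : Runner → Runner → ℕ
  size R R′ = ℤ.∣ minor R R′ ∣

  size-swap : ∀ R R′ → size R R′ ≡ size R′ R
  size-swap R R′ = trans (cong ℤ.∣_∣ (minor-swap R R′)) (ℤ.∣-i∣≡∣i∣ (minor R′ R))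

  plücker : ∀ R₁ R₂ R₃ R₄ →
            minor R₁ R₃ ℤ.* minor R₂ R₄ ≡ minor R₁ R₂ ℤ.* minor R₃ R₄ ℤ.+ minor R₁ R₄ ℤ.* minor R₂ R₃
  plücker (runner a b _ _) (runner c d _ _) (runner e f _ _) (runner g h _ _) = lem a b c d e f g h
    where
    lem : ∀ a b c d e f g h → (a ℤ.* f ℤ.- b ℤ.* e) ℤ.* (c ℤ.* h ℤ.- d ℤ.* g)
          ≡ (a ℤ.* d ℤ.- b ℤ.* c) ℤ.* (e ℤ.* h ℤ.- f ℤ.* g) ℤ.+ (a ℤ.* h ℤ.- b ℤ.* g) ℤ.* (c ℤ.* f ℤ.- d ℤ.* e)
    lem = ℤR.solve-∀

  -- Along the direction (- `wᵢ P` , `vᵢ P`) the runner `P` stands still, and `R` has the speed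
  -- `minor P R`.
  slide : ∀ P R α β τ → ι (minor P R) * τ + pos R α β ≡ pos R (α - ι (wᵢ P) * τ) (β + ι (vᵢ P) * τ)
  slide P R α β τ = trans (cong (λ z → z * τ + pos R α β) (ι-minor P R))
    (lem (ι (vᵢ P)) (ι (wᵢ P)) (ι (vᵢ R)) (ι (wᵢ R)) (sᵢ R) α β τ)
    where
    lem = solve 8 (λ p q v w s α β τ → (p :* w :- q :* v) :* τ :+ (v :* α :+ w :* β :+ s)
      := v :* (α :- q :* τ) :+ w :* (β :+ p :* τ) :+ s) refl

  slide-fixed : ∀ P R α β τ → minor P R ≡ 0ℤ → Away ¼ (pos R α β) → Away ¼ (pos R (α - ι (wᵢ P) * τ) (β + ι (vᵢ P) * τ))
  slide-fixed P R α β τ m≡0 a =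
    away-cong (trans (trans (lem τ (pos R α β)) (cong (λ z → z * τ + pos R α β) (sym (trans (cong ι m≡0) ι0≡0))))
    (slide P R α β τ)) a
    where
    lem : ∀ τ p → p ≡ 0ℚ * τ + p
    lem = solve-∀ ℚ-ring

  slide-self : ∀ P α β τ → Away ¼ (pos P α β) → Away ¼ (pos P (α - ι (wᵢ P) * τ) (β + ι (vᵢ P) * τ))
  slide-self P α β τ = slide-fixed P P α β τ (minor-self P)

  pos-start : ∀ R t → ι (vᵢ R) * t + sᵢ R ≡ pos R t 0ℚ
  pos-start R t = lem (ι (vᵢ R)) (ι (wᵢ R)) (sᵢ R) t
    where
    lem = solve 4 (λ v w s t → v :* t :+ s := v :* t :+ w :* con 0ℚ :+ s) refl

  pivot-distinct : ∀ R₁ R₂ R₃ R₄ → minor R₁ R₂ ≢ 0ℤ → minor R₁ R₃ ≢ 0ℤ → minor R₁ R₄ ≢ 0ℤ →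
    size R₁ R₂ ≢ size R₁ R₃ → size R₁ R₂ ≢ size R₁ R₄ → size R₁ R₃ ≢ size R₁ R₄ → Together R₁ R₂ R₃ R₄
  pivot-distinct R₁ R₂ R₃ R₄ n₂ n₃ n₄ d₂₃ d₂₄ d₃₄ =
    let t , a₁ = one-runner (ι (vᵢ R₁)) (ι≢0 (vᵢ≢0 R₁)) (sᵢ R₁)
        τ , a₂ , a₃ , a₄ = meet (three-runners (minor R₁ R₂) (minor R₁ R₃) (minor R₁ R₄) n₂ n₃ n₄ d₂₃ d₂₄ d₃₄)
                             (pos R₂ t 0ℚ) (pos R₃ t 0ℚ) (pos R₄ t 0ℚ)
    in _ , _ , slide-self R₁ t 0ℚ τ (away-cong (pos-start R₁ t) a₁)
       , away-cong (slide R₁ R₂ t 0ℚ τ) a₂ , away-cong (slide R₁ R₃ t 0ℚ τ) a₃ , away-cong (slide R₁ R₄ t 0ℚ τ) a₄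

  -- A line that keeps `R₁` fixed keeps its parallel `R₂` fixed as well. So `R₁` and `R₂` are placed
  -- first, by moving α, and the others afterwards along that line.
  pivot-parallel : ∀ R₁ R₂ R₃ R₄ → minor R₁ R₂ ≡ 0ℤ → minor R₁ R₃ ≢ 0ℤ → minor R₁ R₄ ≢ 0ℤ → Together R₁ R₂ R₃ R₄
  pivot-parallel R₁ R₂ R₃ R₄ m₂≡0 n₃ n₄ =
    let t , a₁ , a₂ = two-runners (ι (vᵢ R₁)) (ι (vᵢ R₂)) (ι≢0 (vᵢ≢0 R₁)) (ι≢0 (vᵢ≢0 R₂)) (sᵢ R₁) (sᵢ R₂)
        τ , a₃ , a₄ = two-runners (ι (minor R₁ R₃)) (ι (minor R₁ R₄)) (ι≢0 n₃) (ι≢0 n₄) (pos R₃ t 0ℚ) (pos R₄ t 0ℚ)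
    in _ , _ , slide-self R₁ t 0ℚ τ (away-cong (pos-start R₁ t) a₁) , slide-fixed R₁ R₂ t 0ℚ τ m₂≡0
      (away-cong (pos-start R₂ t) a₂)
       , away-cong (slide R₁ R₃ t 0ℚ τ) a₃ , away-cong (slide R₁ R₄ t 0ℚ τ) a₄

  pivot-three-parallel : ∀ R₁ R₂ R₃ R₄ → minor R₁ R₂ ≡ 0ℤ → minor R₁ R₃ ≡ 0ℤ → minor R₁ R₄ ≢ 0ℤ →
    ℤ.∣ vᵢ R₁ ∣ ≢ ℤ.∣ vᵢ R₂ ∣ → ℤ.∣ vᵢ R₁ ∣ ≢ ℤ.∣ vᵢ R₃ ∣ → ℤ.∣ vᵢ R₂ ∣ ≢ ℤ.∣ vᵢ R₃ ∣ → Together R₁ R₂ R₃ R₄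
  pivot-three-parallel R₁ R₂ R₃ R₄ m₂≡0 m₃≡0 n₄ d₁₂ d₁₃ d₂₃ =
    let t , a₁ , a₂ , a₃ = meet (three-runners (vᵢ R₁) (vᵢ R₂) (vᵢ R₃) (vᵢ≢0 R₁) (vᵢ≢0 R₂) (vᵢ≢0 R₃) d₁₂ d₁₃ d₂₃)
          (sᵢ R₁) (sᵢ R₂) (sᵢ R₃)
        τ , a₄ = one-runner (ι (minor R₁ R₄)) (ι≢0 n₄) (pos R₄ t 0ℚ)
    in _ , _ , slide-self R₁ t 0ℚ τ (away-cong (pos-start R₁ t) a₁) , slide-fixed R₁ R₂ t 0ℚ τ m₂≡0
      (away-cong (pos-start R₂ t) a₂)
       , slide-fixed R₁ R₃ t 0ℚ τ m₃≡0 (away-cong (pos-start R₃ t) a₃) , away-cong (slide R₁ R₄ t 0ℚ τ) a₄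

  private
    integer? : ∀ ρ → (∃[ n ] ρ ≡ ι n) ⊎ (∀ n → ρ ≢ ι n)
    integer? ρ with ρ ≟ ι (proj₁ (floor-bounds ρ))
    ... | yes eq = inj₁ (_ , eq)
    -- The upper bound in `floor-bounds` is not strict, so m + 1 is a second candidate.
    ... | no neq with ρ ≟ ι (proj₁ (floor-bounds ρ) ℤ.+ 1ℤ)
    ...   | yes eq = inj₁ (_ , eq)
    ...   | no neq′ = inj₂ λ n eq → go n eq (ℤ.≤-total n m)
      where
      m = proj₁ (floor-bounds ρ)
      m≤ρ = proj₁ (proj₂ (floor-bounds ρ))
      ρ≤m+1 = proj₂ (proj₂ (floor-bounds ρ))
      go : ∀ n → ρ ≡ ι n → n ℤ.≤ m ⊎ m ℤ.≤ n → ⊥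
      go n eq (inj₁ n≤m) = neq (≤-antisym (subst (_≤ ι m) (sym eq) (ι-mono-≤ n≤m)) m≤ρ)
      go n eq (inj₂ m≤n) with m ℤ.≟ n
      ... | yes refl = neq eq
      ... | no m≢n = neq′ (≤-antisym (subst (ρ ≤_) (sym (trans (ι-+ m 1ℤ) (cong (λ z → ι m + z) ι1≡1))) ρ≤m+1)
              (subst (ι (m ℤ.+ 1ℤ) ≤_) (sym eq)
                (ι-mono-≤ (subst (ℤ._≤ n) (ℤ.+-comm 1ℤ m) (ℤ.i<j⇒suc[i]≤j (ℤ.≤∧≢⇒< m≤n m≢n))))))

    1≤∣ι∣ : ∀ n → ι n ≢ 0ℚ → 1ℚ ≤ ∣ ι n ∣
    1≤∣ι∣ n ιn≢0 = subst₂ _≤_ ι1≡1 (sym (∣ι∣ n))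
      (ι-mono-≤ (ℤ.+≤+ (ℕ.n≢0⇒n>0 λ eq → ιn≢0 (trans (cong ι (ℤ.∣i∣≡0⇒i≡0 eq)) ι0≡0))))

    ∣inverse∣≤1 : ∀ p r → p * r ≡ 1ℚ → 1ℚ ≤ ∣ p ∣ → ∣ r ∣ ≤ 1ℚ
    ∣inverse∣≤1 p r pr≡1 1≤p = subst₂ _≤_ (*-identityˡ ∣ r ∣) (trans (sym (∣p*q∣≡∣p∣*∣q∣ p r)) (cong ∣_∣ pr≡1))
      (*-monoʳ-≤-nonNeg ∣ r ∣ {{∣-∣-nonNeg r}} 1≤p)

  -- In the coordinates X, Y given by the first two runners, with X and Y arbitrary,
  -- the other two runners see only Y + X and Y - X respectively.
  harmonic : ∀ ρ τ → ρ ≢ 0ℚ → τ ≢ 0ℚ → ∀ c d →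
             ∃₂ λ X Y → Away ¼ X × Away ¼ Y × Away ¼ (ρ * (Y + X) + c) × Away ¼ (τ * (Y - X) + d)
  harmonic ρ τ ρ≢0 τ≢0 c d = go (integer? ρ) (integer? τ)
    where
    Goal = ∃₂ λ X Y → Away ¼ X × Away ¼ Y × Away ¼ (ρ * (Y + X) + c) × Away ¼ (τ * (Y - X) + d)
    go : (∃[ n ] ρ ≡ ι n) ⊎ (∀ n → ρ ≢ ι n) → (∃[ n ] τ ≡ ι n) ⊎ (∀ n → τ ≢ ι n) → Goal
    go (inj₂ ρ∉ℤ) _ =
      -- With X + Y an integer m, X is away from ℤ exactly as far as Y. The only unknown left is V =
      -- Y - X, on which Y depends with speed ½, so two runners remain.
      let m , a₃ = step ρ ρ∉ℤ c
          V , a₄ , aY = two-runners τ ½ τ≢0 (λ ()) d (½ * ι m)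
          Y = ½ * V + ½ * ι m
      in ι m - Y , Y , away-cong (l₁ Y (ι m)) (away-+ι m (away-neg aY)) , aY
         , away-cong (cong (λ z → ρ * z + c) (l₂ Y (ι m))) a₃ , away-cong (cong (λ z → τ * z + d) (l₃ V (ι m))) a₄
      where
      l₁ : ∀ Y m → - Y + m ≡ m - Y
      l₁ = solve-∀ ℚ-ring
      l₂ : ∀ Y m → m ≡ Y + (m - Y)
      l₂ = solve-∀ ℚ-ring
      l₃ = solve 2 (λ V m → V := con ½ :* V :+ con ½ :* m :- (m :- (con ½ :* V :+ con ½ :* m))) refl
    go (inj₁ _) (inj₂ τ∉ℤ) =
      let m , a₄ = step τ τ∉ℤ d
          U , a₃ , aY = two-runners ρ ½ ρ≢0 (λ ()) c (½ * ι m)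
          Y = ½ * U + ½ * ι m
      in Y - ι m , Y , away-cong (cong (λ z → Y + z) (ι-neg m)) (away-+ι (ℤ.- m) aY) , aY
         , away-cong (cong (λ z → ρ * z + c) (l₂ U (ι m))) a₃ , away-cong (cong (λ z → τ * z + d) (l₃ Y (ι m))) a₄
      where
      l₂ = solve 2 (λ U m → U := con ½ :* U :+ con ½ :* m :+ (con ½ :* U :+ con ½ :* m :- m)) refl
      l₃ : ∀ Y m → m ≡ Y - (Y - m)
      l₃ = solve-∀ ℚ-ring
    go (inj₁ (m , refl)) (inj₁ (n , refl)) =
      -- The start is X = Y = ½, with sum 1 and difference 0. Being nonzero integers, ρ and τ have
      -- absolute value at least 1, so centring the last two runners changes the sum and the
      -- difference by at most ¼ each, hence X and Y by at most ¼.
      let r , ρr≡1 = inverse ρ ρ≢0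
          r′ , τr′≡1 = inverse τ τ≢0
          δ , ∣δ∣≤¼ , a₃ = centre (ρ * 1ℚ + c)
          ε , ∣ε∣≤¼ , a₄ = centre (τ * 0ℚ + d)
          ∣p∣≤¼ = ∣∣-* {δ} {r} ∣δ∣≤¼ (∣inverse∣≤1 ρ r ρr≡1 (1≤∣ι∣ m ρ≢0))
          ∣q∣≤¼ = ∣∣-* {ε} {r′} ∣ε∣≤¼ (∣inverse∣≤1 τ r′ τr′≡1 (1≤∣ι∣ n τ≢0))
          p = δ * r
          q = ε * r′
          half : ∀ z → ∣ z ∣ ≤ ¼ * 1ℚ + ¼ * 1ℚ → Away ¼ (½ * z + ½)
          half z h = away 0ℤ (∣∣-cong {½ * z} (trans (l₀ z) (cong (λ u → ½ * z + ½ - (u + ½)) (sym ι0≡0)))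
            (∣∣-* {½} {z} ≤-refl h))
      in ½ * (p - q) + ½ , ½ * (p + q) + ½
         , half (p - q) (∣∣-+ {p} { - q} ∣p∣≤¼ (∣∣-neg {q} ∣q∣≤¼)) , half (p + q) (∣∣-+ {p} {q} ∣p∣≤¼ ∣q∣≤¼)
         , away-cong (by-eq δ (sym ρr≡1) (l₁ ρ r δ q c)) a₃ , away-cong (by-eq ε (sym τr′≡1) (l₂ τ r′ ε p d)) a₄
      where
      l₀ : ∀ z → ½ * z ≡ ½ * z + ½ - (0ℚ + ½)
      l₀ = solve-∀ ℚ-ring
      l₁ = solve 5 (λ ρ r δ q c →
        ρ :* con 1ℚ :+ c :+ δ :- (ρ :* (con ½ :* (δ :* r :+ q) :+ con ½ :+ (con ½ :* (δ :* r :- q) :+ con ½)) :+ c)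
        := δ :* (con 1ℚ :- ρ :* r)) refl
      l₂ = solve 5 (λ τ r ε p d →
        τ :* con 0ℚ :+ d :+ ε :- (τ :* (con ½ :* (p :+ ε :* r) :+ con ½ :- (con ½ :* (p :- ε :* r) :+ con ½)) :+ d)
        := ε :* (con 1ℚ :- τ :* r)) refl

  -- Cramer's rule, with r inverse to `minor R₁ R₂`. In the new coordinates the coefficients of a
  -- runner are its minors with `R₁` and `R₂`, so that equal sizes become equal coefficients up to
  -- sign.
  coordinates : ∀ R₁ R₂ → minor R₁ R₂ ≢ 0ℤ → ∃[ r ] (r ≢ 0ℚ × (∀ X Y → ∃₂ λ α β →
                X ≡ pos R₁ α β × Y ≡ pos R₂ α β ×
                (∀ R → r * ι (minor R₁ R) * Y + r * ι (minor R R₂) * X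
                  + (sᵢ R - r * (ι (minor R₁ R) * sᵢ R₂ + ι (minor R R₂) * sᵢ R₁)) ≡ pos R α β)))
  coordinates R₁ R₂ n =
    let r , Dr≡1 = inverse D (ι≢0 n)
    in r , (λ r≡0 → 1≢0 (trans (sym Dr≡1) (trans (cong (D *_) r≡0) (*-zeroʳ D)))) , λ X Y →
       _ , _ , by-eq (X - sᵢ R₁) (sym (Dr′≡1 r Dr≡1)) (l₁ v₁ w₁ v₂ w₂ (sᵢ R₁) (sᵢ R₂) r X Y)
       , by-eq (Y - sᵢ R₂) (sym (Dr′≡1 r Dr≡1)) (l₂ v₁ w₁ v₂ w₂ (sᵢ R₁) (sᵢ R₂) r X Y)
       , λ R → trans (cong₂ (λ a b → r * a * Y + r * b * X + (sᵢ R - r * (a * sᵢ R₂ + b * sᵢ R₁))) (ι-minor R₁ R)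
         (ι-minor R R₂))
                     (l₃ v₁ w₁ v₂ w₂ (sᵢ R₁) (sᵢ R₂) r X Y (ι (vᵢ R)) (ι (wᵢ R)) (sᵢ R))
    where
    D = ι (minor R₁ R₂)
    v₁ = ι (vᵢ R₁)
    w₁ = ι (wᵢ R₁)
    v₂ = ι (vᵢ R₂)
    w₂ = ι (wᵢ R₂)
    Dr′≡1 : ∀ r → D * r ≡ 1ℚ → (v₁ * w₂ - w₁ * v₂) * r ≡ 1ℚ
    Dr′≡1 r eq = trans (cong (_* r) (sym (ι-minor R₁ R₂))) eq
    l₁ = solve 9 (λ v w v′ w′ s s′ r X Y →
      X :- (v :* (r :* (w′ :* (X :- s) :- w :* (Y :- s′))) :+ w :* (r :* (v :* (Y :- s′) :- v′ :* (X :- s))) :+ s)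
         := (X :- s) :* (con 1ℚ :- (v :* w′ :- w :* v′) :* r)) refl
    l₂ = solve 9 (λ v w v′ w′ s s′ r X Y →
      Y :- (v′ :* (r :* (w′ :* (X :- s) :- w :* (Y :- s′))) :+ w′ :* (r :* (v :* (Y :- s′) :- v′ :* (X :- s))) :+ s′)
         := (Y :- s′) :* (con 1ℚ :- (v :* w′ :- w :* v′) :* r)) refl
    l₃ = solve 12 (λ v w v′ w′ s s′ r X Y v″ w″ s″ →
         r :* (v :* w″ :- w :* v″) :* Y :+ r :* (v″ :* w′ :- w″ :* v′) :* X
           :+ (s″ :- r :* ((v :* w″ :- w :* v″) :* s′ :+ (v″ :* w′ :- w″ :* v′) :* s))
         := v″ :* (r :* (w′ :* (X :- s) :- w :* (Y :- s′))) :+ w″ :* (r :* (v :* (Y :- s′) :- v′ :* (X :- s))) :+ s″)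
           refl

  private
    *-≢0 : ∀ {p q} → p ≢ 0ℚ → q ≢ 0ℚ → p * q ≢ 0ℚ
    *-≢0 {p} {q} p≢0 q≢0 pq≡0 =
      let r , pr≡1 = inverse p p≢0
      in q≢0 (trans (by-eq (- q) pr≡1 (l₁ p q r)) (trans (cong (r *_) pq≡0) (*-zeroʳ r)))
      where
      l₁ = solve 3 (λ p q r → q :- r :* (p :* q) := :- q :* (p :* r :- con 1ℚ)) refl

    apexes± : ∀ R₁ R₂ R₃ R₄ → minor R₁ R₂ ≢ 0ℤ → minor R₁ R₃ ≢ 0ℤ → minor R₁ R₄ ≢ 0ℤ →
              minor R₃ R₂ ≡ minor R₁ R₃ → minor R₄ R₂ ≡ ℤ.- minor R₁ R₄ → Together R₁ R₂ R₃ R₄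
    apexes± R₁ R₂ R₃ R₄ n₁₂ n₁₃ n₁₄ eq₃ eq₄ =
      let r , r≢0 , solution = coordinates R₁ R₂ n₁₂
          ρ = r * ι (minor R₁ R₃)
          τ = r * ι (minor R₁ R₄)
          c = sᵢ R₃ - r * (ι (minor R₁ R₃) * sᵢ R₂ + ι (minor R₃ R₂) * sᵢ R₁)
          d = sᵢ R₄ - r * (ι (minor R₁ R₄) * sᵢ R₂ + ι (minor R₄ R₂) * sᵢ R₁)
          X , Y , a₁ , a₂ , a₃ , a₄ = harmonic ρ τ (*-≢0 r≢0 (ι≢0 n₁₃)) (*-≢0 r≢0 (ι≢0 n₁₄)) c d
          α , β , X≡ , Y≡ , on = solution X Y
      in α , β , away-cong X≡ a₁ , away-cong Y≡ a₂
         , away-cong (trans (cong (_+ c)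
           (trans (l₁ r (ι (minor R₁ R₃)) Y X) (cong (λ z → ρ * Y + r * z * X) (cong ι (sym eq₃))))) (on R₃)) a₃
         , away-cong (trans (cong (_+ d)
           (trans (l₂ r (ι (minor R₁ R₄)) Y X)
           (cong (λ z → τ * Y + r * z * X) (trans (sym (ι-neg (minor R₁ R₄))) (cong ι (sym eq₄)))))) (on R₄)) a₄
      where
      l₁ = solve 4 (λ r m Y X → r :* m :* (Y :+ X) := r :* m :* Y :+ r :* m :* X) refl
      l₂ = solve 4 (λ r m Y X → r :* m :* (Y :- X) := r :* m :* Y :+ r :* :- m :* X) refl

    ∣i∣≡∣j∣ : ∀ i j → ℤ.∣ i ∣ ≡ ℤ.∣ j ∣ → i ≡ j ⊎ i ≡ ℤ.- j
    ∣i∣≡∣j∣ (+ m) (+ n) eq = inj₁ (cong +_ eq)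
    ∣i∣≡∣j∣ (+ m) -[1+ n ] eq = inj₂ (cong +_ eq)
    ∣i∣≡∣j∣ -[1+ m ] (+ n) eq = inj₂ (cong (λ z → ℤ.- + z) eq)
    ∣i∣≡∣j∣ -[1+ m ] -[1+ n ] eq = inj₁ (cong (λ z → ℤ.- + z) eq)

  -- The directions of R₃ and R₄ are those of R₁ + R₂ and R₁ - R₂ in some order.
  apexes : ∀ R₁ R₂ R₃ R₄ → minor R₁ R₂ ≢ 0ℤ → minor R₁ R₃ ≢ 0ℤ → minor R₁ R₄ ≢ 0ℤ → minor R₃ R₄ ≢ 0ℤ →
           size R₃ R₁ ≡ size R₃ R₂ → size R₄ R₁ ≡ size R₄ R₂ → Together R₁ R₂ R₃ R₄
  apexes R₁ R₂ R₃ R₄ n₁₂ n₁₃ n₁₄ n₃₄ e₃ e₄ = go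
    (∣i∣≡∣j∣ (minor R₃ R₂) (minor R₁ R₃) (trans (sym e₃) (size-swap R₃ R₁)))
    (∣i∣≡∣j∣ (minor R₄ R₂) (minor R₁ R₄) (trans (sym e₄) (size-swap R₄ R₁)))
    where
    -- If both signs agreed, Plücker's relation would give `minor R₁ R₂` · `minor R₃ R₄` = 0. So
    -- exactly one of the two directions is the sum, and the other is the difference.
    parallel : minor R₁ R₃ ℤ.* minor R₄ R₂ ≡ minor R₁ R₄ ℤ.* minor R₃ R₂ → ⊥
    parallel eq = [ n₁₂ , n₃₄ ]′ (ℤ.i*j≡0⇒i≡0∨j≡0 (minor R₁ R₂) (trans
      (lem (minor R₁ R₂ ℤ.* minor R₃ R₄) (minor R₁ R₄ ℤ.* minor R₂ R₃))
        (trans (cong (λ z → z ℤ.- minor R₁ R₄ ℤ.* minor R₂ R₃) (sym (plücker R₁ R₂ R₃ R₄)))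
      (ℤ.i≡j⇒i-j≡0 {minor R₁ R₃ ℤ.* minor R₂ R₄} {minor R₁ R₄ ℤ.* minor R₂ R₃}
        (trans (cong (λ z → minor R₁ R₃ ℤ.* z) (minor-swap R₂ R₄))
        (trans (sym (ℤ.neg-distribʳ-* (minor R₁ R₃) (minor R₄ R₂))) (trans (cong ℤ.-_ eq)
          (trans (ℤ.neg-distribʳ-* (minor R₁ R₄) (minor R₃ R₂))
            (cong (λ z → minor R₁ R₄ ℤ.* z) (sym (minor-swap R₂ R₃)))))))))))
      where
      lem : ∀ p q → p ≡ p ℤ.+ q ℤ.- q
      lem = ℤR.solve-∀
    go : minor R₃ R₂ ≡ minor R₁ R₃ ⊎ minor R₃ R₂ ≡ ℤ.- minor R₁ R₃ → minor R₄ R₂ ≡ minor R₁ R₄ ⊎ minor R₄ R₂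
      ≡ ℤ.- minor R₁ R₄ → Together R₁ R₂ R₃ R₄
    go (inj₁ f₃) (inj₂ f₄) = apexes± R₁ R₂ R₃ R₄ n₁₂ n₁₃ n₁₄ f₃ f₄
    go (inj₂ f₃) (inj₁ f₄) =
        let α , β , a₁ , a₂ , a₄ , a₃ = apexes± R₁ R₂ R₄ R₃ n₁₂ n₁₄ n₁₃ f₄ f₃
        in α , β , a₁ , a₂ , a₃ , a₄
    go (inj₁ f₃) (inj₁ f₄) = ⊥-elim
      (parallel (trans (cong (λ z → minor R₁ R₃ ℤ.* z) f₄)
      (trans (ℤ.*-comm (minor R₁ R₃) (minor R₁ R₄)) (cong (λ z → minor R₁ R₄ ℤ.* z) (sym f₃)))))
    go (inj₂ f₃) (inj₂ f₄) = ⊥-elim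
      (parallel (trans (cong (λ z → minor R₁ R₃ ℤ.* z) f₄)
      (trans (lem′ (minor R₁ R₃) (minor R₁ R₄)) (cong (λ z → minor R₁ R₄ ℤ.* z) (sym f₃)))))
      where
      lem′ : ∀ a b → a ℤ.* (ℤ.- b) ≡ b ℤ.* (ℤ.- a)
      lem′ = ℤR.solve-∀

  private
    record Generic (R₁ R₂ R₃ R₄ : Runner) : Set where
      constructor generic
      field
        n₁₂ : minor R₁ R₂ ≢ 0ℤ
        n₁₃ : minor R₁ R₃ ≢ 0ℤ
        n₁₄ : minor R₁ R₄ ≢ 0ℤ
        n₂₃ : minor R₂ R₃ ≢ 0ℤ
        n₂₄ : minor R₂ R₄ ≢ 0ℤ
        n₃₄ : minor R₃ R₄ ≢ 0ℤ

    swap₁₂ : ∀ {R₁ R₂ R₃ R₄} → Generic R₁ R₂ R₃ R₄ → Generic R₂ R₁ R₃ R₄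
    swap₁₂ {R₁} {R₂} (generic a b c d e f) = generic (minor-swap-≢0 R₁ R₂ a) d e b c f

    swap₂₃ : ∀ {R₁ R₂ R₃ R₄} → Generic R₁ R₂ R₃ R₄ → Generic R₁ R₃ R₂ R₄
    swap₂₃ {R₂ = R₂} {R₃} (generic a b c d e f) = generic b a c (minor-swap-≢0 R₂ R₃ d) f e

    swap₃₄ : ∀ {R₁ R₂ R₃ R₄} → Generic R₁ R₂ R₃ R₄ → Generic R₁ R₂ R₄ R₃
    swap₃₄ {R₃ = R₃} {R₄} (generic a b c d e f) = generic a c b e d (minor-swap-≢0 R₃ R₄ f)

    -- If `R₁` fails as a pivot, two of its three sizes agree; let it point to the runner left out
    -- of that coincidence. When every pivot fails, this is a map without fixed points on four
    -- runners. A 2-cycle is the situation of `apexes`; `edge` and `path` follow the map for one and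
    -- for two steps, and `no-4-cycle` excludes the 4-cycle.
    Pivot : (R₁ R₂ R₃ R₄ : Runner) → Set
    Pivot R₁ R₂ R₃ R₄ = Together R₁ R₂ R₃ R₄ ⊎
      (size R₁ R₂ ≡ size R₁ R₃) ⊎ (size R₁ R₂ ≡ size R₁ R₄) ⊎ (size R₁ R₃ ≡ size R₁ R₄)

    pivot : ∀ R₁ R₂ R₃ R₄ → Generic R₁ R₂ R₃ R₄ → Pivot R₁ R₂ R₃ R₄
    pivot R₁ R₂ R₃ R₄ g with size R₁ R₂ ℕ.≟ size R₁ R₃ | size R₁ R₂ ℕ.≟ size R₁ R₄ | size R₁ R₃ ℕ.≟ size R₁ R₄
    ... | yes e | _ | _ = inj₂ (inj₁ e)
    ... | no _ | yes e | _ = inj₂ (inj₂ (inj₁ e))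
    ... | no _ | no _ | yes e = inj₂ (inj₂ (inj₂ e))
    ... | no d | no d′ | no d″ =
      inj₁ (pivot-distinct R₁ R₂ R₃ R₄ (Generic.n₁₂ g) (Generic.n₁₃ g) (Generic.n₁₄ g) d d′ d″)

    apexes′ : ∀ R₁ R₂ R₃ R₄ → Generic R₁ R₂ R₃ R₄ →
              size R₃ R₁ ≡ size R₃ R₂ → size R₄ R₁ ≡ size R₄ R₂ → Together R₁ R₂ R₃ R₄
    apexes′ R₁ R₂ R₃ R₄ g = apexes R₁ R₂ R₃ R₄ (Generic.n₁₂ g) (Generic.n₁₃ g) (Generic.n₁₄ g) (Generic.n₃₄ g)

    -- Four directions cannot have cyclically proportional minors: Plücker's
    -- relation would make the golden ratio rational.
    no-4-cycle : ∀ R₁ R₂ R₃ R₄ → Generic R₁ R₂ R₃ R₄ →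
                 size R₁ R₃ ≡ size R₁ R₄ → size R₂ R₁ ≡ size R₂ R₄ →
                 size R₃ R₁ ≡ size R₃ R₂ → ¬ size R₄ R₂ ≡ size R₄ R₃
    no-4-cycle R₁ R₂ R₃ R₄ g e₁ e₂ e₃ e₄ = absurd
      (trans (cong ℤ.∣_∣ (sym (plücker R₁ R₂ R₃ R₄))) (trans (ℤ.abs-* (minor R₁ R₃) (minor R₂ R₄)) (cong (y ℕ.*_) e₂₄)))
      (trans (ℤ.abs-* (minor R₁ R₂) (minor R₃ R₄)) (cong (x ℕ.*_) e₃₄))
      (trans (ℤ.abs-* (minor R₁ R₄) (minor R₂ R₃)) (cong₂ ℕ._*_ (sym e₁) e₂₃))
      (abs-+ (minor R₁ R₂ ℤ.* minor R₃ R₄) (minor R₁ R₄ ℤ.* minor R₂ R₃))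
      where
      x = size R₁ R₂
      y = size R₁ R₃
      e₂₃ : size R₂ R₃ ≡ y
      e₂₃ = trans (size-swap R₂ R₃) (trans (sym e₃) (size-swap R₃ R₁))
      e₂₄ : size R₂ R₄ ≡ x
      e₂₄ = trans (sym e₂) (size-swap R₂ R₁)
      e₃₄ : size R₃ R₄ ≡ x
      e₃₄ = trans (size-swap R₃ R₄) (trans (sym e₄) (trans (size-swap R₄ R₂) e₂₄))
      0<x : 0 ℕ.< x
      0<x = ℕ.n≢0⇒n>0 λ eq → Generic.n₁₂ g (ℤ.∣i∣≡0⇒i≡0 eq)
      0<y : 0 ℕ.< y
      0<y = ℕ.n≢0⇒n>0 λ eq → Generic.n₁₃ g (ℤ.∣i∣≡0⇒i≡0 eq)
      absurd : ∀ {a b c} → a ≡ y ℕ.* x → b ≡ x ℕ.* x → c ≡ y ℕ.* y → (a ≡ b ℕ.+ c) ⊎ (b ≡ a ℕ.+ c) ⊎ (c ≡ a ℕ.+ b) → ⊥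
      absurd refl refl refl (inj₁ eq) = xy≢x²+y² x y 0<x 0<y eq
      absurd refl refl refl (inj₂ (inj₁ eq)) = golden x x y ℕ.≤-refl 0<y eq
      absurd refl refl refl (inj₂ (inj₂ eq)) = golden y y x ℕ.≤-refl 0<x (trans eq (cong (ℕ._+ x ℕ.* x) (ℕ.*-comm y x)))

    -- Here `R₁` points to `R₂` and `R₂` to `R₃`. Unless the map is the 4-cycle, the coincidences,
    -- chained by symmetry of `size` where necessary, make two of the runners apexes over the other
    -- two.
    path : ∀ R₁ R₂ R₃ R₄ → Generic R₁ R₂ R₃ R₄ →
           size R₁ R₃ ≡ size R₁ R₄ → size R₂ R₁ ≡ size R₂ R₄ → Together R₁ R₂ R₃ R₄
    path R₁ R₂ R₃ R₄ g e₁ e₂ =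
      go (pivot R₃ R₁ R₂ R₄ (swap₁₂ (swap₂₃ g))) (pivot R₄ R₁ R₂ R₃ (swap₁₂ (swap₂₃ (swap₃₄ g))))
      where
      go : Pivot R₃ R₁ R₂ R₄ → Pivot R₄ R₁ R₂ R₃ → Together R₁ R₂ R₃ R₄
      go (inj₁ (α , β , a₃ , a₁ , a₂ , a₄)) _ = α , β , a₁ , a₂ , a₃ , a₄
      go _ (inj₁ (α , β , a₄ , a₁ , a₂ , a₃)) = α , β , a₁ , a₂ , a₃ , a₄
      go (inj₂ (inj₂ (inj₁ e₃))) (inj₂ _) =
        let α , β , a₁ , a₄ , a₂ , a₃ = apexes′ R₁ R₄ R₂ R₃ (swap₂₃ (swap₃₄ g)) e₂ e₃ in α , β , a₁ , a₂ , a₃ , a₄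
      go (inj₂ _) (inj₂ (inj₂ (inj₁ e₄))) =
        let α , β , a₁ , a₄ , a₂ , a₃ = apexes′ R₁ R₄ R₂ R₃ (swap₂₃ (swap₃₄ g)) e₂
              (trans (size-swap R₃ R₁) (trans e₁ (trans (size-swap R₁ R₄) (trans e₄ (size-swap R₄ R₃)))))
        in α , β , a₁ , a₂ , a₃ , a₄
      go (inj₂ (inj₂ (inj₂ e₃))) (inj₂ (inj₁ e₄)) =
        let α , β , a₂ , a₄ , a₁ , a₃ = apexes′ R₂ R₄ R₁ R₃ (swap₂₃ (swap₃₄ (swap₁₂ g)))
              (trans (size-swap R₁ R₂) (trans e₂ (trans (size-swap R₂ R₄) (trans (sym e₄) (size-swap R₄ R₁))))) e₃
        in α , β , a₁ , a₂ , a₃ , a₄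
      go (inj₂ (inj₂ (inj₂ e₃))) (inj₂ (inj₂ (inj₂ e₄))) =
        let α , β , a₃ , a₄ , a₁ , a₂ = apexes′ R₃ R₄ R₁ R₂ (swap₂₃ (swap₁₂ (swap₃₄ (swap₂₃ g)))) e₁
              (trans (size-swap R₂ R₃) (trans e₃ (trans (size-swap R₃ R₄) (trans (sym e₄) (size-swap R₄ R₂)))))
        in α , β , a₁ , a₂ , a₃ , a₄
      go (inj₂ (inj₁ e₃)) (inj₂ (inj₁ e₄)) = apexes′ R₁ R₂ R₃ R₄ g e₃ e₄
      go (inj₂ (inj₁ e₃)) (inj₂ (inj₂ (inj₂ e₄))) = contradiction e₄ (no-4-cycle R₁ R₂ R₃ R₄ g e₁ e₂ e₃)

    edge : ∀ R₁ R₂ R₃ R₄ → Generic R₁ R₂ R₃ R₄ → size R₁ R₃ ≡ size R₁ R₄ → Together R₁ R₂ R₃ R₄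
    edge R₁ R₂ R₃ R₄ g e₁ = go (pivot R₂ R₁ R₃ R₄ (swap₁₂ g))
      where
      go : Pivot R₂ R₁ R₃ R₄ → Together R₁ R₂ R₃ R₄
      go (inj₁ (α , β , a₂ , a₁ , a₃ , a₄)) = α , β , a₁ , a₂ , a₃ , a₄
      go (inj₂ (inj₁ e₂)) =
          let α , β , a₁ , a₂ , a₄ , a₃ = path R₁ R₂ R₄ R₃ (swap₃₄ g) (sym e₁) e₂
          in α , β , a₁ , a₂ , a₃ , a₄
      go (inj₂ (inj₂ (inj₁ e₂))) = path R₁ R₂ R₃ R₄ g e₁ e₂
      go (inj₂ (inj₂ (inj₂ e₂))) =
        let α , β , a₃ , a₄ , a₁ , a₂ =
              apexes′ R₃ R₄ R₁ R₂ (swap₂₃ (swap₁₂ (swap₃₄ (swap₂₃ g)))) e₁ e₂ in α , β , a₁ , a₂ , a₃ , a₄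

    general-position : ∀ R₁ R₂ R₃ R₄ → Generic R₁ R₂ R₃ R₄ → Together R₁ R₂ R₃ R₄
    general-position R₁ R₂ R₃ R₄ g = go (pivot R₁ R₂ R₃ R₄ g)
      where
      go : Pivot R₁ R₂ R₃ R₄ → Together R₁ R₂ R₃ R₄
      go (inj₁ together) = together
      go (inj₂ (inj₁ e)) =
          let α , β , a₁ , a₄ , a₂ , a₃ = edge R₁ R₄ R₂ R₃ (swap₂₃ (swap₃₄ g)) e
          in α , β , a₁ , a₂ , a₃ , a₄
      go (inj₂ (inj₂ (inj₁ e))) =
          let α , β , a₁ , a₃ , a₂ , a₄ = edge R₁ R₃ R₂ R₄ (swap₂₃ g) e
          in α , β , a₁ , a₂ , a₃ , a₄
      go (inj₂ (inj₂ (inj₂ e))) = edge R₁ R₂ R₃ R₄ g e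

  _#_ : Runner → Runner → Set
  R # R′ = ℤ.∣ vᵢ R ∣ ≢ ℤ.∣ vᵢ R′ ∣

  four-runners : ∀ R₁ R₂ R₃ R₄ → R₁ # R₂ → R₁ # R₃ → R₁ # R₄ → R₂ # R₃ → R₂ # R₄ → R₃ # R₄ →
                 ¬ (minor R₁ R₂ ≡ 0ℤ × minor R₁ R₃ ≡ 0ℤ × minor R₁ R₄ ≡ 0ℤ) → Together R₁ R₂ R₃ R₄
  four-runners R₁ R₂ R₃ R₄ d₁₂ d₁₃ d₁₄ d₂₃ d₂₄ d₃₄ nonparallel
    with minor R₁ R₂ ℤ.≟ 0ℤ | minor R₁ R₃ ℤ.≟ 0ℤ | minor R₁ R₄ ℤ.≟ 0ℤ
  ... | yes m₂ | yes m₃ | yes m₄ = contradiction (m₂ , m₃ , m₄) nonparallel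
  ... | yes m₂ | yes m₃ | no n₄ = pivot-three-parallel R₁ R₂ R₃ R₄ m₂ m₃ n₄ d₁₂ d₁₃ d₂₃
  ... | yes m₂ | no n₃ | yes m₄ =
      let α , β , a₁ , a₂ , a₄ , a₃ = pivot-three-parallel R₁ R₂ R₄ R₃ m₂ m₄ n₃ d₁₂ d₁₄ d₂₄
      in α , β , a₁ , a₂ , a₃ , a₄
  ... | no n₂ | yes m₃ | yes m₄ =
      let α , β , a₁ , a₃ , a₄ , a₂ = pivot-three-parallel R₁ R₃ R₄ R₂ m₃ m₄ n₂ d₁₃ d₁₄ d₃₄
      in α , β , a₁ , a₂ , a₃ , a₄
  ... | yes m₂ | no n₃ | no n₄ = pivot-parallel R₁ R₂ R₃ R₄ m₂ n₃ n₄
  ... | no n₂ | yes m₃ | no n₄ =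
      let α , β , a₁ , a₃ , a₂ , a₄ = pivot-parallel R₁ R₃ R₂ R₄ m₃ n₂ n₄
      in α , β , a₁ , a₂ , a₃ , a₄
  ... | no n₂ | no n₃ | yes m₄ =
      let α , β , a₁ , a₄ , a₂ , a₃ = pivot-parallel R₁ R₄ R₂ R₃ m₄ n₂ n₃
      in α , β , a₁ , a₂ , a₃ , a₄
  ... | no n₂ | no n₃ | no n₄ with minor R₂ R₃ ℤ.≟ 0ℤ | minor R₂ R₄ ℤ.≟ 0ℤ | minor R₃ R₄ ℤ.≟ 0ℤ
  ...   | yes m₃ | yes m₄ | _ =
      let α , β , a₂ , a₃ , a₄ , a₁ = pivot-three-parallel R₂ R₃ R₄ R₁ m₃ m₄ (minor-swap-≢0 R₁ R₂ n₂) d₂₃ d₂₄ d₃₄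
      in α , β , a₁ , a₂ , a₃ , a₄
  ...   | yes m₃ | no n₂₄ | _ =
      let α , β , a₂ , a₃ , a₁ , a₄ = pivot-parallel R₂ R₃ R₁ R₄ m₃ (minor-swap-≢0 R₁ R₂ n₂) n₂₄
      in α , β , a₁ , a₂ , a₃ , a₄
  ...   | no n₂₃ | yes m₄ | _ =
      let α , β , a₂ , a₄ , a₁ , a₃ = pivot-parallel R₂ R₄ R₁ R₃ m₄ (minor-swap-≢0 R₁ R₂ n₂) n₂₃
      in α , β , a₁ , a₂ , a₃ , a₄
  ...   | no n₂₃ | no n₂₄ | yes e₃₄ =
      let α , β , a₃ , a₄ , a₁ , a₂ = pivot-parallel R₃ R₄ R₁ R₂ e₃₄ (minor-swap-≢0 R₁ R₃ n₃) (minor-swap-≢0 R₂ R₃ n₂₃)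
      in α , β , a₁ , a₂ , a₃ , a₄
  ...   | no n₂₃ | no n₂₄ | no n₃₄ = general-position R₁ R₂ R₃ R₄ (generic n₂ n₃ n₄ n₂₃ n₂₄ n₃₄)

  -- Cramer's rule over ℚ and rounding along the flag

  record Vectorℚ : Set where
    constructor vecℚ
    field
      y₀ y₁ y₂ y₃ : ℚ

  open Vectorℚ

  ιᵥ : Vector → Vectorℚ
  ιᵥ (vec a b c d) = vecℚ (ι a) (ι b) (ι c) (ι d)

  H₀ H₁ H₂ H₃ : (v w c : Vectorℚ) → ℚ
  H₀ v w c = (y₁ v * y₃ w - y₃ v * y₁ w) * y₂ c - (y₁ v * y₂ w - y₂ v * y₁ w) * y₃ c
    - (y₂ v * y₃ w - y₃ v * y₂ w) * y₁ c
  H₁ v w c = (y₀ v * y₂ w - y₂ v * y₀ w) * y₃ c + (y₂ v * y₃ w - y₃ v * y₂ w) * y₀ c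
    - (y₀ v * y₃ w - y₃ v * y₀ w) * y₂ c
  H₂ v w c = (y₀ v * y₃ w - y₃ v * y₀ w) * y₁ c - (y₀ v * y₁ w - y₁ v * y₀ w) * y₃ c
    - (y₁ v * y₃ w - y₃ v * y₁ w) * y₀ c
  H₃ v w c = (y₀ v * y₁ w - y₁ v * y₀ w) * y₂ c + (y₁ v * y₂ w - y₂ v * y₁ w) * y₀ c
    - (y₀ v * y₂ w - y₂ v * y₀ w) * y₁ c

  detℚ : (v w c d : Vectorℚ) → ℚ
  detℚ v w c d = H₀ v w c * y₀ d + H₁ v w c * y₁ d + H₂ v w c * y₂ d + H₃ v w c * y₃ d

  ι-₂ : ∀ a b c d → ι (a ℤ.* b ℤ.- c ℤ.* d) ≡ ι a * ι b - ι c * ι d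
  ι-₂ a b c d = trans (ι-- (a ℤ.* b) (c ℤ.* d)) (cong₂ _-_ (ι-* a b) (ι-* c d))

  ∣ι∣≤ : ∀ {n m} → ∥ n ∥ ℤ.≤ m → ∣ ι n ∣ ≤ ι m
  ∣ι∣≤ {n} {m} le = subst (_≤ ι m) (sym (∣ι∣ n)) (ι-mono-≤ le)

  private
    ι-₃ : ∀ {m m′ m″ p p′ p″} x y z → ι m ≡ p → ι m′ ≡ p′ → ι m″ ≡ p″ → ι (m ℤ.* x ℤ.- m′ ℤ.* y ℤ.- m″ ℤ.* z)
      ≡ p * ι x - p′ * ι y - p″ * ι z
    ι-₃ {m} {m′} {m″} x y z refl refl refl =
      trans (ι-- (m ℤ.* x ℤ.- m′ ℤ.* y) (m″ ℤ.* z)) (cong₂ _-_ (ι-₂ m x m′ y) (ι-* m″ z))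

    ι-₃′ : ∀ {m m′ m″ p p′ p″} x y z → ι m ≡ p → ι m′ ≡ p′ → ι m″ ≡ p″ → ι (m ℤ.* x ℤ.+ m′ ℤ.* y ℤ.- m″ ℤ.* z)
      ≡ p * ι x + p′ * ι y - p″ * ι z
    ι-₃′ {m} {m′} {m″} x y z refl refl refl = trans (ι-- (m ℤ.* x ℤ.+ m′ ℤ.* y) (m″ ℤ.* z))
      (cong₂ _-_ (trans (ι-+ (m ℤ.* x) (m′ ℤ.* y)) (cong₂ _+_ (ι-* m x) (ι-* m′ y))) (ι-* m″ z))

    ι-h₀ : ∀ v w c → ι (h₀ v w c) ≡ H₀ (ιᵥ v) (ιᵥ w) (ιᵥ c)
    ι-h₀ (vec v0 v1 v2 v3) (vec w0 w1 w2 w3) (vec c0 c1 c2 c3) =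
      ι-₃ c2 c3 c1 (ι-₂ v1 w3 v3 w1) (ι-₂ v1 w2 v2 w1) (ι-₂ v2 w3 v3 w2)

    ι-h₁ : ∀ v w c → ι (h₁ v w c) ≡ H₁ (ιᵥ v) (ιᵥ w) (ιᵥ c)
    ι-h₁ (vec v0 v1 v2 v3) (vec w0 w1 w2 w3) (vec c0 c1 c2 c3) =
      ι-₃′ c3 c0 c2 (ι-₂ v0 w2 v2 w0) (ι-₂ v2 w3 v3 w2) (ι-₂ v0 w3 v3 w0)

    ι-h₂ : ∀ v w c → ι (h₂ v w c) ≡ H₂ (ιᵥ v) (ιᵥ w) (ιᵥ c)
    ι-h₂ (vec v0 v1 v2 v3) (vec w0 w1 w2 w3) (vec c0 c1 c2 c3) =
      ι-₃ c1 c3 c0 (ι-₂ v0 w3 v3 w0) (ι-₂ v0 w1 v1 w0) (ι-₂ v1 w3 v3 w1)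

    ι-h₃ : ∀ v w c → ι (h₃ v w c) ≡ H₃ (ιᵥ v) (ιᵥ w) (ιᵥ c)
    ι-h₃ (vec v0 v1 v2 v3) (vec w0 w1 w2 w3) (vec c0 c1 c2 c3) =
      ι-₃′ c2 c0 c1 (ι-₂ v0 w1 v1 w0) (ι-₂ v1 w2 v2 w1) (ι-₂ v0 w2 v2 w0)

    ι-det : ∀ v w c d → ι (det v w c d) ≡ detℚ (ιᵥ v) (ιᵥ w) (ιᵥ c) (ιᵥ d)
    ι-det v w c d@(vec d0 d1 d2 d3) =
      trans (ι-+ (h₀ v w c ℤ.* d0 ℤ.+ h₁ v w c ℤ.* d1 ℤ.+ h₂ v w c ℤ.* d2) (h₃ v w c ℤ.* d3)) (cong₂ _+_
      (trans (ι-+ (h₀ v w c ℤ.* d0 ℤ.+ h₁ v w c ℤ.* d1) (h₂ v w c ℤ.* d2)) (cong₂ _+_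
        (trans (ι-+ (h₀ v w c ℤ.* d0) (h₁ v w c ℤ.* d1)) (cong₂ _+_
          (trans (ι-* (h₀ v w c) d0) (cong (_* ι d0) (ι-h₀ v w c)))
            (trans (ι-* (h₁ v w c) d1) (cong (_* ι d1) (ι-h₁ v w c)))))
        (trans (ι-* (h₂ v w c) d2) (cong (_* ι d2) (ι-h₂ v w c)))))
      (trans (ι-* (h₃ v w c) d3) (cong (_* ι d3) (ι-h₃ v w c))))

    combination : ∀ {D} x a p b q c r d s → D ≡ 1ℚ → x * D ≡ p * a + q * b + r * c + s * d → x
      ≡ p * a + q * b + r * c + s * d
    combination x a p b q c r d s refl eq = trans (sym (*-identityʳ x)) eq

    det-polynomial : ∀ {n} (v0 v1 v2 v3 w0 w1 w2 w3 c0 c1 c2 c3 d0 d1 d2 d3 : Polynomial n) → Polynomial n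
    det-polynomial v0 v1 v2 v3 w0 w1 w2 w3 c0 c1 c2 c3 d0 d1 d2 d3 =
      ((v1 :* w3 :- v3 :* w1) :* c2 :- (v1 :* w2 :- v2 :* w1) :* c3 :- (v2 :* w3 :- v3 :* w2) :* c1) :* d0
        :+ ((v0 :* w2 :- v2 :* w0) :* c3 :+ (v2 :* w3 :- v3 :* w2) :* c0 :- (v0 :* w3 :- v3 :* w0) :* c2) :* d1
        :+ ((v0 :* w3 :- v3 :* w0) :* c1 :- (v0 :* w1 :- v1 :* w0) :* c3 :- (v1 :* w3 :- v3 :* w1) :* c0) :* d2
        :+ ((v0 :* w1 :- v1 :* w0) :* c2 :+ (v1 :* w2 :- v2 :* w1) :* c0 :- (v0 :* w2 :- v2 :* w0) :* c1) :* d3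

    cramer₀ : ∀ v w c d x → detℚ v w c d ≡ 1ℚ → y₀ x
      ≡ detℚ x w c d * y₀ v + detℚ v x c d * y₀ w + detℚ v w x d * y₀ c + detℚ v w c x * y₀ d
    cramer₀ v@(vecℚ v0 v1 v2 v3) w@(vecℚ w0 w1 w2 w3) c@(vecℚ c0 c1 c2 c3) d@(vecℚ d0 d1 d2 d3) x@(vecℚ x0 x1 x2 x3)
      eq = combination x0 v0 (detℚ x w c d) w0 (detℚ v x c d) c0 (detℚ v w x d) d0 (detℚ v w c x) eq
      (solve 20 (λ v0 v1 v2 v3 w0 w1 w2 w3 c0 c1 c2 c3 d0 d1 d2 d3 x0 x1 x2 x3 →
        x0 :* det-polynomial v0 v1 v2 v3 w0 w1 w2 w3 c0 c1 c2 c3 d0 d1 d2 d3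
        := det-polynomial x0 x1 x2 x3 w0 w1 w2 w3 c0 c1 c2 c3 d0 d1 d2 d3 :* v0
          :+ det-polynomial v0 v1 v2 v3 x0 x1 x2 x3 c0 c1 c2 c3 d0 d1 d2 d3 :* w0
        :+ det-polynomial v0 v1 v2 v3 w0 w1 w2 w3 x0 x1 x2 x3 d0 d1 d2 d3 :* c0
          :+ det-polynomial v0 v1 v2 v3 w0 w1 w2 w3 c0 c1 c2 c3 x0 x1 x2 x3 :* d0) refl v0 v1 v2 v3 w0 w1 w2 w3 c0 c1 c2
          c3 d0 d1 d2 d3 x0 x1 x2 x3)

    cramer₁ : ∀ v w c d x → detℚ v w c d ≡ 1ℚ → y₁ x
      ≡ detℚ x w c d * y₁ v + detℚ v x c d * y₁ w + detℚ v w x d * y₁ c + detℚ v w c x * y₁ d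
    cramer₁ v@(vecℚ v0 v1 v2 v3) w@(vecℚ w0 w1 w2 w3) c@(vecℚ c0 c1 c2 c3) d@(vecℚ d0 d1 d2 d3) x@(vecℚ x0 x1 x2 x3)
      eq = combination x1 v1 (detℚ x w c d) w1 (detℚ v x c d) c1 (detℚ v w x d) d1 (detℚ v w c x) eq
      (solve 20 (λ v0 v1 v2 v3 w0 w1 w2 w3 c0 c1 c2 c3 d0 d1 d2 d3 x0 x1 x2 x3 →
        x1 :* det-polynomial v0 v1 v2 v3 w0 w1 w2 w3 c0 c1 c2 c3 d0 d1 d2 d3
        := det-polynomial x0 x1 x2 x3 w0 w1 w2 w3 c0 c1 c2 c3 d0 d1 d2 d3 :* v1
          :+ det-polynomial v0 v1 v2 v3 x0 x1 x2 x3 c0 c1 c2 c3 d0 d1 d2 d3 :* w1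
        :+ det-polynomial v0 v1 v2 v3 w0 w1 w2 w3 x0 x1 x2 x3 d0 d1 d2 d3 :* c1
          :+ det-polynomial v0 v1 v2 v3 w0 w1 w2 w3 c0 c1 c2 c3 x0 x1 x2 x3 :* d1) refl v0 v1 v2 v3 w0 w1 w2 w3 c0 c1 c2
          c3 d0 d1 d2 d3 x0 x1 x2 x3)

    cramer₂ : ∀ v w c d x → detℚ v w c d ≡ 1ℚ → y₂ x
      ≡ detℚ x w c d * y₂ v + detℚ v x c d * y₂ w + detℚ v w x d * y₂ c + detℚ v w c x * y₂ d
    cramer₂ v@(vecℚ v0 v1 v2 v3) w@(vecℚ w0 w1 w2 w3) c@(vecℚ c0 c1 c2 c3) d@(vecℚ d0 d1 d2 d3) x@(vecℚ x0 x1 x2 x3)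
      eq = combination x2 v2 (detℚ x w c d) w2 (detℚ v x c d) c2 (detℚ v w x d) d2 (detℚ v w c x) eq
      (solve 20 (λ v0 v1 v2 v3 w0 w1 w2 w3 c0 c1 c2 c3 d0 d1 d2 d3 x0 x1 x2 x3 →
        x2 :* det-polynomial v0 v1 v2 v3 w0 w1 w2 w3 c0 c1 c2 c3 d0 d1 d2 d3
        := det-polynomial x0 x1 x2 x3 w0 w1 w2 w3 c0 c1 c2 c3 d0 d1 d2 d3 :* v2
          :+ det-polynomial v0 v1 v2 v3 x0 x1 x2 x3 c0 c1 c2 c3 d0 d1 d2 d3 :* w2
        :+ det-polynomial v0 v1 v2 v3 w0 w1 w2 w3 x0 x1 x2 x3 d0 d1 d2 d3 :* c2
          :+ det-polynomial v0 v1 v2 v3 w0 w1 w2 w3 c0 c1 c2 c3 x0 x1 x2 x3 :* d2) refl v0 v1 v2 v3 w0 w1 w2 w3 c0 c1 c2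
          c3 d0 d1 d2 d3 x0 x1 x2 x3)

    cramer₃ : ∀ v w c d x → detℚ v w c d ≡ 1ℚ → y₃ x
      ≡ detℚ x w c d * y₃ v + detℚ v x c d * y₃ w + detℚ v w x d * y₃ c + detℚ v w c x * y₃ d
    cramer₃ v@(vecℚ v0 v1 v2 v3) w@(vecℚ w0 w1 w2 w3) c@(vecℚ c0 c1 c2 c3) d@(vecℚ d0 d1 d2 d3) x@(vecℚ x0 x1 x2 x3)
      eq = combination x3 v3 (detℚ x w c d) w3 (detℚ v x c d) c3 (detℚ v w x d) d3 (detℚ v w c x) eq
      (solve 20 (λ v0 v1 v2 v3 w0 w1 w2 w3 c0 c1 c2 c3 d0 d1 d2 d3 x0 x1 x2 x3 →
        x3 :* det-polynomial v0 v1 v2 v3 w0 w1 w2 w3 c0 c1 c2 c3 d0 d1 d2 d3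
        := det-polynomial x0 x1 x2 x3 w0 w1 w2 w3 c0 c1 c2 c3 d0 d1 d2 d3 :* v3
          :+ det-polynomial v0 v1 v2 v3 x0 x1 x2 x3 c0 c1 c2 c3 d0 d1 d2 d3 :* w3
        :+ det-polynomial v0 v1 v2 v3 w0 w1 w2 w3 x0 x1 x2 x3 d0 d1 d2 d3 :* c3
          :+ det-polynomial v0 v1 v2 v3 w0 w1 w2 w3 c0 c1 c2 c3 x0 x1 x2 x3 :* d3) refl v0 v1 v2 v3 w0 w1 w2 w3 c0 c1 c2
          c3 d0 d1 d2 d3 x0 x1 x2 x3)

    ∣sg∣≤1 : ∀ i → ∣ ι (sg i) ∣ ≤ 1ℚ
    ∣sg∣≤1 0F = subst (∣ ι 1ℤ ∣ ≤_) ι1≡1 (∣ι∣≤ {1ℤ} ℤ.≤-refl)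
    ∣sg∣≤1 1F = subst (∣ ι (ℤ.- 1ℤ) ∣ ≤_) ι1≡1 (∣ι∣≤ {ℤ.- 1ℤ} ℤ.≤-refl)

  -- The lattice spanned by ℤ⁴ is reached from any rational vector in three steps: first into
  -- a plane h = n₃, then along c modulo v and w, then along w modulo v. Rounding each time
  -- costs half the reciprocal ratio of consecutive volumes 1, K, A, S.
  covering : ∀ {v} (F : Flag v) → let open Flag F in
             ∀ {rS rA rK} → ι (total v) * rS ≡ 1ℚ → ι A * rA ≡ 1ℚ → ι K * rK ≡ 1ℚ → 0ℚ ≤ rS → 0ℚ ≤ rA → 0ℚ ≤ rK →
             ∀ s → ∃[ t ] let e = ½ * rK * 1ℚ + ½ * (rA * ι K) + ½ * (rS * ι A) in
               Away e (y₀ (ιᵥ v) * t + y₀ s) × Away e (y₁ (ιᵥ v) * t + y₁ s) × Away e (y₂ (ιᵥ v) * t + y₂ s)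
                 × Away e (y₃ (ιᵥ v) * t + y₃ s)
  covering {v@(vec v₀ v₁ v₂ v₃)} F@(flag w@(vec w₀ w₁ w₂ w₃) c@(vec c₀ c₁ c₂ c₃) d@(vec d₀ d₁ d₂ d₃) unimodular) {rS}
    {rA} {rK} SrS≡1 ArA≡1 KrK≡1 0≤rS 0≤rA 0≤rK s@(vecℚ s₀ s₁ s₂ s₃) =
    a₀ + f₂ * (- (N * rA)) + f₁ * (W * rS)
    , coordinate v₀ w₀ c₀ d₀ (sign (h₀ v w c)) s₀
      (trans (cramer₀ V W′ C D x det≡1) (cong (λ z → a₀ * ι v₀ + a₁ * ι w₀ + a₂ * ι c₀ + z * ι d₀) level))
      (row-bound₀ v w) (mean-bound₀ v w c)
    , coordinate v₁ w₁ c₁ d₁ (sign (h₁ v w c)) s₁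
      (trans (cramer₁ V W′ C D x det≡1) (cong (λ z → a₀ * ι v₁ + a₁ * ι w₁ + a₂ * ι c₁ + z * ι d₁) level))
      (row-bound₁ v w) (mean-bound₁ v w c)
    , coordinate v₂ w₂ c₂ d₂ (sign (h₂ v w c)) s₂
      (trans (cramer₂ V W′ C D x det≡1) (cong (λ z → a₀ * ι v₂ + a₁ * ι w₂ + a₂ * ι c₂ + z * ι d₂) level))
      (row-bound₂ v w) (mean-bound₂ v w c)
    , coordinate v₃ w₃ c₃ d₃ (sign (h₃ v w c)) s₃
      (trans (cramer₃ V W′ C D x det≡1) (cong (λ z → a₀ * ι v₃ + a₁ * ι w₃ + a₂ * ι c₃ + z * ι d₃) level))
      (row-bound₃ v w) (mean-bound₃ v w c)
    where
    open Flag F using (A; K)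
    V = ιᵥ v
    W′ = ιᵥ w
    C = ιᵥ c
    D = ιᵥ d
    det≡1 : detℚ V W′ C D ≡ 1ℚ
    det≡1 = trans (sym (ι-det v w c d)) (trans (cong ι unimodular) ι1≡1)
    σ₀ = ι (sgn (h₀ v w c))
    σ₁ = ι (sgn (h₁ v w c))
    σ₂ = ι (sgn (h₂ v w c))
    σ₃ = ι (sgn (h₃ v w c))
    -- The point to be approximated is ½ - s, and ρ is its value under the functional h. Moving by θ
    -- along the sign vector of h changes that value by θ K = f₃, because h takes the value K, its
    -- ℓ¹ norm, there; the sup-norm cost is at most ½/K.
    ρ = H₀ V W′ C * (½ - s₀) + H₁ V W′ C * (½ - s₁) + H₂ V W′ C * (½ - s₂) + H₃ V W′ C * (½ - s₃)
    n₃ = proj₁ (nearest ρ)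
    f₃ = ρ - ι n₃
    θ = f₃ * rK
    x = vecℚ (½ - s₀ - θ * σ₀) (½ - s₁ - θ * σ₁) (½ - s₂ - θ * σ₂) (½ - s₃ - θ * σ₃)
    a₀ = detℚ x W′ C D
    a₁ = detℚ V x C D
    a₂ = detℚ V W′ x D
    N = ι (weigh v w w c)
    M = ι (weigh v w v c)
    W = ι (total w)
    -- By `mean-bound₀` and its companions c is close to (M w - N v)/A. The fraction f₂ of c is
    -- therefore traded for f₂ M/A in the coefficient of w and - f₂ N/A in that of v; afterwards the
    -- fraction f₁ of w is traded for f₁ W/S in the coefficient of v.
    n₂ = proj₁ (nearest a₂)
    f₂ = a₂ - ι n₂
    n₁ = proj₁ (nearest (a₁ + f₂ * (M * rA)))
    f₁ = a₁ + f₂ * (M * rA) - ι n₁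
    K≡ : H₀ V W′ C * σ₀ + H₁ V W′ C * σ₁ + H₂ V W′ C * σ₂ + H₃ V W′ C * σ₃ ≡ ι K
    K≡ = trans (cong₂ _+_ (cong₂ _+_ (cong₂ _+_ (part (h₀ v w c) (ι-h₀ v w c)) (part (h₁ v w c) (ι-h₁ v w c)))
      (part (h₂ v w c) (ι-h₂ v w c))) (part (h₃ v w c) (ι-h₃ v w c)))
      (trans (lem (ι ∥ h₀ v w c ∥) (ι ∥ h₁ v w c ∥) (ι ∥ h₂ v w c ∥) (ι ∥ h₃ v w c ∥))
        (sym (trans (ι-+ ∥ h₀ v w c ∥ _)
          (cong (λ z → ι ∥ h₀ v w c ∥ + z)
          (trans (ι-+ ∥ h₁ v w c ∥ _)
          (cong (λ z → ι ∥ h₁ v w c ∥ + z)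
          (trans (ι-+ ∥ h₂ v w c ∥ _)
          (cong (λ z → ι ∥ h₂ v w c ∥ + z) (trans (ι-+ ∥ h₃ v w c ∥ 0ℤ) (cong (λ z → ι ∥ h₃ v w c ∥ + z) ι0≡0))))))))))
      where
      part : ∀ h {p} → ι h ≡ p → p * ι (sgn h) ≡ ι ∥ h ∥
      part h refl = trans (*-comm (ι h) (ι (sgn h))) (trans (sym (ι-* (sgn h) h)) (cong ι (sgn-* h)))
      lem = solve 4 (λ a b c d → a :+ b :+ c :+ d := a :+ (b :+ (c :+ (d :+ con 0ℚ)))) refl
    level : detℚ V W′ C x ≡ ι n₃
    level = by-eq₂ (- f₃ * rK) (- f₃) K≡ KrK≡1 (solve 15 (λ a b c d s₀ s₁ s₂ s₃ σ₀ σ₁ σ₂ σ₃ n r κ →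
        a :* (con ½ :- s₀ :- (a :* (con ½ :- s₀) :+ b :* (con ½ :- s₁) :+ c :* (con ½ :- s₂) :+ d :* (con ½ :- s₃) :- n)
          :* r :* σ₀)
        :+ b :* (con ½ :- s₁ :- (a :* (con ½ :- s₀) :+ b :* (con ½ :- s₁) :+ c :* (con ½ :- s₂) :+ d :* (con ½ :- s₃)
          :- n) :* r :* σ₁)
        :+ c :* (con ½ :- s₂ :- (a :* (con ½ :- s₀) :+ b :* (con ½ :- s₁) :+ c :* (con ½ :- s₂) :+ d :* (con ½ :- s₃)
          :- n) :* r :* σ₂)
        :+ d :* (con ½ :- s₃ :- (a :* (con ½ :- s₀) :+ b :* (con ½ :- s₁) :+ c :* (con ½ :- s₂) :+ d :* (con ½ :- s₃)
          :- n) :* r :* σ₃) :- n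
        := :- (a :* (con ½ :- s₀) :+ b :* (con ½ :- s₁) :+ c :* (con ½ :- s₂) :+ d :* (con ½ :- s₃) :- n) :* r
          :* (a :* σ₀ :+ b :* σ₁ :+ c :* σ₂ :+ d :* σ₃ :- κ)
          :+ :- (a :* (con ½ :- s₀) :+ b :* (con ½ :- s₁) :+ c :* (con ½ :- s₂) :+ d :* (con ½ :- s₃) :- n) :* (κ :* r
            :- con 1ℚ)) refl (H₀ V W′ C) (H₁ V W′ C) (H₂ V W′ C) (H₃ V W′ C) s₀ s₁ s₂ s₃ σ₀ σ₁ σ₂ σ₃ (ι n₃) rK (ι K))
    e = ½ * rK * 1ℚ + ½ * (rA * ι K) + ½ * (rS * ι A)
    coordinate : ∀ v′ w′ c′ d′ i s′ → ½ - s′ - θ * ι (sg i) ≡ a₀ * ι v′ + a₁ * ι w′ + a₂ * ι c′ + ι n₃ * ι d′ →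
      ∥ total v ℤ.* w′ ℤ.- v′ ℤ.* total w ∥ ℤ.≤ A →
        ∥ weigh v w v w ℤ.* c′ ℤ.+ v′ ℤ.* weigh v w w c ℤ.- w′ ℤ.* weigh v w v c ∥ ℤ.≤ K →
      Away e (ι v′ * (a₀ + f₂ * (- (N * rA)) + f₁ * (W * rS)) + s′)
    coordinate v′ w′ c′ d′ i s′ decomposition b₁ b₂ = away (ℤ.- (n₁ ℤ.* w′ ℤ.+ n₂ ℤ.* c′ ℤ.+ n₃ ℤ.* d′))
      (∣∣-cong (by-eq₃ 1ℚ (- (f₂ * ι c′)) (- (f₁ * ι w′)) decomposition ArA≡1 SrS≡1
          (trans (cong (λ z → - (θ * ι (sg i) + f₂ * (rA * e₂) + f₁ * (rS * e₁))
            - (ι v′ * (a₀ + f₂ * (- (N * rA)) + f₁ * (W * rS)) + s′ - (z + ½))) base)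
            (solve 20 (λ v w c d σ s θ a₀ a₁ a₂ N M W rA rS A S n₁ n₂ n₃ →
        :- (θ :* σ :+ (a₂ :- n₂) :* (rA :* (A :* c :+ v :* N :- w :* M))
          :+ (a₁ :+ (a₂ :- n₂) :* (M :* rA) :- n₁) :* (rS :* (S :* w :- v :* W)))
        :- (v :* (a₀ :+ (a₂ :- n₂) :* (:- (N :* rA)) :+ (a₁ :+ (a₂ :- n₂) :* (M :* rA) :- n₁) :* (W :* rS)) :+ s
          :- (:- (n₁ :* w :+ n₂ :* c :+ n₃ :* d) :+ con ½))
        := con 1ℚ :* (con ½ :- s :- θ :* σ :- (a₀ :* v :+ a₁ :* w :+ a₂ :* c :+ n₃ :* d))
          :+ :- ((a₂ :- n₂) :* c) :* (A :* rA :- con 1ℚ)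
          :+ :- ((a₁ :+ (a₂ :- n₂) :* (M :* rA) :- n₁) :* w) :* (S :* rS :- con 1ℚ)) refl (ι v′) (ι w′) (ι c′) (ι d′)
          (ι (sg i)) s′ θ a₀ a₁ a₂ N M W rA rS (ι A) (ι (total v)) (ι n₁) (ι n₂) (ι n₃))))
        (∣∣-neg {θ * ι (sg i) + f₂ * (rA * e₂) + f₁ * (rS * e₁)}
          (∣∣-+ {θ * ι (sg i) + f₂ * (rA * e₂)} {f₁ * (rS * e₁)} (∣∣-+ {θ * ι (sg i)} {f₂ * (rA * e₂)}
            (∣∣-* {θ} {ι (sg i)} (∣∣-* {f₃} {rK} (proj₂ (nearest ρ)) (∣∣-nonNeg 0≤rK)) (∣sg∣≤1 i))
            (∣∣-* {f₂} {rA * e₂} (proj₂ (nearest a₂))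
              (∣∣-* {rA} {e₂} (∣∣-nonNeg 0≤rA) (subst (λ z → ∣ z ∣ ≤ ι K) e₂≡ (∣ι∣≤ b₂)))))
            (∣∣-* {f₁} {rS * e₁} (proj₂ (nearest (a₁ + f₂ * (M * rA))))
              (∣∣-* {rS} {e₁} (∣∣-nonNeg 0≤rS)
              (subst (λ z → ∣ z ∣ ≤ ι A) (ι-₂ (total v) w′ v′ (total w)) (∣ι∣≤ b₁)))))))
      where
      e₁ = ι (total v) * ι w′ - ι v′ * W
      e₂ = ι A * ι c′ + ι v′ * N - ι w′ * M
      e₂≡ : ι (weigh v w v w ℤ.* c′ ℤ.+ v′ ℤ.* weigh v w w c ℤ.- w′ ℤ.* weigh v w v c) ≡ e₂
      e₂≡ = trans (ι-- (weigh v w v w ℤ.* c′ ℤ.+ v′ ℤ.* weigh v w w c) (w′ ℤ.* weigh v w v c))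
        (cong₂ _-_ (trans (ι-+ (weigh v w v w ℤ.* c′) (v′ ℤ.* weigh v w w c))
          (cong₂ _+_ (trans (ι-* (weigh v w v w) c′) (cong (λ z → ι z * ι c′) (weigh-self v w)))
          (ι-* v′ (weigh v w w c)))) (ι-* w′ (weigh v w v c)))
      base : ι (ℤ.- (n₁ ℤ.* w′ ℤ.+ n₂ ℤ.* c′ ℤ.+ n₃ ℤ.* d′)) ≡ - (ι n₁ * ι w′ + ι n₂ * ι c′ + ι n₃ * ι d′)
      base = trans (ι-neg _) (cong -_
        (trans (ι-+ (n₁ ℤ.* w′ ℤ.+ n₂ ℤ.* c′) (n₃ ℤ.* d′))
        (cong₂ _+_ (trans (ι-+ (n₁ ℤ.* w′) (n₂ ℤ.* c′)) (cong₂ _+_ (ι-* n₁ w′) (ι-* n₂ c′))) (ι-* n₃ d′))))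

  -- Choice between the two covering estimates for given speeds

  Within : ℚ → Vectorℚ → Vectorℚ → ℚ → Set
  Within e v s t = Away e (Vectorℚ.y₀ v * t + Vectorℚ.y₀ s) × Away e (Vectorℚ.y₁ v * t + Vectorℚ.y₁ s)
                 × Away e (Vectorℚ.y₂ v * t + Vectorℚ.y₂ s) × Away e (Vectorℚ.y₃ v * t + Vectorℚ.y₃ s)

  module Speeds (n₀ n₁ n₂ n₃ : ℕ) (p₀ : 0 ℕ.< n₀) (p₁ : 0 ℕ.< n₁) (p₂ : 0 ℕ.< n₂) (p₃ : 0 ℕ.< n₃)
    (d₀₁ : n₀ ≢ n₁) (d₀₂ : n₀ ≢ n₂) (d₀₃ : n₀ ≢ n₃) (d₁₂ : n₁ ≢ n₂) (d₁₃ : n₁ ≢ n₃) (d₂₃ : n₂ ≢ n₃) where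

    v : Vector
    v = vec (+ n₀) (+ n₁) (+ n₂) (+ n₃)

    S : ℕ
    S = n₀ ℕ.+ n₁ ℕ.+ n₂ ℕ.+ n₃

    private
      +≢0 : ∀ {n} → 0 ℕ.< n → + n ≢ 0ℤ
      +≢0 0<n eq = ℕ.<⇒≢ 0<n (sym (ℤ.+-injective eq))

    -- The plane spanned by v and w contains a point far from all integers in every
    -- coordinate; the multiple of w is then rounded to an integer.
    planar : ∀ (F : Flag v) → let open Flag F in A ≢ 0ℤ → ∀ {rS} → ν S * rS ≡ 1ℚ → 0ℚ ≤ rS →
             ∀ s → ∃[ t ] Within (¼ + ½ * (rS * ι A)) (ιᵥ v) s t
    planar F@(flag w@(vec w₀ w₁ w₂ w₃) c d unimodular) A≢0 {rS} SrS≡1 0≤rS (vecℚ s₀ s₁ s₂ s₃) =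
      let α , β , a₀ , a₁ , a₂ , a₃ =
            four-runners (runner (+ n₀) w₀ s₀ (+≢0 p₀)) (runner (+ n₁) w₁ s₁ (+≢0 p₁)) (runner (+ n₂) w₂ s₂ (+≢0 p₂))
            (runner (+ n₃) w₃ s₃ (+≢0 p₃))
                                        d₀₁ d₀₂ d₀₃ d₁₂ d₁₃ d₂₃ nonparallel
          n , ∣f∣≤½ = nearest β
      in α + (β - ι n) * (W * rS)
        , coordinate α β n ∣f∣≤½ (+ n₀) w₀ s₀ (row-bound₀ v w) a₀ , coordinate α β n ∣f∣≤½ (+ n₁) w₁ s₁ (row-bound₁ v w)
          a₁
        , coordinate α β n ∣f∣≤½ (+ n₂) w₂ s₂ (row-bound₂ v w) a₂ , coordinate α β n ∣f∣≤½ (+ n₃) w₃ s₃ (row-bound₃ v w)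
          a₃
      where
      open Flag F using (A)
      W = ι (total w)
      coordinate : ∀ α β n → ∣ β - ι n ∣ ≤ ½ → ∀ v′ w′ s′ → ∥ total v ℤ.* w′ ℤ.- v′ ℤ.* total w ∥ ℤ.≤ A →
        Away ¼ (ι v′ * α + ι w′ * β + s′) →
                   Away (¼ + ½ * (rS * ι A)) (ι v′ * (α + (β - ι n) * (W * rS)) + s′)
      coordinate α β n ∣f∣≤½ v′ w′ s′ b a =
        away-cong (by-eq (ι w′ * (β - ι n)) (sym SrS≡1)
        (trans (cong (λ z → ι v′ * α + ι w′ * β + s′ + z + - ((β - ι n) * (rS * e))
        - (ι v′ * (α + (β - ι n) * (W * rS)) + s′))
            (trans (ι-neg (w′ ℤ.* n)) (cong -_ (ι-* w′ n)))) (lem (ι v′) (ι w′) s′ α β (ι n) W rS (ν S))))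
        (away-+ {x = - ((β - ι n) * (rS * e))}
          (∣∣-neg {(β - ι n) * (rS * e)} (∣∣-* {β - ι n} {rS * e} ∣f∣≤½ (∣∣-* {rS} {e} (∣∣-nonNeg 0≤rS)
          (subst (λ z → ∣ z ∣ ≤ ι A) (ι-₂ (total v) w′ v′ (total w)) (∣ι∣≤ b))))) (away-+ι (ℤ.- (w′ ℤ.* n)) a))
        where
        e = ν S * ι w′ - ι v′ * W
        lem = solve 9 (λ v w s α β n W r S →
          v :* α :+ w :* β :+ s :+ :- (w :* n) :+ :- ((β :- n) :* (r :* (S :* w :- v :* W)))
          :- (v :* (α :+ (β :- n) :* (W :* r)) :+ s) := w :* (β :- n) :* (con 1ℚ :- S :* r)) refl
      nonparallel : ¬ (+ n₀ ℤ.* w₁ ℤ.- w₀ ℤ.* + n₁ ≡ 0ℤ × + n₀ ℤ.* w₂ ℤ.- w₀ ℤ.* + n₂ ≡ 0ℤ × + n₀ ℤ.* w₃ ℤ.- w₀ ℤ.* + n₃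
        ≡ 0ℤ)
      nonparallel (y₁ , y₂ , y₃) = A≢0 (cong₆ z₁ z₂ z₃
        (other (+ n₁) w₁ (+ n₂) w₂ z₁ z₂) (other (+ n₁) w₁ (+ n₃) w₃ z₁ z₃) (other (+ n₂) w₂ (+ n₃) w₃ z₂ z₃))
        where
        flip : ∀ n w w′ n′ → n ℤ.* w′ ℤ.- w ℤ.* n′ ≡ 0ℤ → n ℤ.* w′ ℤ.- n′ ℤ.* w ≡ 0ℤ
        flip n w w′ n′ = trans (cong (λ z → n ℤ.* w′ ℤ.- z) (ℤ.*-comm n′ w))
        z₁ = flip (+ n₀) w₀ w₁ (+ n₁) y₁
        z₂ = flip (+ n₀) w₀ w₂ (+ n₂) y₂
        z₃ = flip (+ n₀) w₀ w₃ (+ n₃) y₃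
        other : ∀ a b a′ b′ → + n₀ ℤ.* b ℤ.- a ℤ.* w₀ ≡ 0ℤ → + n₀ ℤ.* b′ ℤ.- a′ ℤ.* w₀ ≡ 0ℤ → a ℤ.* b′ ℤ.- a′ ℤ.* b ≡ 0ℤ
        other a b a′ b′ z z′ = [ (λ eq → contradiction eq (+≢0 p₀)) , (λ eq → eq) ]′ (ℤ.i*j≡0⇒i≡0∨j≡0 (+ n₀)
          (trans (k (+ n₀) w₀ a b a′ b′) (trans (cong₂ (λ x y → a ℤ.* x ℤ.- a′ ℤ.* y) z′ z) (k₀ a a′))))
          where
          k : ∀ n w a b a′ b′ → n ℤ.* (a ℤ.* b′ ℤ.- a′ ℤ.* b)
            ≡ a ℤ.* (n ℤ.* b′ ℤ.- a′ ℤ.* w) ℤ.- a′ ℤ.* (n ℤ.* b ℤ.- a ℤ.* w)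
          k = ℤR.solve-∀
          k₀ : ∀ a a′ → a ℤ.* 0ℤ ℤ.- a′ ℤ.* 0ℤ ≡ 0ℤ
          k₀ = ℤR.solve-∀

    3/10 : ℚ
    3/10 = + 3 / 10

    module _ (F : Flag v) (196≤S : 196 ℕ.≤ S) where
      open Flag F

      private
        a k : ℕ
        a = ℤ.∣ A ∣
        k = ℤ.∣ K ∣

        A≡ : A ≡ + a
        A≡ = sym (ℤ.0≤i⇒+∣i∣≡i (∥∥₁-nonNeg (bivector v w)))
        K≡ : K ≡ + k
        K≡ = sym (ℤ.0≤i⇒+∣i∣≡i (∥∥₁-nonNeg (trivector v w c)))

        -- The trivector is orthogonal to v, hence an integer relation between the four distinct
        -- speeds; it is nonzero because its pairing with d is 1.
        3≤k : 3 ℕ.≤ k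
        3≤k = weight≥3 ((n₀ , h₀ v w c) ∷ (n₁ , h₁ v w c) ∷ (n₂ , h₂ v w c) ∷ (n₃ , h₃ v w c) ∷ [])
          (p₀ ∷ p₁ ∷ p₂ ∷ p₃ ∷ []) ((d₀₁ ∷ d₀₂ ∷ d₀₃ ∷ []) ∷ (d₁₂ ∷ d₁₃ ∷ []) ∷ (d₂₃ ∷ []) ∷ [] ∷ [])
          (trans (regroup (+ n₀ ℤ.* h₀ v w c) (+ n₁ ℤ.* h₁ v w c) (+ n₂ ℤ.* h₂ v w c) (+ n₃ ℤ.* h₃ v w c))
            (h·v≡0 v w c))
          λ where
            (z₀ ∷ z₁ ∷ z₂ ∷ z₃ ∷ []) →
              contradiction (trans (sym unimodular)
              (trans (cong₂ (λ x y → x ℤ.* x₀ d ℤ.+ y ℤ.* x₁ d ℤ.+ h₂ v w c ℤ.* x₂ d ℤ.+ h₃ v w c ℤ.* x₃ d) z₀ z₁)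
              (trans (cong₂ (λ x y → 0ℤ ℤ.* x₀ d ℤ.+ 0ℤ ℤ.* x₁ d ℤ.+ x ℤ.* x₂ d ℤ.+ y ℤ.* x₃ d) z₂ z₃)
                (zero-row (x₀ d) (x₁ d) (x₂ d) (x₃ d))))) λ ()
          where
          regroup : ∀ a b c d → a ℤ.+ (b ℤ.+ (c ℤ.+ (d ℤ.+ 0ℤ))) ≡ a ℤ.+ b ℤ.+ c ℤ.+ d
          regroup = ℤR.solve-∀
          zero-row : ∀ a b c d → 0ℤ ℤ.* a ℤ.+ 0ℤ ℤ.* b ℤ.+ 0ℤ ℤ.* c ℤ.+ 0ℤ ℤ.* d ≡ 0ℤ
          zero-row = ℤR.solve-∀

        S-inverse = inverse⁺ (ν S) (0<ν (ℕ.<-≤-trans (ℕ.s≤s ℕ.z≤n) 196≤S))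
        rS = proj₁ S-inverse
        SrS≡1 = proj₁ (proj₂ S-inverse)
        0<rS = proj₂ (proj₂ S-inverse)

      solvable : Reduced F → ∃[ e ] (e < 3/10 × (∀ s → ∃[ t ] Within e (ιᵥ v) s t))
      solvable (KK≤2A , AA≤2SK) = go (ℕ.<-≤-connex (10 ℕ.* a) S)
        where
        kk≤2a : k ℕ.* k ℕ.≤ 2 ℕ.* a
        kk≤2a = ℤ.drop‿+≤+ (subst₂ ℤ._≤_ (trans (cong₂ ℤ._*_ K≡ K≡) (sym (ℤ.pos-* k k)))
          (trans (cong (+ 2 ℤ.*_) A≡) (sym (ℤ.pos-* 2 a))) KK≤2A)
        aa≤2Sk : a ℕ.* a ℕ.≤ 2 ℕ.* (S ℕ.* k)
        aa≤2Sk = ℤ.drop‿+≤+ (subst₂ ℤ._≤_ (trans (cong₂ ℤ._*_ A≡ A≡) (sym (ℤ.pos-* a a)))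
          (trans (cong (+ 2 ℤ.*_) (trans (cong₂ ℤ._*_ (cong +_ (comps-v n₀ n₁ n₂ n₃)) K≡) (sym (ℤ.pos-* S k))))
            (sym (ℤ.pos-* 2 (S ℕ.* k)))) AA≤2SK)
          where
          comps-v : ∀ n₀ n₁ n₂ n₃ → n₀ ℕ.+ (n₁ ℕ.+ (n₂ ℕ.+ (n₃ ℕ.+ 0))) ≡ n₀ ℕ.+ n₁ ℕ.+ n₂ ℕ.+ n₃
          comps-v = ℕR.solve-∀
        0<a : 0 ℕ.< a
        0<a = ℕ.n≢0⇒n>0 λ a≡0 → ℕ.<⇒≱ (ℕ.*-mono-< (ℕ.≤-trans (ℕ.s≤s ℕ.z≤n) 3≤k) (ℕ.≤-trans (ℕ.s≤s ℕ.z≤n) 3≤k))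
          (subst (λ z → k ℕ.* k ℕ.≤ 2 ℕ.* z) a≡0 kk≤2a)
        go : 10 ℕ.* a ℕ.< S ⊎ S ℕ.≤ 10 ℕ.* a → ∃[ e ] (e < 3/10 × (∀ s → ∃[ t ] Within e (ιᵥ v) s t))
        go (inj₁ 10a<S) = ¼ + ½ * (rS * ι A) , 0<-⇒<
          (0<-* (0<-* (positive⁻¹ 1/20) 0<rS) (<⇒0<- (ι-mono-< (ℤ.+<+ 10a<S))))
            (by-eq 1/20 SrS≡1 (trans (cong₂ (λ x y → 1/20 * rS * (ν S - x) - (3/10 - (¼ + ½ * (rS * y))))
              (trans (ν-* 10 a) (cong (_* ν a) (ι-def (+ 10)))) (cong ι A≡)) (lem (ν a) rS (ν S))))
          , planar F (λ A≡0 → ℕ.<⇒≢ 0<a (sym (cong ℤ.∣_∣ A≡0))) SrS≡1 (<⇒≤ 0<rS)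
          where
          1/20 10ℚ : ℚ
          1/20 = + 1 / 20
          10ℚ = + 10 / 1
          lem = solve 3 (λ a r S → con 1/20 :* r :* (S :- con 10ℚ :* a) :- (con 3/10 :- (con ¼ :+ con ½ :* (r :* a)))
            := con 1/20 :* (S :* r :- con 1ℚ)) refl
        go (inj₂ S≤10a) = ½ * rK * 1ℚ + ½ * (rA * ι K) + ½ * (rS * ι A)
          -- The inequality of `ratios` divided by 10 a k S.
          , 0<-⇒< (0<-* (0<-* (0<-* (0<-* (positive⁻¹ 1/10) 0<rA) 0<rK) 0<rS)
            (<⇒0<- (ι-mono-< (ℤ.+<+ (ratios {S} {a} {k} 196≤S 3≤k kk≤2a aa≤2Sk S≤10a)))))
              (trans (cong₂ (λ x y → 1/10 * rA * rK * rS * (x - y)) lhs rhs)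
                (trans (by-eq₃ (1/10 * (3ℚ * (ν k * rK) * (ν S * rS)
                  - 5ℚ * ((ν k * rK) * (ν a * rS) + (ν S * rS) * rK)))
                               (1/10 * (3ℚ * (ν S * rS) - 5ℚ * (ν a * rS + (ν S * rS) * (ν k * rA))))
                               (1/10 * (3ℚ - 5ℚ * (ν k * rA + rK))) ArA≡1 KrK≡1 SrS≡1 (lem (ν a) (ν k) (ν S) rA rK rS))
                  (cong₂ (λ x y → 3/10 - (½ * rK * 1ℚ + ½ * (rA * x) + ½ * (rS * y))) (cong ι (sym K≡))
                    (cong ι (sym A≡)))))
          , λ s → covering F SrS≡1 (trans (cong (λ z → ι z * rA) A≡) ArA≡1) (trans (cong (λ z → ι z * rK) K≡) KrK≡1)
            (<⇒≤ 0<rS) (<⇒≤ 0<rA) (<⇒≤ 0<rK) s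
          where
          1/10 5ℚ : ℚ
          1/10 = + 1 / 10
          5ℚ = + 5 / 1
          A-inverse = inverse⁺ (ν a) (0<ν 0<a)
          rA = proj₁ A-inverse
          ArA≡1 = proj₁ (proj₂ A-inverse)
          0<rA = proj₂ (proj₂ A-inverse)
          K-inverse = inverse⁺ (ν k) (0<ν (ℕ.≤-trans (ℕ.s≤s ℕ.z≤n) 3≤k))
          rK = proj₁ K-inverse
          KrK≡1 = proj₁ (proj₂ K-inverse)
          0<rK = proj₂ (proj₂ K-inverse)
          lhs : ν (3 ℕ.* (a ℕ.* k ℕ.* S)) ≡ 3ℚ * (ν a * ν k * ν S)
          lhs = trans (ν-* 3 (a ℕ.* k ℕ.* S))
            (cong₂ _*_ (ι-def (+ 3)) (trans (ν-* (a ℕ.* k) S) (cong (_* ν S) (ν-* a k))))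
          rhs : ν (5 ℕ.* (a ℕ.* a ℕ.* k ℕ.+ k ℕ.* k ℕ.* S ℕ.+ a ℕ.* S))
            ≡ 5ℚ * (ν a * ν a * ν k + ν k * ν k * ν S + ν a * ν S)
          rhs = trans (ν-* 5 (a ℕ.* a ℕ.* k ℕ.+ k ℕ.* k ℕ.* S ℕ.+ a ℕ.* S))
            (cong₂ _*_ (ι-def (+ 5)) (trans (ν-+ (a ℕ.* a ℕ.* k ℕ.+ k ℕ.* k ℕ.* S) (a ℕ.* S))
            (cong₂ _+_ (trans (ν-+ (a ℕ.* a ℕ.* k) (k ℕ.* k ℕ.* S))
              (cong₂ _+_ (trans (ν-* (a ℕ.* a) k) (cong (_* ν k) (ν-* a a)))
              (trans (ν-* (k ℕ.* k) S) (cong (_* ν S) (ν-* k k))))) (ν-* a S))))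
          lem = solve 6 (λ a k S rA rK rS →
            con 1/10 :* rA :* rK :* rS :* (con 3ℚ :* (a :* k :* S) :- con 5ℚ :* (a :* a :* k :+ k :* k :* S :+ a :* S))
              :- (con 3/10 :- (con ½ :* rK :* con 1ℚ :+ con ½ :* (rA :* k) :+ con ½ :* (rS :* a)))
            := con 1/10 :* (con 3ℚ :* (k :* rK) :* (S :* rS) :- con 5ℚ :* ((k :* rK) :* (a :* rS) :+ (S :* rS) :* rK))
              :* (a :* rA :- con 1ℚ)
              :+ con 1/10 :* (con 3ℚ :* (S :* rS) :- con 5ℚ :* (a :* rS :+ (S :* rS) :* (k :* rA))) :* (k :* rK
                :- con 1ℚ)
              :+ con 1/10 :* (con 3ℚ :- con 5ℚ :* (k :* rA :+ rK)) :* (S :* rS :- con 1ℚ)) refl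

  -- Distances to the integers and passage to real shifts

  private
    ½≤∣ι-½∣ : ∀ k → ½ ≤ ∣ ι k - ½ ∣
    ½≤∣ι-½∣ k = go (k ℤ.≤? 0ℤ)
      where
      l₁ : ∀ k → 0ℚ - k ≡ - (k - ½) - ½
      l₁ = solve-∀ ℚ-ring
      l₂ : ∀ k → k - 1ℚ ≡ k - ½ - ½
      l₂ = solve-∀ ℚ-ring
      go : Dec (k ℤ.≤ 0ℤ) → ½ ≤ ∣ ι k - ½ ∣
      go (yes k≤0) = ≤-trans (0≤-⇒≤ (≤⇒0≤- (subst (ι k ≤_) ι0≡0 (ι-mono-≤ k≤0))) (l₁ (ι k)))
        (∣x∣≤e⇒-x≤e {ι k - ½} ≤-refl)
      go (no k≰0) = ≤-trans (0≤-⇒≤ (≤⇒0≤- (subst (_≤ ι k) ι1≡1 (ι-mono-≤ (ℤ.i<j⇒suc[i]≤j (ℤ.≰⇒> k≰0))))) (l₂ (ι k)))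
        (x≤∣x∣ (ι k - ½))

  -- An integer m and a half-integer n + ½ are at least ½ apart. If q is within 3/10 of the latter,
  -- then it is at least ½ - 3/10 from the former, in particular from an m that attains the
  -- distance.
  away⇒≤distℤ : ∀ {q} → Away (+ 3 / 10) q → + 1 / 5 ≤ distℤ q
  away⇒≤distℤ {q} (away n near) =
    let m , attained = distℤ-attained q
    in 0≤-⇒≤ (≤⇒0≤- (≤-trans (½≤∣ι-½∣ (m ℤ.- n))
      (∣∣-cong {q - (ι n + ½) + - (q - ι m)} (trans (l₁ q (ι n) (ι m)) (cong (_- ½) (sym (ι-- m n))))
         (∣∣-+ {q - (ι n + ½)} { - (q - ι m)} near (∣∣-neg {q - ι m} ≤-refl)))))
       (trans (l₂ ∣ q - ι m ∣) (cong (λ z → z - + 1 / 5) (trans (cong (λ z → ∣ q - z ∣) (ι-def m)) (sym attained))))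
    where
    l₁ = solve 3 (λ q n m → q :- (n :+ con ½) :+ :- (q :- m) := m :- n :- con ½) refl
    l₂ : ∀ x → + 3 / 10 + x - ½ ≡ x - + 1 / 5
    l₂ = solve-∀ ℚ-ring

  real-shifts : ∀ {e} (n : Fin 4 → ℕ) → e < + 3 / 10 →
    (∀ s → ∃[ t ] Within e (ιᵥ (vec (+ n 0F) (+ n 1F) (+ n 2F) (+ n 3F))) s t) →
    (s : Fin 4 → ℝ) → ∃[ t ] (∀ i → ‖ fromℕ (n i) *ℝ t +ℝ s i ‖ ≥ℝ fromℚ (+ 1 / 5))
  real-shifts {e} n e<3/10 within s =
    let t , a₀ , a₁ , a₂ , a₃ = within (vecℚ (seq (s 0F) N) (seq (s 1F) N) (seq (s 2F) N) (seq (s 3F) N))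
    in fromℚ t , λ where
         0F → limit 0F t (ℕ.≤-trans (ℕ.m≤m⊔n (M 0F) (M 1F)) (ℕ.m≤m⊔n (M 0F ℕ.⊔ M 1F) (M 2F ℕ.⊔ M 3F))) a₀
         1F → limit 1F t (ℕ.≤-trans (ℕ.m≤n⊔m (M 0F) (M 1F)) (ℕ.m≤m⊔n (M 0F ℕ.⊔ M 1F) (M 2F ℕ.⊔ M 3F))) a₁
         2F → limit 2F t (ℕ.≤-trans (ℕ.m≤m⊔n (M 2F) (M 3F)) (ℕ.m≤n⊔m (M 0F ℕ.⊔ M 1F) (M 2F ℕ.⊔ M 3F))) a₂
         3F → limit 3F t (ℕ.≤-trans (ℕ.m≤n⊔m (M 2F) (M 3F)) (ℕ.m≤n⊔m (M 0F ℕ.⊔ M 1F) (M 2F ℕ.⊔ M 3F))) a₃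
    where
    -- The slack left by the strict bound. Beyond the index N all shifts stay within η of their N-th
    -- terms, so that the rational time found for these terms serves for all later ones.
    η = + 3 / 10 - e
    0<η : 0ℚ < η
    0<η = <⇒0<- e<3/10
    M : Fin 4 → ℕ
    M i = proj₁ (cauchy (s i) η 0<η)
    N = M 0F ℕ.⊔ M 1F ℕ.⊔ (M 2F ℕ.⊔ M 3F)
    limit : ∀ i t → M i ℕ.≤ N → Away e (ν (n i) * t + seq (s i) N) →
      ‖ fromℕ (n i) *ℝ fromℚ t +ℝ s i ‖ ≥ℝ fromℚ (+ 1 / 5)
    limit i t M≤N a ε 0<ε = N , λ m N≤m → ≤-trans
      (away⇒≤distℤ (away-cong (trans (l₁ (ν (n i)) t (seq (s i) N) (seq (s i) m))
        (cong (λ z → z * t + seq (s i) m) (ι-def (+ n i))))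
        (away-mono (≤-reflexive (l₂ e))
          (away-+ {x = seq (s i) m - seq (s i) N} (proj₂ (cauchy (s i) η 0<η) m N (ℕ.≤-trans M≤N N≤m) M≤N) a))))
      (0≤-⇒≤ (<⇒≤ 0<ε) (l₃ ε (distℤ (+ n i / 1 * t + seq (s i) m))))
      where
      l₁ = solve 4 (λ v t x y → v :* t :+ x :+ (y :- x) := v :* t :+ y) refl
      l₂ : ∀ e → e + (+ 3 / 10 - e) ≡ + 3 / 10
      l₂ = solve-∀ ℚ-ring
      l₃ : ∀ ε x → ε ≡ x + ε - x
      l₃ = solve-∀ ℚ-ring

open import Data.Fin.Base using (Fin)
open import Data.Fin.Patterns using (0F; 1F; 2F; 3F)
open import Data.Integer.Base using (+_)
open import Data.Nat.Base using (ℕ; _+_; _<_; _≥_)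
open import Data.Nat.GCD using (gcd)
open import Data.Product.Base using (∃-syntax; _,_)
open import Data.Rational.Base using (_/_)
open import Function.Definitions using (Injective)
open import Relation.Binary.PropositionalEquality using (_≡_; _≢_)

corollary1p11 : (v : Fin 4 → ℕ) →
    (∀ i → 0 < v i) →
    Injective _≡_ _≡_ v →
    gcd (v 0F) (gcd (v 1F) (gcd (v 2F) (v 3F))) ≡ 1 →
    v 0F + v 1F + v 2F + v 3F ≥ 196 →
    (s : Fin 4 → ℝ) →
    ∃[ t ] (∀ i → ‖ fromℕ (v i) *ℝ t +ℝ s i ‖ ≥ℝ fromℚ (+ 1 / 5))
corollary1p11 v 0<v injective gcd≡1 196≤S s =
  let F , reduced = Integral.reduce (Integral.complete (v 0F) (v 1F) (v 2F) (v 3F) (0<v 1F) (0<v 2F) gcd≡1)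
      e , e<3/10 , solve = Solution.solvable F 196≤S reduced
  in Rational.real-shifts v e<3/10 solve s
  where
  distinct : ∀ {i j} → i ≢ j → v i ≢ v j
  distinct i≢j eq = i≢j (injective eq)
  module Solution = Rational.Speeds (v 0F) (v 1F) (v 2F) (v 3F) (0<v 0F) (0<v 1F) (0<v 2F) (0<v 3F)
    (distinct λ ()) (distinct λ ()) (distinct λ ()) (distinct λ ()) (distinct λ ()) (distinct λ ())
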